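{- Let $d\ge1$, $r_1,\dots,r_d\in\mathbb{Z}$, and let $(U_n)_{n\ge0}$ be a sequence of integers with $U_n=r_1U_{n-1}+\cdots+r_dU_{n-d}$ for all $n\ge d$, whose characteristic polynomial $C(x)=x^d-r_1x^{d-1}-\cdots-r_d$ is irreducible over $\mathbb{Q}$. Let $\alpha_0,\dots,\alpha_{d-1}$ be the roots of $C$ and $l_0,\dots,l_{d-1}$ the constants with $U_n=\sum_{i=0}^{d-1}l_i\alpha_i^n$ for all $n\ge0$. Then $(U_n)_{n\ge1}$ almost satisfies the Dold condition if and only if $l_0=l_1=\cdots=l_{d-1}$.
   Context: A sequence of integers $(A_n)_{n\ge1}$ satisfies the Dold condition if $n\mid\sum_{d\mid n}\mu(d)A_{n/d}$ for every $n\in\mathbb{N}_+$ ($\mu$ the Möbius function). It almost satisfies the Dold condition if there is $c\in\mathbb{N}_+$ such that $(cA_n)_{n\ge1}$ satisfies the Dold condition. -}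

module Defs where

open import Level using (Level; _⊔_) renaming (suc to lsuc)
open import Data.Bool using (Bool; true; false; if_then_else_)
open import Data.Nat as ℕ using (ℕ; zero; suc)
open import Data.Nat.Divisibility using (_∣?_)
open import Data.Nat.DivMod using (_/_)
open import Data.Nat.Primality using (prime?)
open import Data.Integer as ℤ using (ℤ; +_; -[1+_])
open import Data.Integer.Divisibility as ℤD using ()
open import Data.Rational as ℚ using (ℚ; 0ℚ)
open import Data.Fin using (Fin; zero; suc)
open import Data.Vec as Vec using (Vec; toList)
open import Data.List as List using (List; []; _∷_; _++_; reverse; upTo)
open import Data.Bool.ListAction using (any)
open import Data.Product using (∃; _×_; _,_)
open import Relation.Nullary using (¬_; ⌊_⌋)
open import Relation.Nullary.Decidable using (_×-dec_)
open import Relation.Binary.PropositionalEquality using (_≡_; _≢_)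
open import Algebra.Bundles using (CommutativeRing)

ΣFinℤ : ∀ {n} → (Fin n → ℤ) → ℤ
ΣFinℤ {zero}  f = + 0
ΣFinℤ {suc n} f = f zero ℤ.+ ΣFinℤ (λ i → f (suc i))

Σ<ℤ : ℕ → (ℕ → ℤ) → ℤ
Σ<ℤ zero    f = + 0
Σ<ℤ (suc n) f = Σ<ℤ n f ℤ.+ f n

hasSquareFactor : ℕ → Bool
hasSquareFactor n = any (λ k → ⌊ (suc (suc k) ℕ.* suc (suc k)) ∣? n ⌋) (upTo n)

ω : ℕ → ℕ
ω n = List.length (List.filter (λ p → prime? p ×-dec (p ∣? n)) (upTo (suc n)))

μ : ℕ → ℤ
μ n = if hasSquareFactor n then + 0 else (ℤ.- (+ 1)) ℤ.^ ω n

-- Dold condition for a sequence (A n)_{n ≥ 1}, given as A : ℕ → ℤ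
-- (the value A 0 is never used).

doldSum : (ℕ → ℤ) → ℕ → ℤ
doldSum A n = Σ<ℤ n (λ k → if ⌊ suc k ∣? n ⌋ then μ (suc k) ℤ.* A (n / suc k) else + 0)

Dold : (ℕ → ℤ) → Set
Dold A = ∀ n → 1 ℕ.≤ n → (+ n) ℤD.∣ doldSum A n

AlmostDold : (ℕ → ℤ) → Set
AlmostDold A = ∃ λ c → 1 ℕ.≤ c × Dold (λ n → (+ c) ℤ.* A n)

-- Linear recurrences  U_n = r_1 U_{n-1} + ... + r_d U_{n-d}
-- r = [r_1, ..., r_d] : Vec ℤ d  (Vec.lookup r i = r_{i+1})

recStep : ∀ {d} → Vec ℤ d → (ℕ → ℤ) → ℕ → ℤ
recStep r U n = ΣFinℤ (λ i → Vec.lookup r i ℤ.* U (n ℕ.∸ suc (Data.Fin.toℕ i)))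
  where import Data.Fin

SatisfiesRec : ∀ {d} → Vec ℤ d → (ℕ → ℤ) → Set
SatisfiesRec {d} r U = ∀ n → d ℕ.≤ n → U n ≡ recStep r U n

-- characteristic polynomial C(x) = x^d - r_1 x^{d-1} - ... - r_d,
-- as its coefficient list, lowest degree first: [-r_d, ..., -r_1, 1]
charPoly : ∀ {d} → Vec ℤ d → List ℤ
charPoly r = reverse (List.map ℤ.-_ (toList r)) ++ (+ 1 ∷ [])

-- Polynomials over ℚ as coefficient lists (lowest degree first),
-- and irreducibility over ℚ.

coeff : List ℚ → ℕ → ℚ
coeff []       _       = 0ℚ
coeff (a ∷ p)  zero    = a
coeff (a ∷ p)  (suc m) = coeff p m

Σ<ℚ : ℕ → (ℕ → ℚ) → ℚ
Σ<ℚ zero    f = 0ℚ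
Σ<ℚ (suc n) f = Σ<ℚ n f ℚ.+ f n

mulCoeff : List ℚ → List ℚ → ℕ → ℚ
mulCoeff p q m = Σ<ℚ (suc m) (λ i → coeff p i ℚ.* coeff q (m ℕ.∸ i))

NonConstant : List ℚ → Set
NonConstant p = ∃ λ i → 1 ℕ.≤ i × coeff p i ≢ 0ℚ

-- irreducible over ℚ: non-constant and not a product of two
-- non-constant polynomials (units of ℚ[x] are the nonzero constants)
Irreducibleℚ : List ℚ → Set
Irreducibleℚ f = NonConstant f ×
  ¬ (∃ λ p → ∃ λ q → NonConstant p × NonConstant q × (∀ m → mulCoeff p q m ≡ coeff f m))

toℚPoly : List ℤ → List ℚ
toℚPoly = List.map (λ z → z ℚ./ 1)

record Field (c ℓ : Level) : Set (lsuc (c ⊔ ℓ)) where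
  field
    commutativeRing : CommutativeRing c ℓ
  open CommutativeRing commutativeRing public
  field
    1≉0     : ¬ (1# ≈ 0#)
    inverse : ∀ x → ¬ (x ≈ 0#) → ∃ λ y → (x * y) ≈ 1#

module FieldOps {c ℓ} (K : Field c ℓ) where
  open Field K hiding (zero)

  ιℕ : ℕ → Carrier
  ιℕ zero    = 0#
  ιℕ (suc n) = 1# + ιℕ n

  ιℤ : ℤ → Carrier
  ιℤ (+ n)     = ιℕ n
  ιℤ -[1+ n ]  = - ιℕ (suc n)

  CharacteristicZero : Set ℓ
  CharacteristicZero = ∀ n → ¬ (ιℕ (suc n) ≈ 0#)

  pow : Carrier → ℕ → Carrier
  pow x zero    = 1#
  pow x (suc n) = x * pow x n

  ΣFin : ∀ {n} → (Fin n → Carrier) → Carrier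
  ΣFin {zero}  f = 0#
  ΣFin {suc n} f = f zero + ΣFin (λ i → f (suc i))

  evalℤ : List ℤ → Carrier → Carrier
  evalℤ []      x = 0#
  evalℤ (a ∷ p) x = ιℤ a + x * evalℤ p x

{-# OPTIONS --safe #-}
-- If all l i are equal, then d U is an integer multiple of the power sums of the roots, which satisfy the Dold
-- condition: by Newton's identities their generating function is, up to sign, the logarithmic derivative of an
-- integral power series with constant term 1, that is, of a product of powers of the 1 - t ^ m.
--
-- Conversely, let c U satisfy the Dold condition. A nonzero multiple u of l lies in ℤ[α], and Tr(u αⁿ) ≡ Tr(u α^{np})
-- modulo every prime p. Since Tr(xᵖ) ≡ Tr(x), this gives Tr((uᵖ - u) α^{np}) ≡ 0, so that uᵖ ≡ u modulo p for all
-- large p by nondegeneracy of the trace form. For such u every p ^ Σ_{j < N} ⌊j / p⌋ divides the Vandermonde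
-- determinant of the N = X ^ 2 points a + b u with 0 ≤ a, b < X: replace the monomials xʲ by the polynomials
-- (xᵖ - x) ^ ⌊j / p⌋ x ^ (j mod p). For large X the resulting divisor, essentially Π_{j < N} j!, exceeds the size
-- O(X) ^ (N (N - 1) / 2) of the determinant, unless u is rational, in which case all l i are equal.
module Submission where

open import Defs
open import Data.Nat using (ℕ; _≤_)
open import Data.Integer using (ℤ)
open import Data.Fin using (Fin)
open import Data.Vec using (Vec)
open import Data.Product using (_×_)
open import Function.Bundles using (_⇔_)
open import Relation.Nullary using (¬_)
open import Relation.Binary.PropositionalEquality using (_≡_)
open import Level using (Level; _⊔_)
open import Data.Nat as ℕ using (zero; suc; z≤n; s≤s; NonZero; _<_; _∸_)
import Data.Nat.Properties as ℕₚ
open import Data.Nat.Divisibility as ℕ∣ using (_∣_; _∤_; _∣?_; divides)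
open import Data.Nat.Primality using (Prime; prime?; euclidsLemma)
open import Data.Integer as ℤ using (+_; -[1+_]; ∣_∣)
import Data.Integer.Properties as ℤₚ
import Data.Integer.Divisibility.Signed as ℤ∣
import Data.Integer.Solver as ℤ-Solver
open import Data.Fin using (toℕ)
open import Data.List as List using (List; []; _∷_; _++_)
open import Data.Product using (∃; _,_; proj₁; proj₂)
open import Data.Sum using (_⊎_; inj₁; inj₂; [_,_]′)
open import Data.Empty using (⊥-elim)
open import Data.Bool using (Bool; true; false; if_then_else_)
open import Relation.Nullary using (yes; no; contradiction; ⌊_⌋)
open import Relation.Binary.PropositionalEquality using (_≢_; refl; sym; trans; cong; cong₂; subst; module ≡-Reasoning)
open import Algebra.Bundles using (CommutativeRing)
open import Function using (_∘_)

-- An element fixed modulo almost all primes by Frobenius is rational by a density theorem; the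
-- Vandermonde estimate is an elementary substitute. Its points need two parameters: with T = N (N -
-- 1) / 2 and N = X ^ 2 points of size O(X), the product of the j! is about X ^ (2 T) and the
-- determinant only O(X) ^ T. The surplus pays for two losses: the primes up to a bound P contribute
-- nothing, and a larger p contributes ⌊j / p⌋ instead of the full exponent of p in j!. Hence a
-- square is compared with a cube, X ^ (4 T) with X ^ (3 T).
--
-- No number field is built. The order lives in the ring `K ^ d`, where α is the vector of the roots
-- and the trace is the sum of the coordinates. This ring has zero divisors, so nonvanishing is
-- expressed as dividing a nonzero integer; irreducibility supplies this for every element of ℤ[α]
-- with a nonzero coordinate, in particular for the derivative δ of the polynomial at α. If δ w = m
-- ≠ 0, then l δ ∈ ℤ[α] shows that m l ∈ ℤ[α], and the trace form is nondegenerate modulo every p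
-- prime to m.

-- Finite sums, the Möbius function and Dold sums

module DoldSums where
  open import Data.Nat.Induction using (<-rec)
  open import Data.Nat.DivMod using (_/_; m*n/n≡m)
  open import Data.List.Properties using (length-++; filter-++; upTo-∷ʳ)
  open import Data.List.Relation.Unary.Any.Properties using (any⁺; any⁻)
  open import Data.List.Membership.Propositional using (find; lose)
  open import Data.List.Membership.Propositional.Properties using (∈-upTo⁺)
  open import Data.Bool.Properties using (T-≡)
  open import Data.Nat.Primality using (¬prime[0]; ¬prime[1]; prime⇒nonZero; prime⇒irreducible)
  open import Data.Nat.Coprimality using (Coprime; coprime-divisor)
  open import Relation.Nullary.Decidable using (toWitness; fromWitness; _×-dec_)
  open import Relation.Unary using (Pred; Decidable)
  open import Function.Bundles using (Equivalence)
  open import Data.Nat.Primality.Factorisation using (factorise)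
  open import Data.List.Relation.Unary.All using (_∷_)
  open ℤ-Solver.+-*-Solver using (solve; _:+_; _:*_; :-_; _:-_; _:=_; con)

  private
    variable
      f g : ℕ → ℤ

  Σ-cong : ∀ n → (∀ k → k < n → f k ≡ g k) → Σ<ℤ n f ≡ Σ<ℤ n g
  Σ-cong zero    eq = refl
  Σ-cong (suc n) eq = cong₂ ℤ._+_ (Σ-cong n (λ k k<n → eq k (ℕₚ.m<n⇒m<1+n k<n))) (eq n ℕₚ.≤-refl)

  Σ-zero : ∀ n → (∀ k → k < n → f k ≡ + 0) → Σ<ℤ n f ≡ + 0
  Σ-zero zero    eq = refl
  Σ-zero (suc n) eq = cong₂ ℤ._+_ (Σ-zero n (λ k k<n → eq k (ℕₚ.m<n⇒m<1+n k<n))) (eq n ℕₚ.≤-refl)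

  Σ-+ : ∀ n → Σ<ℤ n (λ k → f k ℤ.+ g k) ≡ Σ<ℤ n f ℤ.+ Σ<ℤ n g
  Σ-+ zero    = refl
  Σ-+ {f} {g} (suc n) = trans (cong (ℤ._+ (f n ℤ.+ g n)) (Σ-+ n))
    (solve 4 (λ a b x y → (a :+ b) :+ (x :+ y) := (a :+ x) :+ (b :+ y)) refl (Σ<ℤ n f) (Σ<ℤ n g) (f n) (g n))

  Σ-*ˡ : ∀ c n → Σ<ℤ n (λ k → c ℤ.* f k) ≡ c ℤ.* Σ<ℤ n f
  Σ-*ˡ c zero = sym (ℤₚ.*-zeroʳ c)
  Σ-*ˡ {f} c (suc n) = trans (cong (ℤ._+ (c ℤ.* f n)) (Σ-*ˡ c n)) (sym (ℤₚ.*-distribˡ-+ c (Σ<ℤ n f) (f n)))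

  ∣0 : ∀ {m} → m ℤ∣.∣ + 0
  ∣0 = ℤ∣.divides (+ 0) refl

  Σ-∣ : ∀ {m} n → (∀ k → k < n → m ℤ∣.∣ f k) → m ℤ∣.∣ Σ<ℤ n f
  Σ-∣ zero    div = ∣0
  Σ-∣ (suc n) div = ℤ∣.∣m∣n⇒∣m+n (Σ-∣ n (λ k k<n → div k (ℕₚ.m<n⇒m<1+n k<n))) (div n ℕₚ.≤-refl)

  Σ-split : ∀ m n → Σ<ℤ (m ℕ.+ n) f ≡ Σ<ℤ m f ℤ.+ Σ<ℤ n (λ k → f (m ℕ.+ k))
  Σ-split {f} m zero = trans (cong (λ x → Σ<ℤ x f) (ℕₚ.+-identityʳ m)) (sym (ℤₚ.+-identityʳ _))
  Σ-split {f} m (suc n) = trans (cong (λ x → Σ<ℤ x f) (ℕₚ.+-suc m n))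
    (trans (cong (ℤ._+ f (m ℕ.+ n)) (Σ-split m n)) (ℤₚ.+-assoc (Σ<ℤ m f) _ _))

  Σ-truncate : ∀ {m n} → m ≤ n → (∀ k → m ≤ k → k < n → f k ≡ + 0) → Σ<ℤ n f ≡ Σ<ℤ m f
  Σ-truncate {f} {m} {n} m≤n vanish = begin
    Σ<ℤ n f                                        ≡⟨ cong (λ x → Σ<ℤ x f) (sym m+k≡n) ⟩
    Σ<ℤ (m ℕ.+ (n ∸ m)) f                          ≡⟨ Σ-split m (n ∸ m) ⟩
    Σ<ℤ m f ℤ.+ Σ<ℤ (n ∸ m) (λ k → f (m ℕ.+ k))    ≡⟨ cong (λ x → Σ<ℤ m f ℤ.+ x) (Σ-zero (n ∸ m) λ k k< →
        vanish (m ℕ.+ k) (ℕₚ.m≤m+n m k) (subst (m ℕ.+ k <_) m+k≡n (ℕₚ.+-monoʳ-< m k<))) ⟩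
    Σ<ℤ m f ℤ.+ + 0                                ≡⟨ ℤₚ.+-identityʳ _ ⟩
    Σ<ℤ m f                                        ∎
    where
    open ≡-Reasoning
    m+k≡n = ℕₚ.m+[n∸m]≡n m≤n

  -- Möbius function

  private
    Bool-ext : ∀ {a b : Bool} → (a ≡ true → b ≡ true) → (b ≡ true → a ≡ true) → a ≡ b
    Bool-ext {false} {false} _ _ = refl
    Bool-ext {true}  {true}  _ _ = refl
    Bool-ext {false} {true}  _ g = g refl
    Bool-ext {true}  {false} f _ = sym (f refl)

    p∤1 : ∀ {p} → Prime p → p ∤ 1
    p∤1 pp p∣1 with ℕ∣.∣1⇒≡1 p∣1
    ... | refl = ¬prime[1] pp

  square-factor⁺ : ∀ {n} → 1 ≤ n → ∀ k → suc (suc k) ℕ.* suc (suc k) ∣ n → hasSquareFactor n ≡ true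
  square-factor⁺ {n} 1≤n k k²∣n = Equivalence.to T-≡ (any⁺ _ (lose (∈-upTo⁺ k<n) (fromWitness k²∣n)))
    where
    k<n : k < n
    k<n = ℕₚ.<-≤-trans (s≤s (ℕₚ.≤-trans (ℕₚ.n≤1+n k) (ℕₚ.m≤m+n (suc k) _)))
                       (ℕ∣.∣⇒≤ {{ℕ.>-nonZero 1≤n}} k²∣n)

  square-factor⁻ : ∀ n → hasSquareFactor n ≡ true → ∃ λ k → suc (suc k) ℕ.* suc (suc k) ∣ n
  square-factor⁻ n eq with find (any⁻ (λ k → ⌊ (suc (suc k) ℕ.* suc (suc k)) ∣? n ⌋) (List.upTo n) (Equivalence.from T-≡ eq))
  ... | k , _ , t = k , toWitness t

  private
    square∣prime* : ∀ {p j} → Prime p → p ∤ j → ∀ k → k ℕ.* k ∣ p ℕ.* j → k ℕ.* k ∣ j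
    square∣prime* {p} {j} pp p∤j k k²∣pj = coprime-divisor cop k²∣pj
      where
      p∤k : p ∤ k
      p∤k p∣k = p∤j (ℕ∣.*-cancelˡ-∣ p {{prime⇒nonZero pp}} (ℕ∣.∣-trans (ℕ∣.*-pres-∣ p∣k p∣k) k²∣pj))
      cop : Coprime (k ℕ.* k) p
      cop {i} (i∣k² , i∣p) with prime⇒irreducible pp i∣p
      ... | inj₁ i≡1 = i≡1
      ... | inj₂ refl = contradiction i∣k² λ p∣k² → [ p∤k , p∤k ]′ (euclidsLemma k k pp p∣k²)

  hasSquareFactor-prime* : ∀ {p j} → Prime p → 1 ≤ j → p ∤ j → hasSquareFactor (p ℕ.* j) ≡ hasSquareFactor j
  hasSquareFactor-prime* {p} {j} pp 1≤j p∤j = Bool-ext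
    (λ eq → let k , k²∣ = square-factor⁻ (p ℕ.* j) eq in square-factor⁺ 1≤j k (square∣prime* pp p∤j (suc (suc k)) k²∣))
    (λ eq → let k , k²∣ = square-factor⁻ j eq in
      square-factor⁺ (ℕₚ.≤-trans 1≤j (ℕₚ.m≤n*m j p {{prime⇒nonZero pp}})) k (ℕ∣.∣n⇒∣m*n p k²∣))

  count : ∀ {P : Pred ℕ Level.zero} → Decidable P → ℕ → ℕ
  count P? n = List.length (List.filter P? (List.upTo n))

  private
    variable
      P Q : Pred ℕ Level.zero

    count-suc : ∀ (P? : Decidable P) n → count P? (suc n) ≡ count P? n ℕ.+ List.length (List.filter P? (n ∷ []))
    count-suc P? n = trans (cong (List.length ∘ List.filter P?) (sym (upTo-∷ʳ n)))
      (trans (cong List.length (filter-++ P? (List.upTo n) (n ∷ []))) (length-++ (List.filter P? (List.upTo n))))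

    single-cong : ∀ (P? : Decidable P) (Q? : Decidable Q) n → (P n → Q n) → (Q n → P n) →
                  List.length (List.filter P? (n ∷ [])) ≡ List.length (List.filter Q? (n ∷ []))
    single-cong P? Q? n to from with P? n | Q? n
    ... | yes _ | yes _ = refl
    ... | no _  | no _  = refl
    ... | yes p | no ¬q = contradiction (to p) ¬q
    ... | no ¬p | yes q = contradiction (from q) ¬p

    single-yes : ∀ (P? : Decidable P) n → P n → List.length (List.filter P? (n ∷ [])) ≡ 1
    single-yes P? n p with P? n
    ... | yes _ = refl
    ... | no ¬p = contradiction p ¬p

    single-no : ∀ (P? : Decidable P) n → ¬ P n → List.length (List.filter P? (n ∷ [])) ≡ 0
    single-no P? n ¬p with P? n
    ... | yes p = contradiction p ¬p
    ... | no _  = refl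

  count-cong : ∀ (P? : Decidable P) (Q? : Decidable Q) n → (∀ k → k < n → P k → Q k) → (∀ k → k < n → Q k → P k) →
               count P? n ≡ count Q? n
  count-cong P? Q? zero    to from = refl
  count-cong P? Q? (suc n) to from = trans (count-suc P? n) (trans
    (cong₂ ℕ._+_ (count-cong P? Q? n (λ k k<n → to k (ℕₚ.m<n⇒m<1+n k<n)) (λ k k<n → from k (ℕₚ.m<n⇒m<1+n k<n)))
                 (single-cong P? Q? n (to n ℕₚ.≤-refl) (from n ℕₚ.≤-refl)))
    (sym (count-suc Q? n)))

  count-extend : ∀ (P? : Decidable P) n → (∀ k → n ≤ k → ¬ P k) → ∀ m → count P? (m ℕ.+ n) ≡ count P? n
  count-extend P? n none zero    = refl
  count-extend P? n none (suc m) = trans (count-suc P? (m ℕ.+ n)) (trans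
    (cong₂ ℕ._+_ (count-extend P? n none m) (single-no P? (m ℕ.+ n) (none _ (ℕₚ.m≤n+m n m))))
    (ℕₚ.+-identityʳ _))

  count-insert : ∀ (P? : Decidable P) (Q? : Decidable Q) n p → p < n → P p → ¬ Q p →
                 (∀ k → k ≢ p → P k → Q k) → (∀ k → k ≢ p → Q k → P k) → count P? n ≡ suc (count Q? n)
  count-insert P? Q? (suc n) p p<n Pp ¬Qp to from with p ℕ.≟ n
  ... | yes refl = trans (count-suc P? n) (trans (cong₂ ℕ._+_
      (count-cong P? Q? n (λ k k<n → to k (ℕₚ.<⇒≢ k<n)) (λ k k<n → from k (ℕₚ.<⇒≢ k<n))) (single-yes P? n Pp))
    (trans (ℕₚ.+-comm _ 1) (cong suc (sym (trans (count-suc Q? n)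
      (trans (cong (count Q? n ℕ.+_) (single-no Q? n ¬Qp)) (ℕₚ.+-identityʳ _)))))))
  ... | no p≢n = trans (count-suc P? n) (trans (cong₂ ℕ._+_
      (count-insert P? Q? n p (ℕₚ.≤∧≢⇒< (ℕ.s≤s⁻¹ p<n) p≢n) Pp ¬Qp to from)
      (single-cong P? Q? n (to n (p≢n ∘ sym)) (from n (p≢n ∘ sym))))
    (cong suc (sym (count-suc Q? n))))

  primeDivisor? : ∀ n → Decidable (λ q → Prime q × q ∣ n)
  primeDivisor? n q = prime? q ×-dec (q ∣? n)

  -- The only new prime divisor is `p`. The two counts run over different ranges; `count-extend`
  -- reconciles them because no divisor of `j` exceeds `j`.
  ω-prime* : ∀ {p j} → Prime p → 1 ≤ j → p ∤ j → ω (p ℕ.* j) ≡ suc (ω j)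
  ω-prime* {p} {j} pp 1≤j p∤j = trans
    (count-insert (primeDivisor? (p ℕ.* j)) (primeDivisor? j) (suc (p ℕ.* j)) p (s≤s (ℕₚ.m≤m*n p j {{j≢0}}))
      (pp , ℕ∣.m∣m*n j) (p∤j ∘ proj₂) to (λ q _ (qq , q∣j) → qq , ℕ∣.∣n⇒∣m*n p q∣j))
    (cong suc (trans (cong (count (primeDivisor? j)) (sym (ℕₚ.m∸n+n≡m {suc (p ℕ.* j)} {suc j} (s≤s (ℕₚ.m≤n*m j p {{p≢0}})))))
      (count-extend (primeDivisor? j) (suc j) (λ k j<k (_ , k∣j) → ℕₚ.<⇒≱ j<k (ℕ∣.∣⇒≤ {{j≢0}} k∣j)) (p ℕ.* j ∸ j))))
    where
    j≢0 = ℕ.>-nonZero 1≤j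
    p≢0 = prime⇒nonZero pp
    to : ∀ q → q ≢ p → Prime q × q ∣ p ℕ.* j → Prime q × q ∣ j
    to q q≢p (qq , q∣pj) with euclidsLemma p j qq q∣pj
    ... | inj₂ q∣j = qq , q∣j
    ... | inj₁ q∣p with prime⇒irreducible pp q∣p
    ...   | inj₁ refl = contradiction qq ¬prime[1]
    ...   | inj₂ q≡p  = contradiction q≡p q≢p

  μ-prime* : ∀ {p j} → Prime p → 1 ≤ j → p ∤ j → μ (p ℕ.* j) ≡ ℤ.- μ j
  μ-prime* {p} {j} pp 1≤j p∤j rewrite hasSquareFactor-prime* pp 1≤j p∤j | ω-prime* pp 1≤j p∤j with hasSquareFactor j
  ... | true  = refl
  ... | false = ℤₚ.-1*i≡-i _

  μ-prime*-multiple : ∀ {p j} → Prime p → 1 ≤ j → p ∣ j → μ (p ℕ.* j) ≡ + 0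
  μ-prime*-multiple {suc (suc k)} {j} pp 1≤j p∣j
    rewrite square-factor⁺ {suc (suc k) ℕ.* j} (ℕₚ.≤-trans 1≤j (ℕₚ.m≤n*m j (suc (suc k)))) k (ℕ∣.*-monoʳ-∣ (suc (suc k)) p∣j) = refl
  μ-prime*-multiple {0} pp = contradiction pp ¬prime[0]
  μ-prime*-multiple {1} pp = contradiction pp ¬prime[1]

  -- Möbius sums

  möbiusTerm : (ℕ → ℤ) → ℕ → ℕ → ℤ
  möbiusTerm A n k = if ⌊ suc k ∣? n ⌋ then μ (suc k) ℤ.* A (n / suc k) else + 0

  möbiusTerm-∣ : ∀ A {n} k q → n ≡ q ℕ.* suc k → möbiusTerm A n k ≡ μ (suc k) ℤ.* A q
  möbiusTerm-∣ A k q refl with suc k ∣? (q ℕ.* suc k)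
  ... | yes _ = cong (λ x → μ (suc k) ℤ.* A x) (m*n/n≡m q (suc k))
  ... | no ndiv = contradiction (divides q refl) ndiv

  möbiusTerm-∤ : ∀ A {n} k → suc k ∤ n → möbiusTerm A n k ≡ + 0
  möbiusTerm-∤ A {n} k ndiv with suc k ∣? n
  ... | yes div = contradiction div ndiv
  ... | no _  = refl

  doldSum-cong : ∀ {A B} n → (∀ k → 1 ≤ k → k ≤ n → A k ≡ B k) → doldSum A n ≡ doldSum B n
  doldSum-cong {A} {B} zero    eq = refl
  doldSum-cong {A} {B} (suc n) eq = Σ-cong (suc n) term
    where
    term : ∀ k → k < suc n → möbiusTerm A (suc n) k ≡ möbiusTerm B (suc n) k
    term k k< with suc k ∣? suc n
    ... | no _ = refl
    ... | yes (divides (suc q) e) = cong (μ (suc k) ℤ.*_) (trans (cong A q≡) (trans (eq (suc q) (s≤s z≤n) q≤) (cong B (sym q≡))))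
      where
      q≡ = trans (cong (_/ suc k) e) (m*n/n≡m (suc q) (suc k))
      q≤ = subst (suc q ≤_) (sym e) (ℕₚ.m≤m*n (suc q) (suc k))

  doldSum-+ : ∀ A B n → doldSum (λ k → A k ℤ.+ B k) n ≡ doldSum A n ℤ.+ doldSum B n
  doldSum-+ A B n = trans (Σ-cong n (λ k _ → term k)) (Σ-+ n)
    where
    term : ∀ k → möbiusTerm (λ j → A j ℤ.+ B j) n k ≡ möbiusTerm A n k ℤ.+ möbiusTerm B n k
    term k with suc k ∣? n
    ... | yes _ = ℤₚ.*-distribˡ-+ (μ (suc k)) _ _
    ... | no _  = refl

  doldSum-*ˡ : ∀ c A n → doldSum (λ k → c ℤ.* A k) n ≡ c ℤ.* doldSum A n
  doldSum-*ˡ c A n = trans (Σ-cong n (λ k _ → term k)) (Σ-*ˡ c n)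
    where
    term : ∀ k → möbiusTerm (λ j → c ℤ.* A j) n k ≡ c ℤ.* möbiusTerm A n k
    term k with suc k ∣? n
    ... | yes _ = solve 3 (λ x y z → x :* (y :* z) := y :* (x :* z)) refl (μ (suc k)) c (A (n / suc k))
    ... | no _  = sym (ℤₚ.*-zeroʳ c)

  doldSum-∣ : ∀ {m} A n → (∀ k → 1 ≤ k → k ≤ n → m ℤ∣.∣ A k) → m ℤ∣.∣ doldSum A n
  doldSum-∣ {m} A zero    div = ∣0
  doldSum-∣ {m} A (suc n) div = Σ-∣ (suc n) term
    where
    term : ∀ k → k < suc n → m ℤ∣.∣ möbiusTerm A (suc n) k
    term k _ with suc k ∣? suc n
    ... | no _ = ∣0
    ... | yes (divides (suc q) e) = ℤ∣.∣n⇒∣m*n (μ (suc k)) (subst (λ x → m ℤ∣.∣ A x) (sym q≡) (div (suc q) (s≤s z≤n) q≤))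
      where
      q≡ = trans (cong (_/ suc k) e) (m*n/n≡m (suc q) (suc k))
      q≤ = subst (suc q ≤_) (sym e) (ℕₚ.m≤m*n (suc q) (suc k))

  Dold-*ˡ : ∀ c A → Dold A → Dold (λ n → c ℤ.* A n)
  Dold-*ˡ c A dA n 1≤n = ℤ∣.∣⇒∣ᵤ (subst (+ n ℤ∣.∣_) (sym (doldSum-*ˡ c A n)) (ℤ∣.∣n⇒∣m*n c (ℤ∣.∣ᵤ⇒∣ (dA n 1≤n))))

  private
    offMultiples : ℕ → (ℕ → ℤ) → ℕ → ℤ
    offMultiples p F k = if ⌊ p ∣? suc k ⌋ then + 0 else F k

    offMultiples-∣ : ∀ p F k → p ∣ suc k → offMultiples p F k ≡ + 0
    offMultiples-∣ p F k div with p ∣? suc k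
    ... | yes _ = refl
    ... | no ndiv = contradiction div ndiv

    offMultiples-∤ : ∀ p F k → p ∤ suc k → offMultiples p F k ≡ F k
    offMultiples-∤ p F k ndiv with p ∣? suc k
    ... | yes div = contradiction div ndiv
    ... | no _  = refl

    -- Index `k` stands for the divisor `k + 1`, so the multiples of `suc p` sit at the last place
    -- of each block of `suc p` consecutive indices.
    Σ-multiples : ∀ p F n → Σ<ℤ (n ℕ.* suc p) F ≡
                  Σ<ℤ (n ℕ.* suc p) (offMultiples (suc p) F) ℤ.+ Σ<ℤ n (λ j → F (j ℕ.* suc p ℕ.+ p))
    Σ-multiples p F zero    = refl
    Σ-multiples p F (suc n) = begin
      Σ<ℤ (suc p ℕ.+ n ℕ.* suc p) F
        ≡⟨ reorder F ⟩
      Σ<ℤ (n ℕ.* suc p) F ℤ.+ (Σ<ℤ p F′ ℤ.+ F′ p)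
        ≡⟨ cong (ℤ._+ (Σ<ℤ p F′ ℤ.+ F′ p)) (Σ-multiples p F n) ⟩
      (a ℤ.+ b) ℤ.+ (Σ<ℤ p F′ ℤ.+ F′ p)
        ≡⟨ solve 4 (λ a b x y → (a :+ b) :+ (x :+ y) := (a :+ (x :+ con (+ 0))) :+ (b :+ y)) refl a b (Σ<ℤ p F′) (F′ p) ⟩
      (a ℤ.+ (Σ<ℤ p F′ ℤ.+ + 0)) ℤ.+ (b ℤ.+ F′ p)
        ≡⟨ cong (λ x → (a ℤ.+ x) ℤ.+ (b ℤ.+ F′ p)) (sym (cong₂ ℤ._+_
             (Σ-cong p λ k k<p → offMultiples-∤ (suc p) F (n ℕ.* suc p ℕ.+ k) (λ div → ℕₚ.<⇒≱ k<p (ℕ.s≤s⁻¹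
               (ℕ∣.∣⇒≤ (ℕ∣.∣m+n∣m⇒∣n (subst (suc p ∣_) (sym (ℕₚ.+-suc (n ℕ.* suc p) k)) div) (ℕ∣.n∣m*n n))))))
             (offMultiples-∣ (suc p) F (n ℕ.* suc p ℕ.+ p)
               (subst (suc p ∣_) (ℕₚ.+-suc (n ℕ.* suc p) p) (ℕ∣.∣m∣n⇒∣m+n (ℕ∣.n∣m*n n) ℕ∣.∣-refl))))) ⟩
      (a ℤ.+ Σ<ℤ (suc p) (λ k → offMultiples (suc p) F (n ℕ.* suc p ℕ.+ k))) ℤ.+ (b ℤ.+ F′ p)
        ≡⟨ cong (ℤ._+ (b ℤ.+ F′ p)) (sym (reorder (offMultiples (suc p) F))) ⟩
      Σ<ℤ (suc p ℕ.+ n ℕ.* suc p) (offMultiples (suc p) F) ℤ.+ (b ℤ.+ F′ p) ∎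
      where
      open ≡-Reasoning
      F′ = λ k → F (n ℕ.* suc p ℕ.+ k)
      a = Σ<ℤ (n ℕ.* suc p) (offMultiples (suc p) F)
      b = Σ<ℤ n (λ j → F (j ℕ.* suc p ℕ.+ p))
      reorder : ∀ G → Σ<ℤ (suc p ℕ.+ n ℕ.* suc p) G ≡ Σ<ℤ (n ℕ.* suc p) G ℤ.+ Σ<ℤ (suc p) (λ k → G (n ℕ.* suc p ℕ.+ k))
      reorder G = trans (cong (λ x → Σ<ℤ x G) (ℕₚ.+-comm (suc p) (n ℕ.* suc p))) (Σ-split (n ℕ.* suc p) (suc p))

  -- The joint contribution of the divisors `suc k` and `p * suc k` of `n * p` when `p` does not
  -- divide `suc k`.
  primeTerm : (ℕ → ℤ) → ℕ → ℕ → ℕ → ℤ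
  primeTerm A p n = offMultiples p (möbiusTerm (λ m → A (m ℕ.* p) ℤ.- A m) n)

  -- The divisors of n p are those prime to p, which divide n, and the p j with j ∣ n, where μ (p j) = - μ j or 0.
  doldSum-*prime : ∀ A {p} n → Prime p → 1 ≤ n → doldSum A (n ℕ.* p) ≡ Σ<ℤ n (primeTerm A p n)
  doldSum-*prime A {zero}  n pp = contradiction pp ¬prime[0]
  doldSum-*prime A {suc p} n pp 1≤n = begin
    Σ<ℤ (n ℕ.* suc p) F
      ≡⟨ Σ-multiples p F n ⟩
    Σ<ℤ (n ℕ.* suc p) (offMultiples (suc p) F) ℤ.+ Σ<ℤ n (λ j → F (j ℕ.* suc p ℕ.+ p))
      ≡⟨ cong (ℤ._+ Σ<ℤ n (λ j → F (j ℕ.* suc p ℕ.+ p))) (Σ-truncate (ℕₚ.m≤m*n n (suc p)) (λ k n≤k _ → tail k n≤k)) ⟩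
    Σ<ℤ n (offMultiples (suc p) F) ℤ.+ Σ<ℤ n (λ j → F (j ℕ.* suc p ℕ.+ p))
      ≡⟨ sym (Σ-+ n) ⟩
    Σ<ℤ n (λ k → offMultiples (suc p) F k ℤ.+ F (k ℕ.* suc p ℕ.+ p))
      ≡⟨ Σ-cong n (λ k _ → pair k) ⟩
    Σ<ℤ n (primeTerm A (suc p) n) ∎
    where
    open ≡-Reasoning
    F = möbiusTerm A (n ℕ.* suc p)
    coprime-part : ∀ k → suc p ∤ suc k → suc k ∣ n ℕ.* suc p → suc k ∣ n
    coprime-part k ndiv div = coprime-divisor cop (subst (suc k ∣_) (ℕₚ.*-comm n (suc p)) div)
      where
      cop : Coprime (suc k) (suc p)
      cop (i∣k , i∣p) with prime⇒irreducible pp i∣p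
      ... | inj₁ i≡1 = i≡1
      ... | inj₂ refl = contradiction i∣k ndiv
    tail : ∀ k → n ≤ k → offMultiples (suc p) F k ≡ + 0
    tail k n≤k with suc p ∣? suc k
    ... | yes _ = refl
    ... | no ndiv = möbiusTerm-∤ A k (λ div → ℕₚ.<⇒≱ (s≤s n≤k) (ℕ∣.∣⇒≤ {{ℕ.>-nonZero 1≤n}} (coprime-part k ndiv div)))
    index : ∀ k → suc (k ℕ.* suc p ℕ.+ p) ≡ suc k ℕ.* suc p
    index k = trans (sym (ℕₚ.+-suc (k ℕ.* suc p) p)) (ℕₚ.+-comm (k ℕ.* suc p) (suc p))
    pair : ∀ k → offMultiples (suc p) F k ℤ.+ F (k ℕ.* suc p ℕ.+ p) ≡ primeTerm A (suc p) n k
    pair k with suc k ∣? n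
    pair k | no ∤n = trans (cong₂ ℤ._+_ fst snd) (sym (rhs))
      where
      fst : offMultiples (suc p) F k ≡ + 0
      fst with suc p ∣? suc k
      ... | yes _ = refl
      ... | no ndiv = möbiusTerm-∤ A k (∤n ∘ coprime-part k ndiv)
      snd : F (k ℕ.* suc p ℕ.+ p) ≡ + 0
      snd = möbiusTerm-∤ A _ (λ div → ∤n (ℕ∣.*-cancelʳ-∣ (suc p) (subst (_∣ n ℕ.* suc p) (index k) div)))
      rhs : (if ⌊ suc p ∣? suc k ⌋ then + 0 else + 0) ≡ + 0
      rhs with ⌊ suc p ∣? suc k ⌋
      ... | true = refl
      ... | false = refl
    pair k | yes (divides q e) = go
      where
      q≡ : n / suc k ≡ q
      q≡ = trans (cong (_/ suc k) e) (m*n/n≡m q (suc k))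
      snd : F (k ℕ.* suc p ℕ.+ p) ≡ μ (suc p ℕ.* suc k) ℤ.* A q
      snd = trans (möbiusTerm-∣ A (k ℕ.* suc p ℕ.+ p) q (trans (cong (ℕ._* suc p) e)
                    (trans (ℕₚ.*-assoc q (suc k) (suc p)) (cong (q ℕ.*_) (sym (index k))))))
                  (cong (λ x → μ x ℤ.* A q) (trans (index k) (ℕₚ.*-comm (suc k) (suc p))))
      go : offMultiples (suc p) F k ℤ.+ F (k ℕ.* suc p ℕ.+ p) ≡
           (if ⌊ suc p ∣? suc k ⌋ then + 0 else μ (suc k) ℤ.* (A (n / suc k ℕ.* suc p) ℤ.- A (n / suc k)))
      go with suc p ∣? suc k
      ... | yes div = trans (ℤₚ.+-identityˡ _) (trans snd (cong (ℤ._* A q) (μ-prime*-multiple pp (s≤s z≤n) div)))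
      ... | no ndiv = trans (cong₂ ℤ._+_ (möbiusTerm-∣ A k (q ℕ.* suc p) fst-eq) (trans snd (cong (ℤ._* A q) (μ-prime* pp (s≤s z≤n) ndiv))))
          (trans (solve 3 (λ m a b → m :* a :+ (:- m) :* b := m :* (a :- b)) refl (μ (suc k)) (A (q ℕ.* suc p)) (A q))
            (cong (λ x → μ (suc k) ℤ.* (A (x ℕ.* suc p) ℤ.- A x)) (sym q≡)))
        where
        fst-eq : n ℕ.* suc p ≡ q ℕ.* suc p ℕ.* suc k
        fst-eq = trans (cong (ℕ._* suc p) e) (trans (ℕₚ.*-assoc q (suc k) (suc p))
                   (trans (cong (q ℕ.*_) (ℕₚ.*-comm (suc k) (suc p))) (sym (ℕₚ.*-assoc q (suc p) (suc k)))))

  -- In the paired form of the Dold sum at `n * p` the divisor 1 contributes exactly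
  -- `A (n * p) - A n`. The whole sum is divisible by `n * p`, and by induction `p` divides every
  -- other term, since these involve only proper divisors of `n`.
  Dold⇒prime-∣ : ∀ {A} → Dold A → ∀ {p} → Prime p → ∀ n → 1 ≤ n → + p ℤ∣.∣ A (n ℕ.* p) ℤ.- A n
  Dold⇒prime-∣ {A} dA {p} pp = <-rec _ step
    where
    step : ∀ n → (∀ {m} → m < n → 1 ≤ m → + p ℤ∣.∣ A (m ℕ.* p) ℤ.- A m) → 1 ≤ n → + p ℤ∣.∣ A (n ℕ.* p) ℤ.- A n
    step (suc n) rec _ = subst (+ p ℤ∣.∣_) first≡ (ℤ∣.∣m+n∣n⇒∣m whole (Σ-∣ n (λ k k<n → rest k)))
      where
      B = λ m → A (m ℕ.* p) ℤ.- A m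
      term = primeTerm A p (suc n)
      whole : + p ℤ∣.∣ term 0 ℤ.+ Σ<ℤ n (λ k → term (suc k))
      whole = subst (+ p ℤ∣.∣_) (trans (doldSum-*prime A (suc n) pp (s≤s z≤n))
          (trans (Σ-split {term} 1 n) (cong (ℤ._+ Σ<ℤ n (λ k → term (suc k))) (ℤₚ.+-identityˡ (term 0)))))
        (ℤ∣.∣-trans {j = + (suc n ℕ.* p)} (ℤ∣.∣ᵤ⇒∣ (ℕ∣.n∣m*n (suc n)))
          (ℤ∣.∣ᵤ⇒∣ (dA (suc n ℕ.* p) (ℕₚ.≤-trans (ℕ.>-nonZero⁻¹ p {{prime⇒nonZero pp}}) (ℕₚ.m≤n*m p (suc n))))))
      first≡ : term 0 ≡ A (suc n ℕ.* p) ℤ.- A (suc n)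
      first≡ = trans (offMultiples-∤ p (möbiusTerm B (suc n)) 0 (p∤1 pp)) (trans (möbiusTerm-∣ B 0 (suc n) (sym (ℕₚ.*-identityʳ (suc n)))) (ℤₚ.*-identityˡ _))
      rest : ∀ k → + p ℤ∣.∣ term (suc k)
      rest k with suc (suc k) ∣? suc n
      ... | no _ with p ∣? suc (suc k)
      ...   | yes _ = ∣0
      ...   | no _  = ∣0
      rest k | yes (divides (suc q) e) with p ∣? suc (suc k)
      ...   | yes _ = ∣0
      ...   | no _  = ℤ∣.∣n⇒∣m*n (μ (suc (suc k))) (subst (λ x → + p ℤ∣.∣ A (x ℕ.* p) ℤ.- A x) (sym q≡)
                        (rec (subst (suc q <_) (sym e) (ℕₚ.m<m*n (suc q) (suc (suc k)) (s≤s (s≤s z≤n)))) (s≤s z≤n)))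
        where q≡ = trans (cong (_/ suc (suc k)) e) (m*n/n≡m (suc q) (suc (suc k)))

  primeFactor : ∀ n → 2 ≤ n → ∃ λ p → Prime p × p ∣ n
  primeFactor (suc n) 2≤n with factorise (suc n)
  ... | record { factors = [] ; isFactorisation = eq } = contradiction (subst (2 ≤_) eq 2≤n) λ { (s≤s ()) }
  ... | record { factors = p ∷ ps ; isFactorisation = eq ; factorsPrime = pp ∷ _ } =
    p , pp , subst (p ∣_) (sym eq) (ℕ∣.m∣m*n _)

  -- For n ≥ 1 the numbers `m * comb m n` are the coefficients of - t h′ / h with h = 1 - t ^ m.
  comb : ℕ → ℕ → ℤ
  comb m n = if ⌊ m ∣? n ⌋ then + 1 else + 0

  private
    -- Pairing divisors along any prime factor of `n` turns the summands into differences of a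
    -- constant sequence.
    doldSum-1 : ∀ n → 2 ≤ n → doldSum (λ _ → + 1) n ≡ + 0
    doldSum-1 n 2≤n with primeFactor n 2≤n
    ... | p , pp , divides (suc q) refl = trans (doldSum-*prime (λ _ → + 1) (suc q) pp (s≤s z≤n)) (Σ-zero (suc q) (λ k _ → term k))
      where
      term : ∀ k → primeTerm (λ _ → + 1) p (suc q) k ≡ + 0
      term k with p ∣? suc k
      ... | yes _ = refl
      ... | no _ with suc k ∣? suc q
      ...   | yes _ = ℤₚ.*-zeroʳ (μ (suc k))
      ...   | no _  = refl

  comb-∣ : ∀ m n → m ∣ n → comb m n ≡ + 1
  comb-∣ m n div with m ∣? n
  ... | yes _   = refl
  ... | no ndiv = contradiction div ndiv

  comb-∤ : ∀ m n → m ∤ n → comb m n ≡ + 0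
  comb-∤ m n ndiv with m ∣? n
  ... | yes div = contradiction div ndiv
  ... | no _    = refl

  -- Σ_{d ∣ M, m ∣ M/d} μ d vanishes unless M = m.
  comb-dold : ∀ m M → 1 ≤ m → 1 ≤ M → + M ℤ∣.∣ doldSum (λ n → + m ℤ.* comb m n) M
  comb-dold m M 1≤m 1≤M with m ∣? M
  ... | no ∤M = subst (+ M ℤ∣.∣_) (sym (trans (doldSum-*ˡ (+ m) (comb m) M) (trans (cong (+ m ℤ.*_) (Σ-zero M (λ k _ → term k))) (ℤₚ.*-zeroʳ (+ m))))) ∣0
    where
    term : ∀ k → möbiusTerm (comb m) M k ≡ + 0
    term k with suc k ∣? M
    ... | no _ = refl
    ... | yes (divides q e) = trans (cong (μ (suc k) ℤ.*_) (comb-∤ m (M / suc k) λ ∣q → ∤M (subst (m ∣_) (sym e)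
            (ℕ∣.∣m⇒∣m*n (suc k) (subst (m ∣_) (trans (cong (_/ suc k) e) (m*n/n≡m q (suc k))) ∣q))))) (ℤₚ.*-zeroʳ (μ (suc k)))
  comb-dold (suc m) M 1≤m 1≤M | yes (divides (suc zero) refl) =
    subst (+ M ℤ∣.∣_) (sym (doldSum-*ˡ (+ suc m) (comb (suc m)) M))
      (subst (λ x → + M ℤ∣.∣ + x ℤ.* doldSum (comb (suc m)) M) (ℕₚ.*-identityˡ (suc m)) (ℤ∣.∣m⇒∣m*n _ ℤ∣.∣-refl))
  comb-dold (suc m) M 1≤m 1≤M | yes (divides q@(suc (suc _)) refl) =
    subst (+ M ℤ∣.∣_) (sym (trans (doldSum-*ˡ (+ suc m) (comb (suc m)) M) (trans (cong (+ suc m ℤ.*_) (begin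
      doldSum (comb (suc m)) (q ℕ.* suc m)
        ≡⟨ Σ-truncate (ℕₚ.m≤m*n q (suc m)) (λ k q≤k _ → trans (term k) (möbiusTerm-∤ (λ _ → + 1) k (λ div → ℕₚ.<⇒≱ (s≤s q≤k) (ℕ∣.∣⇒≤ div)))) ⟩
      Σ<ℤ q (möbiusTerm (comb (suc m)) (q ℕ.* suc m))
        ≡⟨ Σ-cong q (λ k _ → term k) ⟩
      doldSum (λ _ → + 1) q
        ≡⟨ doldSum-1 q (s≤s (s≤s z≤n)) ⟩
      + 0 ∎)) (ℤₚ.*-zeroʳ (+ suc m))))) ∣0
    where
    open ≡-Reasoning
    -- A divisor D of `q * suc m` has a cofactor divisible by `suc m` exactly when D divides `q`, so
    -- the sum collapses to the Möbius sum over the divisors of `q ≥ 2`.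
    term : ∀ k → möbiusTerm (comb (suc m)) (q ℕ.* suc m) k ≡ möbiusTerm (λ _ → + 1) q k
    term k with suc k ∣? q
    ... | yes (divides t e) = trans (möbiusTerm-∣ (comb (suc m)) k (t ℕ.* suc m) (trans (cong (ℕ._* suc m) e) (trans (ℕₚ.*-assoc t (suc k) (suc m))
              (trans (cong (t ℕ.*_) (ℕₚ.*-comm (suc k) (suc m))) (sym (ℕₚ.*-assoc t (suc m) (suc k)))))))
            (cong (μ (suc k) ℤ.*_) (comb-∣ (suc m) (t ℕ.* suc m) (ℕ∣.n∣m*n t)))
    ... | no ndiv with suc k ∣? (q ℕ.* suc m)
    ...   | no _ = refl
    ...   | yes (divides t e) = trans (cong (μ (suc k) ℤ.*_) (comb-∤ (suc m) (q ℕ.* suc m / suc k) λ div → ndiv (∣q (subst (suc m ∣_) (trans (cong (_/ suc k) e) (m*n/n≡m t (suc k))) div))))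
                                        (ℤₚ.*-zeroʳ (μ (suc k)))
      where
      ∣q : suc m ∣ t → suc k ∣ q
      ∣q (divides s refl) = divides s (ℕₚ.*-cancelʳ-≡ q (s ℕ.* suc k) (suc m) (trans e (trans (ℕₚ.*-assoc s (suc m) (suc k))
        (trans (cong (s ℕ.*_) (ℕₚ.*-comm (suc m) (suc k))) (sym (ℕₚ.*-assoc s (suc k) (suc m)))))))

-- Power series and logarithmic derivatives

module LogDerivative where
  open DoldSums
  open import Data.Integer.DivMod using (_%ℕ_; _/ℕ_; a≡a%ℕn+[a/ℕn]*n)
  open ℤ-Solver.+-*-Solver using (solve; _:+_; _:*_; :-_; _:-_; _:=_; con)

  -- conv A e m = Σ_{n < m} e n * A (m - 1 - n)
  conv : (ℕ → ℤ) → (ℕ → ℤ) → ℕ → ℤ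
  conv A e zero    = + 0
  conv A e (suc m) = e 0 ℤ.* A m ℤ.+ conv A (e ∘ suc) m

  conv-suc : ∀ A e m → conv A e (suc m) ≡ e m ℤ.* A 0 ℤ.+ conv (A ∘ suc) e m
  conv-suc A e zero    = refl
  conv-suc A e (suc m) = trans (cong (λ x → e 0 ℤ.* A (suc m) ℤ.+ x) (conv-suc A (e ∘ suc) m))
    (solve 3 (λ a b c → a :+ (b :+ c) := b :+ (a :+ c)) refl (e 0 ℤ.* A (suc m)) (e (suc m) ℤ.* A 0) (conv (A ∘ suc) (e ∘ suc) m))

  conv-congʳ : ∀ A {e e′} m → (∀ k → e k ≡ e′ k) → conv A e m ≡ conv A e′ m
  conv-congʳ A zero    eq = refl
  conv-congʳ A (suc m) eq = cong₂ ℤ._+_ (cong (ℤ._* A m) (eq 0)) (conv-congʳ A m (eq ∘ suc))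

  conv-congˡ : ∀ {A A′} e m → (∀ k → A k ≡ A′ k) → conv A e m ≡ conv A′ e m
  conv-congˡ e zero    eq = refl
  conv-congˡ e (suc m) eq = cong₂ ℤ._+_ (cong (e 0 ℤ.*_) (eq m)) (conv-congˡ (e ∘ suc) m eq)

  conv-+ʳ : ∀ A e g m → conv A (λ k → e k ℤ.+ g k) m ≡ conv A e m ℤ.+ conv A g m
  conv-+ʳ A e g zero    = refl
  conv-+ʳ A e g (suc m) = trans (cong (λ x → (e 0 ℤ.+ g 0) ℤ.* A m ℤ.+ x) (conv-+ʳ A (e ∘ suc) (g ∘ suc) m))
    (solve 5 (λ x y a u v → (x :+ y) :* a :+ (u :+ v) := (x :* a :+ u) :+ (y :* a :+ v)) refl (e 0) (g 0) (A m) (conv A (e ∘ suc) m) (conv A (g ∘ suc) m))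

  conv--ˡ : ∀ A B c e m → conv (λ k → A k ℤ.- c ℤ.* B k) e m ≡ conv A e m ℤ.- c ℤ.* conv B e m
  conv--ˡ A B c e zero    = solve 1 (λ x → con (+ 0) := con (+ 0) :- x :* con (+ 0)) refl c
  conv--ˡ A B c e (suc m) = trans (cong (λ x → e 0 ℤ.* (A m ℤ.- c ℤ.* B m) ℤ.+ x) (conv--ˡ A B c (e ∘ suc) m))
    (solve 6 (λ x a b c u v → x :* (a :- c :* b) :+ (u :- c :* v) := (x :* a :+ u) :- c :* (x :* b :+ v)) refl
      (e 0) (A m) (B m) c (conv A (e ∘ suc) m) (conv B (e ∘ suc) m))

  conv-negˡ : ∀ A e m → conv (λ k → ℤ.- A k) e m ≡ ℤ.- conv A e m
  conv-negˡ A e zero    = refl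
  conv-negˡ A e (suc m) = trans (cong (λ x → e 0 ℤ.* (ℤ.- A m) ℤ.+ x) (conv-negˡ A (e ∘ suc) m))
    (solve 3 (λ x a u → x :* (:- a) :+ :- u := :- (x :* a :+ u)) refl (e 0) (A m) (conv A (e ∘ suc) m))

  conv-∣ : ∀ {c} A e m → (∀ k → k < m → c ℤ∣.∣ A k) → c ℤ∣.∣ conv A e m
  conv-∣ A e zero    div = ∣0
  conv-∣ A e (suc m) div = ℤ∣.∣m∣n⇒∣m+n (ℤ∣.∣n⇒∣m*n (e 0) (div m ℕₚ.≤-refl)) (conv-∣ A (e ∘ suc) m (λ k k<m → div k (ℕₚ.m<n⇒m<1+n k<m)))

  conv-skip : ∀ A e i n → (∀ k → k < i → A k ≡ + 0) → conv A e (i ℕ.+ n) ≡ conv (λ k → A (i ℕ.+ k)) e n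
  conv-skip A e zero    n vanish = refl
  conv-skip A e (suc i) n vanish = trans (conv-suc A e (i ℕ.+ n)) (trans
    (cong (λ x → e (i ℕ.+ n) ℤ.* x ℤ.+ conv (A ∘ suc) e (i ℕ.+ n)) (vanish 0 (s≤s z≤n)))
    (trans (cong (ℤ._+ conv (A ∘ suc) e (i ℕ.+ n)) (ℤₚ.*-zeroʳ (e (i ℕ.+ n))))
    (trans (ℤₚ.+-identityˡ _) (conv-skip (A ∘ suc) e i n (λ k k<i → vanish (suc k) (s≤s k<i))))))

  delay : (ℕ → ℤ) → ℕ → ℤ
  delay h zero    = + 0
  delay h (suc n) = h n

  -- multiplication of a power series by t ^ m
  shift : ℕ → (ℕ → ℤ) → ℕ → ℤ
  shift zero    h = h
  shift (suc m) h = delay (shift m h)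

  private
    delay-cong : ∀ {h g} → (∀ n → h n ≡ g n) → ∀ n → delay h n ≡ delay g n
    delay-cong eq zero    = refl
    delay-cong eq (suc n) = eq n

    shift-cong : ∀ m {h g} → (∀ n → h n ≡ g n) → ∀ n → shift m h n ≡ shift m g n
    shift-cong zero    eq = eq
    shift-cong (suc m) eq = delay-cong (shift-cong m eq)

    shift-+ : ∀ m h n → shift m h (m ℕ.+ n) ≡ h n
    shift-+ zero    h n = refl
    shift-+ (suc m) h n = shift-+ m h n

    shift-< : ∀ m h n → n < m → shift m h n ≡ + 0
    shift-< (suc m) h zero    _         = refl
    shift-< (suc m) h (suc n) (s≤s n<m) = shift-< m h n n<m

    conv-shift : ∀ A m h n → conv A (shift m h) n ≡ shift m (conv A h) n
    conv-shift A zero    h n       = refl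
    conv-shift A (suc m) h zero    = refl
    conv-shift A (suc m) h (suc n) = trans (ℤₚ.+-identityˡ _) (conv-shift A m h n)

    -- The Leibniz rule for the operator t d/dt on t ^ m h.
    shift-θ : ∀ m h n → + n ℤ.* shift m h n ≡ shift m (λ k → + k ℤ.* h k) n ℤ.+ + m ℤ.* shift m h n
    shift-θ m h n with n ℕ.<? m
    ... | yes n<m rewrite shift-< m h n n<m | shift-< m (λ k → + k ℤ.* h k) n n<m = trans (ℤₚ.*-zeroʳ (+ n)) (sym (trans (ℤₚ.+-identityˡ _) (ℤₚ.*-zeroʳ (+ m))))
    ... | no n≮m = subst (λ n → + n ℤ.* shift m h n ≡ shift m (λ k → + k ℤ.* h k) n ℤ.+ + m ℤ.* shift m h n) (ℕₚ.m+[n∸m]≡n (ℕₚ.≮⇒≥ n≮m)) (go (n ∸ m))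
      where
      go : ∀ k → + (m ℕ.+ k) ℤ.* shift m h (m ℕ.+ k) ≡ shift m (λ k → + k ℤ.* h k) (m ℕ.+ k) ℤ.+ + m ℤ.* shift m h (m ℕ.+ k)
      go k rewrite shift-+ m h k | shift-+ m (λ k → + k ℤ.* h k) k =
        solve 3 (λ m k x → (m :+ k) :* x := k :* x :+ m :* x) refl (+ m) (+ k) (h k)

    comb-+ : ∀ m n → comb m (m ℕ.+ n) ≡ comb m n
    comb-+ m n with m ∣? n
    ... | yes div = comb-∣ m (m ℕ.+ n) (ℕ∣.∣m∣n⇒∣m+n ℕ∣.∣-refl div)
    ... | no ndiv = comb-∤ m (m ℕ.+ n) (λ div → ndiv (ℕ∣.∣m+n∣m⇒∣n div ℕ∣.∣-refl))

    -- The series G = Σ t ^ j over the positive multiples j of s = m + 1 is geometric, so G = t ^ s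
    -- (1 + G); this is multiplied by h.
    conv-comb : ∀ m h n → conv (comb (suc m) ∘ suc) h n ≡ shift (suc m) (λ k → h k ℤ.+ conv (comb (suc m) ∘ suc) h k) n
    conv-comb m h n with n ℕ.<? suc m
    ... | yes n≤m = trans (trans (cong (conv _ h) (sym (ℕₚ.+-identityʳ n)))
                      (conv-skip (comb (suc m) ∘ suc) h n 0 (λ k k<n → comb-∤ (suc m) (suc k) (λ div → ℕₚ.<⇒≱ (ℕₚ.≤-<-trans k<n n≤m) (ℕ∣.∣⇒≤ div)))))
                      (sym (shift-< (suc m) _ n n≤m))
    ... | no n≰m = subst (λ n → conv (comb (suc m) ∘ suc) h n ≡ shift (suc m) (λ k → h k ℤ.+ conv (comb (suc m) ∘ suc) h k) n)
                     (ℕₚ.m+[n∸m]≡n (ℕₚ.≮⇒≥ n≰m)) (go (n ∸ suc m))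
      where
      go : ∀ k → conv (comb (suc m) ∘ suc) h (suc m ℕ.+ k) ≡ shift (suc m) (λ k → h k ℤ.+ conv (comb (suc m) ∘ suc) h k) (suc m ℕ.+ k)
      go k = begin
        conv (comb (suc m) ∘ suc) h (suc m ℕ.+ k)
          ≡⟨ cong (conv (comb (suc m) ∘ suc) h) (sym (ℕₚ.+-suc m k)) ⟩
        conv (comb (suc m) ∘ suc) h (m ℕ.+ suc k)
          ≡⟨ conv-skip (comb (suc m) ∘ suc) h m (suc k) (λ k k<m → comb-∤ (suc m) (suc k) (λ div → ℕₚ.<⇒≱ (s≤s k<m) (ℕ∣.∣⇒≤ div))) ⟩
        conv (λ j → comb (suc m) (suc (m ℕ.+ j))) h (suc k)
          ≡⟨ conv-suc _ h k ⟩
        h k ℤ.* comb (suc m) (suc (m ℕ.+ 0)) ℤ.+ conv (λ j → comb (suc m) (suc (m ℕ.+ suc j))) h k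
          ≡⟨ cong₂ ℤ._+_ (trans (cong (h k ℤ.*_) (comb-∣ (suc m) _ (ℕ∣.∣-reflexive (cong suc (sym (ℕₚ.+-identityʳ m)))))) (ℤₚ.*-identityʳ (h k)))
                         (conv-congˡ h k (λ j → comb-+ (suc m) (suc j))) ⟩
        h k ℤ.+ conv (comb (suc m) ∘ suc) h k
          ≡⟨ sym (shift-+ (suc m) _ k) ⟩
        shift (suc m) (λ k → h k ℤ.+ conv (comb (suc m) ∘ suc) h k) (suc m ℕ.+ k) ∎
        where open ≡-Reasoning

  -- t h′(t) = p(t) h(t), where p(t) = Σ_{n ≥ 1} p n t ^ n
  LogDerivative : (ℕ → ℤ) → (ℕ → ℤ) → Set
  LogDerivative p h = ∀ n → + n ℤ.* h n ≡ conv (p ∘ suc) h n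

  private
    -- h is multiplied by 1 - t ^ (m + 1)
    cut : ℕ → (ℕ → ℤ) → ℕ → ℤ
    cut m h n = h n ℤ.+ shift (suc m) (λ k → ℤ.- h k) n

    -- Logarithmic derivatives add under multiplication, and that of 1 - t ^ s, with s = m + 1, has
    -- the coefficients `- s * comb s n`. The proof avoids dividing by power series.
    LogDerivative-cut : ∀ m {p h} → LogDerivative p h → LogDerivative (λ n → p n ℤ.- + suc m ℤ.* comb (suc m) n) (cut m h)
    LogDerivative-cut m {p} {h} eq n = sym (begin
      conv (λ k → p (suc k) ℤ.- + suc m ℤ.* q k) (cut m h) n
        ≡⟨ conv--ˡ (p ∘ suc) q (+ suc m) (cut m h) n ⟩
      conv (p ∘ suc) (cut m h) n ℤ.- + suc m ℤ.* conv q (cut m h) n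
        ≡⟨ cong₂ (λ x y → x ℤ.- + suc m ℤ.* y) first second ⟩
      (+ n ℤ.* h n ℤ.+ S′) ℤ.- + suc m ℤ.* (ℤ.- S)
        ≡⟨ solve 4 (λ a s m t → (a :+ s) :- m :* (:- t) := a :+ (s :+ m :* t)) refl (+ n ℤ.* h n) S′ (+ suc m) S ⟩
      + n ℤ.* h n ℤ.+ (S′ ℤ.+ + suc m ℤ.* S)
        ≡⟨ cong (λ x → + n ℤ.* h n ℤ.+ x) (sym (shift-θ (suc m) (λ k → ℤ.- h k) n)) ⟩
      + n ℤ.* h n ℤ.+ + n ℤ.* S
        ≡⟨ sym (ℤₚ.*-distribˡ-+ (+ n) (h n) S) ⟩
      + n ℤ.* cut m h n ∎)
      where
      open ≡-Reasoning
      q = comb (suc m) ∘ suc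
      S = shift (suc m) (λ k → ℤ.- h k) n
      S′ = shift (suc m) (λ k → + k ℤ.* (ℤ.- h k)) n
      conv-neg : ∀ A k → conv A (λ j → ℤ.- h j) k ≡ ℤ.- conv A h k
      conv-neg A k = begin
        conv A (λ j → ℤ.- h j) k
          ≡⟨ solve 2 (λ x y → x := (y :+ x) :- y) refl (conv A (λ j → ℤ.- h j) k) (conv A h k) ⟩
        (conv A h k ℤ.+ conv A (λ j → ℤ.- h j) k) ℤ.- conv A h k
          ≡⟨ cong (ℤ._- conv A h k) (sym (conv-+ʳ A h (λ j → ℤ.- h j) k)) ⟩
        conv A (λ j → h j ℤ.- h j) k ℤ.- conv A h k
          ≡⟨ cong (ℤ._- conv A h k) (trans (conv-congʳ A k (λ j → ℤₚ.+-inverseʳ (h j))) (conv-0 k)) ⟩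
        + 0 ℤ.- conv A h k
          ≡⟨ ℤₚ.+-identityˡ _ ⟩
        ℤ.- conv A h k ∎
        where
        conv-0 : ∀ k → conv A (λ _ → + 0) k ≡ + 0
        conv-0 zero = refl
        conv-0 (suc k) = trans (ℤₚ.+-identityˡ _) (conv-0 k)
      first : conv (p ∘ suc) (cut m h) n ≡ + n ℤ.* h n ℤ.+ S′
      first = trans (conv-+ʳ (p ∘ suc) h _ n) (cong₂ ℤ._+_ (sym (eq n)) (trans (conv-shift (p ∘ suc) (suc m) _ n)
        (shift-cong (suc m) (λ k → trans (conv-neg (p ∘ suc) k) (trans (cong ℤ.-_ (sym (eq k))) (ℤₚ.neg-distribʳ-* (+ k) (h k)))) n)))
      -- Multiplication by 1 - t ^ s turns the geometric series t ^ s / (1 - t ^ s) into t ^ s; here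
      -- `- S` is the coefficient of t ^ s h.
      second : conv q (cut m h) n ≡ ℤ.- S
      second = begin
        conv q (cut m h) n
          ≡⟨ conv-+ʳ q h _ n ⟩
        conv q h n ℤ.+ conv q (shift (suc m) (λ k → ℤ.- h k)) n
          ≡⟨ cong₂ ℤ._+_ (neg-involutive (conv-comb m (λ k → ℤ.- h k) n)) (conv-shift q (suc m) (λ k → ℤ.- h k) n) ⟩
        ℤ.- shift (suc m) (λ k → ℤ.- h k ℤ.+ conv q (λ j → ℤ.- h j) k) n ℤ.+ shift (suc m) (conv q (λ j → ℤ.- h j)) n
          ≡⟨ cong (λ x → ℤ.- x ℤ.+ shift (suc m) (conv q (λ j → ℤ.- h j)) n) (shift-sum (suc m) _ _ n) ⟩
        ℤ.- (S ℤ.+ X) ℤ.+ X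
          ≡⟨ solve 2 (λ s x → :- (s :+ x) :+ x := :- s) refl S X ⟩
        ℤ.- S ∎
        where
        X = shift (suc m) (conv q (λ j → ℤ.- h j)) n
        neg-involutive : ∀ {y} → conv q (λ k → ℤ.- h k) n ≡ y → conv q h n ≡ ℤ.- y
        neg-involutive e = trans (sym (ℤₚ.neg-involutive _)) (cong ℤ.-_ (trans (sym (conv-neg q n)) e))
        shift-sum : ∀ m f g n → shift m (λ k → f k ℤ.+ g k) n ≡ shift m f n ℤ.+ shift m g n
        shift-sum zero    f g n       = refl
        shift-sum (suc m) f g zero    = refl
        shift-sum (suc m) f g (suc n) = shift-sum m f g n

    LogDerivative-cutⁿ : ∀ c m {p h} → h 0 ≡ + 1 → LogDerivative p h →
      ∃ λ h′ → h′ 0 ≡ + 1 × LogDerivative (λ n → p n ℤ.- + c ℤ.* (+ suc m ℤ.* comb (suc m) n)) h′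
    LogDerivative-cutⁿ zero    m {p} {h} h₀ eq = h , h₀ , λ n → trans (eq n) (conv-congˡ h n (λ k →
      solve 2 (λ x y → x := x :- con (+ 0) :* y) refl (p (suc k)) (+ suc m ℤ.* comb (suc m) (suc k))))
    LogDerivative-cutⁿ (suc c) m {p} {h} h₀ eq with LogDerivative-cutⁿ c m {λ n → p n ℤ.- + suc m ℤ.* comb (suc m) n} {cut m h} (cong (ℤ._+ + 0) h₀) (LogDerivative-cut m {p} {h} eq)
    ... | h′ , h′₀ , eq′ = h′ , h′₀ , λ n → trans (eq′ n) (conv-congˡ h′ n (λ k →
      solve 3 (λ x c y → (x :- y) :- c :* y := x :- (con (+ 1) :+ c) :* y) refl (p (suc k)) (+ c) (+ suc m ℤ.* comb (suc m) (suc k))))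

  -- Fix M. Multiplying h by (1 - t ^ m) ^ c with c ≡ h m (mod M) for m = 1, 2, …, M in turn changes p by
  -- combs n ↦ c m [m ∣ n] and makes p 1, …, p M divisible by M.
  LogDerivative⇒Dold : ∀ {p h} → h 0 ≡ + 1 → LogDerivative p h → Dold p
  LogDerivative⇒Dold {p} {h} h₀ eq M@(suc _) _ = ℤ∣.∣⇒∣ᵤ (go M 0 refl p h h₀ eq (λ { (suc _) _ () }))
    where
    go : ∀ k m → m ℕ.+ k ≡ M → ∀ p h → h 0 ≡ + 1 → LogDerivative p h →
         (∀ j → 1 ≤ j → j ≤ m → + M ℤ∣.∣ p j) → + M ℤ∣.∣ doldSum p M
    go zero    m m≡M p h h₀ eq div = doldSum-∣ p M (λ j 1≤j j≤M → div j 1≤j (subst (j ≤_) (trans (sym m≡M) (ℕₚ.+-identityʳ m)) j≤M))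
    go (suc k) m m+k p h h₀ eq div =
      subst (+ M ℤ∣.∣_) (sym dold≡) (ℤ∣.∣m∣n⇒∣m+n rec (ℤ∣.∣n⇒∣m*n (+ c) (comb-dold (suc m) M (s≤s z≤n) (s≤s z≤n))))
      where
      combs : ℕ → ℤ
      combs n = + suc m ℤ.* comb (suc m) n
      x = h (suc m)
      -- The factor can be inserted only a natural number of times, so `x` is replaced by its
      -- residue modulo `M`.
      c = x %ℕ M
      p′ = λ n → p n ℤ.- + c ℤ.* (+ suc m ℤ.* comb (suc m) n)
      next = LogDerivative-cutⁿ c m {p} {h} h₀ eq
      small : ∀ j → 1 ≤ j → j ≤ m → p′ j ≡ p j
      small j 1≤j j≤m = trans (cong (λ y → p j ℤ.- + c ℤ.* (+ suc m ℤ.* y))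
          (comb-∤ (suc m) j (λ d → ℕₚ.<⇒≱ (s≤s j≤m) (ℕ∣.∣⇒≤ {{ℕ.>-nonZero 1≤j}} d))))
        (solve 3 (λ x c y → x :- c :* (y :* con (+ 0)) := x) refl (p j) (+ c) (+ suc m))
      R = conv (p ∘ suc) (h ∘ suc) m
      -- The defining equation at `suc m` reads `suc m * x = p (suc m) + R`, and `R` involves only
      -- `p 1`, ..., `p m`, all divisible by `M`. What remains of the new value is
      -- `suc m * (x - c)`.
      top : p′ (suc m) ≡ (x /ℕ M) ℤ.* + suc m ℤ.* + M ℤ.+ ℤ.- R
      top = begin
        p (suc m) ℤ.- + c ℤ.* (+ suc m ℤ.* comb (suc m) (suc m))
          ≡⟨ cong (λ y → p (suc m) ℤ.- + c ℤ.* (+ suc m ℤ.* y)) (comb-∣ (suc m) (suc m) ℕ∣.∣-refl) ⟩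
        p (suc m) ℤ.- + c ℤ.* (+ suc m ℤ.* + 1)
          ≡⟨ solve 4 (λ p c s R → p :- c :* (s :* con (+ 1)) := (con (+ 1) :* p :+ R) :- R :- s :* c) refl (p (suc m)) (+ c) (+ suc m) R ⟩
        (+ 1 ℤ.* p (suc m) ℤ.+ R) ℤ.- R ℤ.- + suc m ℤ.* + c
          ≡⟨ cong (λ y → (y ℤ.* p (suc m) ℤ.+ R) ℤ.- R ℤ.- + suc m ℤ.* + c) (sym h₀) ⟩
        (h 0 ℤ.* p (suc m) ℤ.+ R) ℤ.- R ℤ.- + suc m ℤ.* + c
          ≡⟨ cong (λ y → y ℤ.- R ℤ.- + suc m ℤ.* + c) (sym (eq (suc m))) ⟩
        + suc m ℤ.* x ℤ.- R ℤ.- + suc m ℤ.* + c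
          ≡⟨ cong (λ y → + suc m ℤ.* y ℤ.- R ℤ.- + suc m ℤ.* + c) (a≡a%ℕn+[a/ℕn]*n x M) ⟩
        + suc m ℤ.* (+ c ℤ.+ (x /ℕ M) ℤ.* + M) ℤ.- R ℤ.- + suc m ℤ.* + c
          ≡⟨ solve 5 (λ s c q M R → s :* (c :+ q :* M) :- R :- s :* c := q :* s :* M :+ :- R) refl (+ suc m) (+ c) (x /ℕ M) (+ M) R ⟩
        (x /ℕ M) ℤ.* + suc m ℤ.* + M ℤ.+ ℤ.- R ∎
        where open ≡-Reasoning
      div′ : ∀ j → 1 ≤ j → j ≤ suc m → + M ℤ∣.∣ p′ j
      div′ j 1≤j j≤sm with j ℕ.≟ suc m
      ... | no j≢sm = subst (+ M ℤ∣.∣_) (sym (small j 1≤j j≤m)) (div j 1≤j j≤m)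
        where j≤m = ℕ.s≤s⁻¹ (ℕₚ.≤∧≢⇒< j≤sm j≢sm)
      ... | yes refl = subst (+ M ℤ∣.∣_) (sym top) (ℤ∣.∣m∣n⇒∣m+n (ℤ∣.∣n⇒∣m*n ((x /ℕ M) ℤ.* + suc m) ℤ∣.∣-refl)
                         (ℤ∣.∣m⇒∣-m (conv-∣ (p ∘ suc) (h ∘ suc) m (λ i i<m → div (suc i) (s≤s z≤n) i<m))))
      rec : + M ℤ∣.∣ doldSum p′ M
      rec = go k (suc m) (trans (sym (ℕₚ.+-suc m k)) m+k) p′ (proj₁ next) (proj₁ (proj₂ next)) (proj₂ (proj₂ next)) div′
      dold≡ : doldSum p M ≡ doldSum p′ M ℤ.+ + c ℤ.* doldSum (λ n → + suc m ℤ.* comb (suc m) n) M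
      dold≡ = begin
        doldSum p M
          ≡⟨ doldSum-cong {p} {λ n → p′ n ℤ.+ + c ℤ.* combs n} M (λ n _ _ → solve 2 (λ x y → x := (x :- y) :+ y) refl (p n) (+ c ℤ.* (+ suc m ℤ.* comb (suc m) n))) ⟩
        doldSum (λ n → p′ n ℤ.+ + c ℤ.* (+ suc m ℤ.* comb (suc m) n)) M
          ≡⟨ doldSum-+ p′ (λ n → + c ℤ.* combs n) M ⟩
        doldSum p′ M ℤ.+ doldSum (λ n → + c ℤ.* (+ suc m ℤ.* comb (suc m) n)) M
          ≡⟨ cong (λ y → doldSum p′ M ℤ.+ y) (doldSum-*ˡ (+ c) combs M) ⟩
        doldSum p′ M ℤ.+ + c ℤ.* doldSum (λ n → + suc m ℤ.* comb (suc m) n) M ∎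
        where open ≡-Reasoning

-- Integers in a commutative ring and Horner evaluation

module RingTools where

  module IntegerAction {c ℓ : Level} (R : CommutativeRing c ℓ) where
    open CommutativeRing R renaming (refl to ≈-refl; sym to ≈-sym; trans to ≈-trans; zero to *-zero; reflexive to ≈-reflexive)
    open import Algebra.Properties.Ring ring using (-‿+-comm; -‿distribˡ-*; -0#≈0#; -‿involutive)
    open import Algebra.Solver.Ring.AlmostCommutativeRing using (fromCommutativeRing; _-Raw-AlmostCommutative⟶_)
    open import Data.Maybe.Base using (Maybe; just; nothing)
    open import Relation.Binary.Reasoning.Setoid setoid

    ιℕ : ℕ → Carrier
    ιℕ zero    = 0#
    ιℕ (suc n) = 1# + ιℕ n

    ι : ℤ → Carrier
    ι (+ n)    = ιℕ n
    ι -[1+ n ] = - ιℕ (suc n)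

    private
      ι-⊖ : ∀ m n → ι (m ℤ.⊖ n) ≈ ιℕ m - ιℕ n
      ι-⊖ zero    zero    = ≈-sym (-‿inverseʳ 0#)
      ι-⊖ (suc m) zero    = ≈-trans (≈-sym (+-identityʳ _)) (+-congˡ (≈-sym -0#≈0#))
      ι-⊖ zero    (suc n) = ≈-sym (+-identityˡ _)
      ι-⊖ (suc m) (suc n) = begin
        ι (suc m ℤ.⊖ suc n)                ≡⟨ cong ι (ℤₚ.[1+m]⊖[1+n]≡m⊖n m n) ⟩
        ι (m ℤ.⊖ n)                        ≈⟨ ι-⊖ m n ⟩
        ιℕ m - ιℕ n                        ≈⟨ +-congʳ (≈-sym (+-identityʳ _)) ⟩
        (ιℕ m + 0#) - ιℕ n                 ≈⟨ +-congʳ (+-congˡ (≈-sym (-‿inverseʳ 1#))) ⟩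
        (ιℕ m + (1# - 1#)) - ιℕ n          ≈⟨ +-congʳ (≈-sym (+-assoc _ _ _)) ⟩
        ((ιℕ m + 1#) - 1#) - ιℕ n          ≈⟨ +-congʳ (+-congʳ (+-comm _ _)) ⟩
        ((1# + ιℕ m) - 1#) - ιℕ n          ≈⟨ +-assoc _ _ _ ⟩
        (1# + ιℕ m) + (- 1# - ιℕ n)        ≈⟨ +-congˡ (-‿+-comm 1# (ιℕ n)) ⟩
        (1# + ιℕ m) - (1# + ιℕ n)          ∎

      ιℕ-+ : ∀ m n → ιℕ (m ℕ.+ n) ≈ ιℕ m + ιℕ n
      ιℕ-+ zero    n = ≈-sym (+-identityˡ _)
      ιℕ-+ (suc m) n = ≈-trans (+-congˡ (ιℕ-+ m n)) (≈-sym (+-assoc _ _ _))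

    ι-+ : ∀ a b → ι (a ℤ.+ b) ≈ ι a + ι b
    ι-+ (+ m)    (+ n)    = ιℕ-+ m n
    ι-+ (+ m)    -[1+ n ] = ι-⊖ m (suc n)
    ι-+ -[1+ m ] (+ n)    = ≈-trans (ι-⊖ n (suc m)) (+-comm _ _)
    ι-+ -[1+ m ] -[1+ n ] = begin
      - ιℕ (suc (suc (m ℕ.+ n)))         ≡⟨ cong (λ x → - ιℕ (suc x)) (sym (ℕₚ.+-suc m n)) ⟩
      - ιℕ (suc m ℕ.+ suc n)             ≈⟨ -‿cong (ιℕ-+ (suc m) (suc n)) ⟩
      - (ιℕ (suc m) + ιℕ (suc n))        ≈⟨ ≈-sym (-‿+-comm _ _) ⟩
      - ιℕ (suc m) - ιℕ (suc n)          ∎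

    ι-neg : ∀ a → ι (ℤ.- a) ≈ - ι a
    ι-neg (+ zero)  = ≈-sym -0#≈0#
    ι-neg (+ suc n) = ≈-refl
    ι-neg -[1+ n ]  = ≈-sym (-‿involutive _)

    ι-1 : ι (+ 1) ≈ 1#
    ι-1 = +-identityʳ 1#

    private
      ι-*ℕ : ∀ n b → ι (+ n ℤ.* b) ≈ ιℕ n * ι b
      ι-*ℕ zero    b = ≈-sym (zeroˡ _)
      ι-*ℕ (suc n) b = begin
        ι (+ suc n ℤ.* b)           ≡⟨ cong ι (ℤₚ.suc-* (+ n) b) ⟩
        ι (b ℤ.+ + n ℤ.* b)         ≈⟨ ι-+ b (+ n ℤ.* b) ⟩
        ι b + ι (+ n ℤ.* b)         ≈⟨ +-cong (≈-sym (*-identityˡ _)) (ι-*ℕ n b) ⟩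
        1# * ι b + ιℕ n * ι b       ≈⟨ ≈-sym (distribʳ _ _ _) ⟩
        (1# + ιℕ n) * ι b           ∎

    ι-* : ∀ a b → ι (a ℤ.* b) ≈ ι a * ι b
    ι-* (+ n)    b = ι-*ℕ n b
    ι-* -[1+ n ] b = begin
      ι (-[1+ n ] ℤ.* b)            ≡⟨ cong ι (sym (ℤₚ.neg-distribˡ-* (+ suc n) b)) ⟩
      ι (ℤ.- (+ suc n ℤ.* b))       ≈⟨ ι-neg (+ suc n ℤ.* b) ⟩
      - ι (+ suc n ℤ.* b)           ≈⟨ -‿cong (ι-*ℕ (suc n) b) ⟩
      - (ιℕ (suc n) * ι b)          ≈⟨ -‿distribˡ-* _ _ ⟩
      - ιℕ (suc n) * ι b            ∎

    ι-cong : ∀ {a b} → a ≡ b → ι a ≈ ι b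
    ι-cong refl = ≈-refl

    open import Algebra.Properties.Semiring.Exp semiring public using (_^_; ^-congˡ; ^-congʳ; ^-assocʳ)

    module ≈-Solver where
      private
        morphism : ℤ.+-*-rawRing -Raw-AlmostCommutative⟶ fromCommutativeRing R
        morphism = record
          { ⟦_⟧ = ι ; +-homo = ι-+ ; *-homo = ι-* ; -‿homo = ι-neg ; 0-homo = ≈-refl ; 1-homo = ι-1 }
        weakly-equal : ∀ a b → Maybe (ι a ≈ ι b)
        weakly-equal a b with a ℤ.≟ b
        ... | yes a≡b = just (ι-cong a≡b)
        ... | no _    = nothing
      open import Algebra.Solver.Ring ℤ.+-*-rawRing (fromCommutativeRing R) morphism weakly-equal public
        using (solve; _:+_; _:*_; :-_; _:-_; _:=_; con)

    -- horner c m y = Σ_{n < m} c n * y ^ (m - 1 - n)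
    horner : (ℕ → Carrier) → ℕ → Carrier → Carrier
    horner c zero    y = 0#
    horner c (suc m) y = y * horner c m y + c m

    horner-cong : ∀ {c c′ y y′} m → (∀ n → n < m → c n ≈ c′ n) → y ≈ y′ → horner c m y ≈ horner c′ m y′
    horner-cong zero    eq y≈y′ = ≈-refl
    horner-cong (suc m) eq y≈y′ = +-cong (*-cong y≈y′ (horner-cong m (λ n n<m → eq n (ℕₚ.m<n⇒m<1+n n<m)) y≈y′)) (eq m ℕₚ.≤-refl)

    horner-congˡ : ∀ {c c′ y} m → (∀ n → n < m → c n ≈ c′ n) → horner c m y ≈ horner c′ m y
    horner-congˡ m eq = horner-cong m eq ≈-refl

    open ≈-Solver

    horner-linear : ∀ c c′ a m y → horner (λ n → c n + a * c′ n) m y ≈ horner c m y + a * horner c′ m y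
    horner-linear c c′ a zero    y = solve 1 (λ a → con (+ 0) := con (+ 0) :+ a :* con (+ 0)) ≈-refl a
    horner-linear c c′ a (suc m) y = ≈-trans (+-congʳ (*-congˡ (horner-linear c c′ a m y)))
      (solve 6 (λ y u v a x x′ → y :* (u :+ a :* v) :+ (x :+ a :* x′) := (y :* u :+ x) :+ a :* (y :* v :+ x′)) ≈-refl
        y (horner c m y) (horner c′ m y) a (c m) (c′ m))

    horner-zero : ∀ {c} m y → (∀ n → n < m → c n ≈ 0#) → horner c m y ≈ 0#
    horner-zero zero    y eq = ≈-refl
    horner-zero (suc m) y eq = ≈-trans (+-cong (≈-trans (*-congˡ (horner-zero m y (λ n n<m → eq n (ℕₚ.m<n⇒m<1+n n<m)))) (zeroʳ y)) (eq m ℕₚ.≤-refl)) (+-identityʳ 0#)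

    horner-* : ∀ c a m y → horner (λ n → a * c n) m y ≈ a * horner c m y
    horner-* c a m y = begin
      horner (λ n → a * c n) m y                    ≈⟨ horner-congˡ m (λ n _ → ≈-sym (+-identityˡ _)) ⟩
      horner (λ n → 0# + a * c n) m y               ≈⟨ horner-linear (λ _ → 0#) c a m y ⟩
      horner (λ _ → 0#) m y + a * horner c m y      ≈⟨ +-congʳ (horner-zero m y (λ _ _ → ≈-refl)) ⟩
      0# + a * horner c m y                         ≈⟨ +-identityˡ _ ⟩
      a * horner c m y                              ∎

    horner-front : ∀ c m y → horner c (suc m) y ≈ c 0 * y ^ m + horner (c ∘ suc) m y
    horner-front c zero    y = ≈-trans (solve 2 (λ y x → y :* con (+ 0) :+ x := x :+ con (+ 0)) ≈-refl y (c 0)) (+-congʳ (≈-sym (*-identityʳ _)))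
    horner-front c (suc m) y = ≈-trans (+-congʳ (*-congˡ (horner-front c m y)))
      (solve 5 (λ y x p h z → y :* (x :* p :+ h) :+ z := x :* (y :* p) :+ (y :* h :+ z)) ≈-refl y (c 0) (y ^ m) (horner (c ∘ suc) m y) (c (suc m)))

    -- Synthetic division by y - a: the coefficients of the quotient are the intermediate values of
    -- Horner's scheme at `a`.
    horner-divided : ∀ c m y a → horner c (suc m) y - horner c (suc m) a ≈ (y - a) * horner (λ n → horner c (suc n) a) m y
    horner-divided c zero    y a = solve 3 (λ y a x → (y :* con (+ 0) :+ x) :- (a :* con (+ 0) :+ x) := (y :- a) :* con (+ 0)) ≈-refl y a (c 0)
    horner-divided c (suc m) y a = begin
      (y * Hy + x) - (a * Ha + x)           ≈⟨ solve 5 (λ y hy x a ha → (y :* hy :+ x) :- (a :* ha :+ x) := y :* (hy :- ha) :+ (y :- a) :* ha) ≈-refl y Hy x a Ha ⟩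
      y * (Hy - Ha) + (y - a) * Ha          ≈⟨ +-congʳ (*-congˡ (horner-divided c m y a)) ⟩
      y * ((y - a) * D) + (y - a) * Ha      ≈⟨ solve 4 (λ y s d h → y :* (s :* d) :+ s :* h := s :* (y :* d :+ h)) ≈-refl y (y - a) D Ha ⟩
      (y - a) * (y * D + Ha)                ∎
      where
      Hy = horner c (suc m) y
      Ha = horner c (suc m) a
      x = c (suc m)
      D = horner (λ n → horner c (suc n) a) m y

-- The order ℤ[α] and the heights of its elements

module Lattice where

  bound : (ℕ → ℤ) → ℕ → ℕ
  bound c zero    = 0
  bound c (suc m) = bound c m ℕ.+ ∣ c m ∣

  ∣c∣≤bound : ∀ c m n → n < m → ∣ c n ∣ ≤ bound c m
  ∣c∣≤bound c (suc m) n n<1+m with n ℕ.≟ m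
  ... | yes refl = ℕₚ.m≤n+m ∣ c n ∣ (bound c n)
  ... | no n≢m   = ℕₚ.≤-trans (∣c∣≤bound c m n (ℕₚ.≤∧≢⇒< (ℕ.s≤s⁻¹ n<1+m) n≢m)) (ℕₚ.m≤m+n _ _)

  -- The order ℤ[α], where α is a root of the monic polynomial x ^ (k + 1) + e 1 x ^ k + ⋯ + e (k + 1).
  record MonicOrder (c ℓ : Level) : Set (Level.suc (c ⊔ ℓ)) where
    field
      R : CommutativeRing c ℓ
    open CommutativeRing R
    open RingTools.IntegerAction R
    field
      k    : ℕ
      α    : Carrier
      e    : ℕ → ℤ
      e₀   : e 0 ≡ + 1
      root : horner (λ n → ι (e n)) (suc (suc k)) α ≈ 0#

  module Order {c ℓ : Level} (𝓞 : MonicOrder c ℓ) where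
    open MonicOrder 𝓞 public
    open CommutativeRing R renaming (refl to ≈-refl; sym to ≈-sym; trans to ≈-trans; zero to *-zero; reflexive to ≈-reflexive)
    open RingTools.IntegerAction R
    open ≈-Solver
    open import Relation.Binary.Reasoning.Setoid setoid

    d : ℕ
    d = suc k

    -- Coordinates run from `α ^ k` down to 1, as in Horner's scheme; the constant coordinate has
    -- index `k`.
    ⟦_⟧ : (ℕ → ℤ) → Carrier
    ⟦ c ⟧ = horner (λ n → ι (c n)) d α

    Height : ℕ → Carrier → Set ℓ
    Height h x = ∃ λ c → (∀ n → n < d → ∣ c n ∣ ≤ h) × x ≈ ⟦ c ⟧

    Integral : Carrier → Set ℓ
    Integral x = ∃ λ h → Height h x

    record Multiple (m : ℤ) (x : Carrier) : Set (c ⊔ ℓ) where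
      constructor multiple
      field
        {quotient} : Carrier
        integral   : Integral quotient
        equality   : x ≈ ι m * quotient

    Height-cong : ∀ {h x y} → x ≈ y → Height h x → Height h y
    Height-cong x≈y (c , c≤ , x≈) = c , c≤ , ≈-trans (≈-sym x≈y) x≈

    Height-mono : ∀ {h h′ x} → h ≤ h′ → Height h x → Height h′ x
    Height-mono h≤ (c , c≤ , x≈) = c , (λ n n<d → ℕₚ.≤-trans (c≤ n n<d) h≤) , x≈

    ⟦⟧-Height : ∀ c → Height (bound c d) ⟦ c ⟧
    ⟦⟧-Height c = c , ∣c∣≤bound c d , ≈-refl

    ⟦⟧-linear : ∀ a b s → ⟦ (λ n → a n ℤ.+ s ℤ.* b n) ⟧ ≈ ⟦ a ⟧ + ι s * ⟦ b ⟧
    ⟦⟧-linear a b s = ≈-trans (horner-congˡ d (λ n _ → ≈-trans (ι-+ (a n) (s ℤ.* b n)) (+-congˡ (ι-* s (b n)))))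
      (horner-linear (λ n → ι (a n)) (λ n → ι (b n)) (ι s) d α)

    Height-linear : ∀ {h h′ x y} s → Height h x → Height h′ y → Height (h ℕ.+ ∣ s ∣ ℕ.* h′) (x + ι s * y)
    Height-linear s (a , a≤ , x≈) (b , b≤ , y≈) = (λ n → a n ℤ.+ s ℤ.* b n)
      , (λ n n<d → ℕₚ.≤-trans (ℤₚ.∣i+j∣≤∣i∣+∣j∣ (a n) (s ℤ.* b n)) (ℕₚ.+-mono-≤ (a≤ n n<d)
          (ℕₚ.≤-trans (ℕₚ.≤-reflexive (ℤₚ.abs-* s (b n))) (ℕₚ.*-monoʳ-≤ ∣ s ∣ (b≤ n n<d)))))
      , ≈-trans (+-cong x≈ (*-congˡ y≈)) (≈-sym (⟦⟧-linear a b s))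

    Height-0 : Height 0 0#
    Height-0 = (λ _ → + 0) , (λ _ _ → z≤n) , ≈-sym (horner-zero d α (λ _ _ → ≈-refl))

    Height-+ : ∀ {h h′ x y} → Height h x → Height h′ y → Height (h ℕ.+ h′) (x + y)
    Height-+ {h} {h′} Hx Hy = Height-mono (ℕₚ.≤-reflexive (cong (h ℕ.+_) (ℕₚ.*-identityˡ h′)))
      (Height-cong (+-congˡ (≈-trans (*-congʳ ι-1) (*-identityˡ _))) (Height-linear (+ 1) Hx Hy))

    Height-ι* : ∀ {h y} s → Height h y → Height (∣ s ∣ ℕ.* h) (ι s * y)
    Height-ι* s Hy = Height-cong (+-identityˡ _) (Height-linear s Height-0 Hy)

    one : ℕ → ℤ
    one n = if ⌊ n ℕ.≟ k ⌋ then + 1 else + 0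

    one-< : ∀ n → n < k → one n ≡ + 0
    one-< n n<k with n ℕ.≟ k
    ... | yes refl = contradiction n<k (ℕₚ.<-irrefl refl)
    ... | no _     = refl

    ⟦one⟧ : 1# ≈ ⟦ one ⟧
    ⟦one⟧ = ≈-sym (begin
      α * horner (λ n → ι (one n)) k α + ι (one k)    ≈⟨ +-cong (*-congˡ (horner-zero k α (λ n n<k → ι-cong (one-< n n<k)))) (ι-cong one-k) ⟩
      α * 0# + ι (+ 1)                                ≈⟨ +-cong (zeroʳ α) ι-1 ⟩
      0# + 1#                                         ≈⟨ +-identityˡ 1# ⟩
      1#                                              ∎)
      where
      one-k : one k ≡ + 1
      one-k with k ℕ.≟ k
      ... | yes _  = refl
      ... | no k≢k = contradiction refl k≢k

    Height-1 : Height 1 1#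
    Height-1 = one , one≤ , ⟦one⟧
      where
      one≤ : ∀ n → n < d → ∣ one n ∣ ≤ 1
      one≤ n _ with n ℕ.≟ k
      ... | yes _ = ℕₚ.≤-refl
      ... | no _  = z≤n

    private
      E : ℕ
      E = bound (e ∘ suc) d

      truncate : (ℕ → ℤ) → ℕ → ℤ
      truncate c n = if ⌊ n ℕ.<? d ⌋ then c n else + 0

      truncate-< : ∀ c n → n < d → truncate c n ≡ c n
      truncate-< c n n<d with n ℕ.<? d
      ... | yes _  = refl
      ... | no n≮d = contradiction n<d n≮d

      truncate-d : ∀ c → truncate c d ≡ + 0
      truncate-d c with d ℕ.<? d
      ... | yes d<d = contradiction d<d (ℕₚ.<-irrefl refl)
      ... | no _    = refl

      α^d : α ^ d ≈ - ⟦ e ∘ suc ⟧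
      α^d = begin
        α ^ d                                            ≈⟨ solve 2 (λ x y → x := (x :+ y) :- y) ≈-refl (α ^ d) ⟦ e ∘ suc ⟧ ⟩
        (α ^ d + ⟦ e ∘ suc ⟧) - ⟦ e ∘ suc ⟧              ≈⟨ +-congʳ (+-congʳ (≈-sym (≈-trans (*-congʳ (≈-trans (ι-cong e₀) ι-1)) (*-identityˡ _)))) ⟩
        (ι (e 0) * α ^ d + ⟦ e ∘ suc ⟧) - ⟦ e ∘ suc ⟧    ≈⟨ +-congʳ (≈-sym (horner-front (λ n → ι (e n)) d α)) ⟩
        horner (λ n → ι (e n)) (suc d) α - ⟦ e ∘ suc ⟧   ≈⟨ +-congʳ root ⟩
        0# - ⟦ e ∘ suc ⟧                                 ≈⟨ +-identityˡ _ ⟩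
        - ⟦ e ∘ suc ⟧                                    ∎

      -- The coordinates move up one place, and the overflow `c 0 * α ^ d` is expanded by the monic
      -- equation.
      α*⟦_⟧ : ∀ c → α * ⟦ c ⟧ ≈ ⟦ (λ n → truncate c (suc n) ℤ.+ (ℤ.- c 0) ℤ.* e (suc n)) ⟧
      α*⟦ c ⟧ = begin
        α * ⟦ c ⟧
          ≈⟨ *-congˡ (horner-congˡ d (λ n n<d → ι-cong (sym (truncate-< c n n<d)))) ⟩
        α * ⟦ truncate c ⟧
          ≈⟨ ≈-sym (+-identityʳ _) ⟩
        α * ⟦ truncate c ⟧ + 0#
          ≈⟨ +-congˡ (ι-cong (sym (truncate-d c))) ⟩
        horner (λ n → ι (truncate c n)) (suc d) α
          ≈⟨ horner-front (λ n → ι (truncate c n)) d α ⟩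
        ι (truncate c 0) * α ^ d + ⟦ truncate c ∘ suc ⟧
          ≈⟨ +-congʳ (*-cong (ι-cong (truncate-< c 0 (s≤s z≤n))) α^d) ⟩
        ι (c 0) * (- ⟦ e ∘ suc ⟧) + ⟦ truncate c ∘ suc ⟧
          ≈⟨ solve 3 (λ x y z → x :* (:- y) :+ z := z :+ (:- x) :* y) ≈-refl (ι (c 0)) ⟦ e ∘ suc ⟧ ⟦ truncate c ∘ suc ⟧ ⟩
        ⟦ truncate c ∘ suc ⟧ + (- ι (c 0)) * ⟦ e ∘ suc ⟧
          ≈⟨ +-congˡ (*-congʳ (≈-sym (ι-neg (c 0)))) ⟩
        ⟦ truncate c ∘ suc ⟧ + ι (ℤ.- c 0) * ⟦ e ∘ suc ⟧
          ≈⟨ ≈-sym (⟦⟧-linear (truncate c ∘ suc) (e ∘ suc) (ℤ.- c 0)) ⟩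
        ⟦ (λ n → truncate c (suc n) ℤ.+ (ℤ.- c 0) ℤ.* e (suc n)) ⟧ ∎

      -- The recursion of the Horner loop: multiplication by α costs the factor `1 + E`, and each
      -- added coefficient costs 1.
      growth : ℕ → ℕ
      growth zero    = 0
      growth (suc m) = (1 ℕ.+ E) ℕ.* growth m ℕ.+ 1

    Height-α* : ∀ {h x} → Height h x → Height ((1 ℕ.+ E) ℕ.* h) (α * x)
    Height-α* {h} (c , c≤ , x≈) = (λ n → truncate c (suc n) ℤ.+ (ℤ.- c 0) ℤ.* e (suc n)) , coord≤ , ≈-trans (*-congˡ x≈) α*⟦ c ⟧
      where
      truncate≤ : ∀ n → ∣ truncate c n ∣ ≤ h
      truncate≤ n with n ℕ.<? d
      ... | yes n<d = c≤ n n<d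
      ... | no _    = z≤n
      coord≤ : ∀ n → n < d → ∣ truncate c (suc n) ℤ.+ (ℤ.- c 0) ℤ.* e (suc n) ∣ ≤ h ℕ.+ E ℕ.* h
      coord≤ n n<d = ℕₚ.≤-trans (ℤₚ.∣i+j∣≤∣i∣+∣j∣ (truncate c (suc n)) _) (ℕₚ.+-mono-≤ (truncate≤ (suc n))
        (ℕₚ.≤-trans (ℕₚ.≤-reflexive (trans (ℤₚ.abs-* (ℤ.- c 0) (e (suc n))) (trans (cong (ℕ._* ∣ e (suc n) ∣) (ℤₚ.∣-i∣≡∣i∣ (c 0))) (ℕₚ.*-comm ∣ c 0 ∣ _))))
          (ℕₚ.*-mono-≤ (∣c∣≤bound (e ∘ suc) d n n<d) (c≤ 0 (s≤s z≤n)))))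

    distortion : ℕ
    distortion = growth d

    -- The first factor is unfolded by Horner's scheme, so that only multiplications by α and by
    -- integers occur. The bound is submultiplicative up to the constant `distortion`, which depends
    -- on the polynomial alone.
    Height-* : ∀ {h h′ x y} → Height h x → Height h′ y → Height (distortion ℕ.* (h ℕ.* h′)) (x * y)
    Height-* {h} {h′} {x} {y} (c , c≤ , x≈) Hy = Height-cong (*-congʳ (≈-sym x≈)) (go d ℕₚ.≤-refl)
      where
      go : ∀ m → m ≤ d → Height (growth m ℕ.* (h ℕ.* h′)) (horner (λ n → ι (c n)) m α * y)
      go zero    _   = Height-cong (≈-sym (zeroˡ y)) Height-0
      go (suc m) m<d = Height-mono (ℕₚ.≤-trans (ℕₚ.+-monoʳ-≤ _ (ℕₚ.*-monoˡ-≤ h′ (c≤ m m<d))) (ℕₚ.≤-reflexive eq))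
        (Height-cong (solve 4 (λ a u v y → a :* (u :* y) :+ v :* y := (a :* u :+ v) :* y) ≈-refl α (horner (λ n → ι (c n)) m α) (ι (c m)) y)
          (Height-+ (Height-α* (go m (ℕₚ.<⇒≤ m<d))) (Height-ι* (c m) Hy)))
        where
        eq : (1 ℕ.+ E) ℕ.* (growth m ℕ.* (h ℕ.* h′)) ℕ.+ h ℕ.* h′ ≡ ((1 ℕ.+ E) ℕ.* growth m ℕ.+ 1) ℕ.* (h ℕ.* h′)
        eq = trans (cong₂ ℕ._+_ (sym (ℕₚ.*-assoc (1 ℕ.+ E) (growth m) (h ℕ.* h′))) (sym (ℕₚ.*-identityˡ (h ℕ.* h′))))
                   (sym (ℕₚ.*-distribʳ-+ (h ℕ.* h′) ((1 ℕ.+ E) ℕ.* growth m) 1))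

    abstract
      Integral-cong : ∀ {x y} → x ≈ y → Integral x → Integral y
      Integral-cong x≈y (h , Hx) = h , Height-cong x≈y Hx

      Integral-+ : ∀ {x y} → Integral x → Integral y → Integral (x + y)
      Integral-+ (_ , Hx) (_ , Hy) = _ , Height-+ Hx Hy

      Integral-ι* : ∀ {x} s → Integral x → Integral (ι s * x)
      Integral-ι* s (_ , Hx) = _ , Height-ι* s Hx

      Integral-* : ∀ {x y} → Integral x → Integral y → Integral (x * y)
      Integral-* (_ , Hx) (_ , Hy) = _ , Height-* Hx Hy

      Integral-0 : Integral 0#
      Integral-0 = _ , Height-0

      Integral-1 : Integral 1#
      Integral-1 = _ , Height-1

      Integral-α : Integral α
      Integral-α = _ , Height-cong (*-identityʳ α) (Height-α* Height-1)

      Integral-ι : ∀ s → Integral (ι s)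
      Integral-ι s = Integral-cong (*-identityʳ (ι s)) (Integral-ι* s Integral-1)

      Integral-neg : ∀ {x} → Integral x → Integral (- x)
      Integral-neg {x} Ix = Integral-cong (solve 1 (λ x → con (ℤ.- + 1) :* x := :- x) ≈-refl x) (Integral-ι* (ℤ.- + 1) Ix)

      Integral-sub : ∀ {x y} → Integral x → Integral y → Integral (x - y)
      Integral-sub Ix Iy = Integral-+ Ix (Integral-neg Iy)

      Integral-^ : ∀ {x} n → Integral x → Integral (x ^ n)
      Integral-^ zero    Ix = Integral-1
      Integral-^ (suc n) Ix = Integral-* Ix (Integral-^ n Ix)

      Multiple-cong : ∀ {m x y} → x ≈ y → Multiple m x → Multiple m y
      Multiple-cong x≈y (multiple {w} Iw x≈) = multiple Iw (≈-trans (≈-sym x≈y) x≈)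

      Multiple-ι* : ∀ m {w} → Integral w → Multiple m (ι m * w)
      Multiple-ι* m Iw = multiple Iw ≈-refl

      Multiple-0 : ∀ m → Multiple m 0#
      Multiple-0 m = multiple Integral-0 (≈-sym (zeroʳ (ι m)))

      Multiple-+ : ∀ {m x y} → Multiple m x → Multiple m y → Multiple m (x + y)
      Multiple-+ (multiple {w} Iw x≈) (multiple {v} Iv y≈) = multiple (Integral-+ Iw Iv) (≈-trans (+-cong x≈ y≈) (≈-sym (distribˡ _ _ _)))

      Multiple-neg : ∀ {m x} → Multiple m x → Multiple m (- x)
      Multiple-neg {m} (multiple {w} Iw x≈) = multiple (Integral-neg Iw) (≈-trans (-‿cong x≈) (solve 2 (λ m w → :- (m :* w) := m :* (:- w)) ≈-refl (ι m) w))

      Multiple-sub : ∀ {m x y} → Multiple m x → Multiple m y → Multiple m (x - y)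
      Multiple-sub Mx My = Multiple-+ Mx (Multiple-neg My)

      Multiple-*ʳ : ∀ {m x y} → Multiple m x → Integral y → Multiple m (x * y)
      Multiple-*ʳ (multiple {w} Iw x≈) Iy = multiple (Integral-* Iw Iy) (≈-trans (*-congʳ x≈) (*-assoc _ _ _))

      Multiple-*ˡ : ∀ {m x y} → Integral x → Multiple m y → Multiple m (x * y)
      Multiple-*ˡ Ix My = Multiple-cong (*-comm _ _) (Multiple-*ʳ My Ix)

      Multiple-* : ∀ {m n x y} → Multiple m x → Multiple n y → Multiple (m ℤ.* n) (x * y)
      Multiple-* {m} {n} (multiple {w} Iw x≈) (multiple {v} Iv y≈) = multiple (Integral-* Iw Iv)
        (≈-trans (*-cong x≈ y≈) (≈-trans (solve 4 (λ m w n v → (m :* w) :* (n :* v) := (m :* n) :* (w :* v)) ≈-refl (ι m) w (ι n) v)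
          (*-congʳ (≈-sym (ι-* m n)))))

-- Binomial coefficients modulo a prime

module Binomials where
  open import Data.Nat.Combinatorics using (_C_; nCk≡n!/k![n-k]!; k![n∸k]!∣n!)
  open import Data.Nat.Base using (_!)
  open import Data.Nat.Properties using (_!≢0)
  open import Data.Nat.Primality using (¬prime[0]; ¬prime[1])
  open import Data.Nat.DivMod using (m/n*n≡m)

  nCk*k![n∸k]! : ∀ {n k} → k ≤ n → (n C k) ℕ.* (k ! ℕ.* (n ∸ k) !) ≡ n !
  nCk*k![n∸k]! {n} {k} k≤n = trans (cong (ℕ._* (k ! ℕ.* (n ∸ k) !)) (nCk≡n!/k![n-k]! k≤n))
    (m/n*n≡m {{ℕₚ.m*n≢0 (k !) ((n ∸ k) !) {{k !≢0}} {{(n ∸ k) !≢0}}}} (k![n∸k]!∣n! k≤n))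

  prime∤! : ∀ {p k} → Prime p → k < p → p ∤ k !
  prime∤! {p} {zero}  pp _   p∣ with ℕ∣.∣1⇒≡1 p∣
  ... | refl = ¬prime[1] pp
  prime∤! {p} {suc k} pp k<p p∣ with euclidsLemma (suc k) (k !) pp p∣
  ... | inj₁ p∣k  = ℕₚ.<⇒≱ k<p (ℕ∣.∣⇒≤ p∣k)
  ... | inj₂ p∣k! = prime∤! pp (ℕₚ.<⇒≤ k<p) p∣k!

  prime∣C : ∀ {p k} → Prime p → 1 ≤ k → k < p → p ∣ p C k
  prime∣C {p@(suc _)} {k} pp 1≤k k<p with euclidsLemma (p C k) (k ! ℕ.* (p ∸ k) !) pp
      (subst (p ∣_) (sym (nCk*k![n∸k]! (ℕₚ.<⇒≤ k<p))) (ℕ∣.m∣m*n _))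
  ... | inj₁ p∣C = p∣C
  ... | inj₂ p∣!! with euclidsLemma (k !) ((p ∸ k) !) pp p∣!!
  ...   | inj₁ p∣k! = contradiction p∣k! (prime∤! pp k<p)
  ...   | inj₂ p∣!  = contradiction p∣! (prime∤! pp (ℕₚ.∸-monoʳ-< 1≤k (ℕₚ.<⇒≤ k<p)))
  prime∣C {zero} pp = contradiction pp ¬prime[0]

-- Frobenius congruences in the order

module Frobenius where
  open Binomials
  open Lattice using (MonicOrder; module Order)
  open import Data.Nat.Primality using (¬prime[0])
  open import Data.Nat.Combinatorics using (_C_; nCn≡1)
  import Data.Fin as Fin
  import Data.Fin.Properties as Finₚ

  module Congruence {c ℓ : Level} (𝓞 : MonicOrder c ℓ) (p : ℕ) where
    open Order 𝓞
    open CommutativeRing R renaming (refl to ≈-refl; sym to ≈-sym; trans to ≈-trans; zero to *-zero; reflexive to ≈-reflexive)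
    open RingTools.IntegerAction R
    open ≈-Solver
    open import Algebra.Properties.CommutativeSemiring.Exp commutativeSemiring using (^-distrib-*)

    infix 4 _≋_
    _≋_ : Carrier → Carrier → Set (c ⊔ ℓ)
    x ≋ y = Multiple (+ p) (x - y)

    ≈⇒≋ : ∀ {x y} → x ≈ y → x ≋ y
    ≈⇒≋ {x} {y} x≈y = Multiple-cong (≈-sym (≈-trans (+-congʳ x≈y) (-‿inverseʳ y))) (Multiple-0 (+ p))

    ≋-sym : ∀ {x y} → x ≋ y → y ≋ x
    ≋-sym {x} {y} m = Multiple-cong (solve 2 (λ x y → :- (x :- y) := y :- x) ≈-refl x y) (Multiple-neg m)

    ≋-trans : ∀ {x y z} → x ≋ y → y ≋ z → x ≋ z
    ≋-trans {x} {y} {z} m n = Multiple-cong (solve 3 (λ x y z → (x :- y) :+ (y :- z) := x :- z) ≈-refl x y z) (Multiple-+ m n)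

    ≋-+ : ∀ {x y u v} → x ≋ y → u ≋ v → x + u ≋ y + v
    ≋-+ {x} {y} {u} {v} m n = Multiple-cong (solve 4 (λ x y u v → (x :- y) :+ (u :- v) := (x :+ u) :- (y :+ v)) ≈-refl x y u v) (Multiple-+ m n)

    ≋-neg : ∀ {x y} → x ≋ y → - x ≋ - y
    ≋-neg {x} {y} m = Multiple-cong (solve 2 (λ x y → :- (x :- y) := :- x :- :- y) ≈-refl x y) (Multiple-neg m)

    ≋-* : ∀ {x y u v} → Integral u → Integral y → x ≋ y → u ≋ v → x * u ≋ y * v
    ≋-* {x} {y} {u} {v} Iu Iy m n = Multiple-cong (solve 4 (λ x y u v → (x :- y) :* u :+ y :* (u :- v) := x :* u :- y :* v) ≈-refl x y u v)
      (Multiple-+ (Multiple-*ʳ m Iu) (Multiple-*ˡ Iy n))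

    ≋-^ : ∀ {x y} n → Integral x → Integral y → x ≋ y → x ^ n ≋ y ^ n
    ≋-^ zero    Ix Iy x≋y = ≈⇒≋ ≈-refl
    ≋-^ (suc n) Ix Iy x≋y = ≋-* (Integral-^ n Ix) Iy x≋y (≋-^ n Ix Iy x≋y)

    private
      open import Algebra.Properties.Semiring.Mult semiring using () renaming (_×_ to _·_)

      ×-ι : ∀ n x → n · x ≈ ι (+ n) * x
      ×-ι zero    x = ≈-sym (zeroˡ x)
      ×-ι (suc n) x = ≈-trans (+-cong (≈-sym (*-identityˡ x)) (×-ι n x)) (≈-sym (distribʳ x 1# (ιℕ n)))

      open import Algebra.Properties.Semiring.Sum semiring using (sum; sum-init-last)
      open import Algebra.Properties.CommutativeSemiring.Binomial commutativeSemiring using (theorem; binomialTerm)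

      sum-≋0 : ∀ {n} (t : Fin n → Carrier) → (∀ i → t i ≋ 0#) → sum t ≋ 0#
      sum-≋0 {zero}  t eq = ≈⇒≋ ≈-refl
      sum-≋0 {suc n} t eq = ≋-trans (≋-+ (eq Fin.zero) (sum-≋0 (t ∘ Fin.suc) (eq ∘ Fin.suc))) (≈⇒≋ (+-identityʳ 0#))

    module _ (pp : Prime p) where
      frobenius-+ : ∀ {x y} → Integral x → Integral y → (x + y) ^ p ≋ x ^ p + y ^ p
      frobenius-+ {x} {y} Ix Iy = go p refl
        where
        go : ∀ n → p ≡ n → (x + y) ^ n ≋ x ^ n + y ^ n
        go zero    refl = contradiction pp ¬prime[0]
        go (suc n) refl = ≋-trans (≈⇒≋ (≈-trans (theorem (suc n) x y) (+-congˡ (sum-init-last t))))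
            (≋-trans (≋-+ (≈⇒≋ first) (≋-+ (sum-≋0 (λ i → t (Fin.inject₁ i)) middle) (≈⇒≋ last)))
              (≈⇒≋ (≈-trans (+-congˡ (+-identityˡ _)) (+-comm _ _))))
          where
          t : Fin (suc n) → Carrier
          t i = binomialTerm x y (suc n) (Fin.suc i)
          first : binomialTerm x y (suc n) Fin.zero ≈ y ^ suc n
          first = ≈-trans (×-ι (suc n C 0) (1# * y ^ suc n)) (≈-trans (*-congʳ ι-1) (≈-trans (*-identityˡ _) (*-identityˡ _)))
          last : t (Fin.fromℕ n) ≈ x ^ suc n
          last = ≈-trans (×-ι (suc n C suc (toℕ (Fin.fromℕ n))) (x ^ suc (toℕ (Fin.fromℕ n)) * y ^ (n ∸ toℕ (Fin.fromℕ n)))) (≈-trans (*-cong (≈-trans (ι-cong (cong +_ (trans (cong (λ j → suc n C suc j) (Finₚ.toℕ-fromℕ n)) (nCn≡1 (suc n))))) ι-1)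
              (*-cong (≈-reflexive (cong (λ j → x ^ suc j) (Finₚ.toℕ-fromℕ n)))
                      (≈-reflexive (cong (y ^_) (trans (cong (n ∸_) (Finₚ.toℕ-fromℕ n)) (ℕₚ.n∸n≡0 n))))))
            (≈-trans (*-identityˡ _) (*-identityʳ _)))
          middle : ∀ i → t (Fin.inject₁ i) ≋ 0#
          middle i with prime∣C pp (s≤s z≤n) (s≤s (subst (_< n) (sym (Finₚ.toℕ-inject₁ i)) (Finₚ.toℕ<n i)))
          ... | divides q C≡ = Multiple-cong (≈-sym (≈-trans (solve 1 (λ z → z :- con (+ 0) := z) ≈-refl _) (≈-trans (×-ι (suc n C suc (toℕ (Fin.inject₁ i))) monomial)
                (≈-trans (*-congʳ (≈-trans (ι-cong (trans (cong +_ (trans C≡ (ℕₚ.*-comm q (suc n)))) (ℤₚ.pos-* (suc n) q))) (ι-* (+ suc n) (+ q)))) (*-assoc _ _ _)))))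
                (Multiple-ι* (+ suc n) (Integral-ι* (+ q) (Integral-* (Integral-^ (suc (toℕ (Fin.inject₁ i))) Ix) (Integral-^ (n ∸ toℕ (Fin.inject₁ i)) Iy))))
            where monomial = x ^ suc (toℕ (Fin.inject₁ i)) * y ^ (n ∸ toℕ (Fin.inject₁ i))

      0^p : 0# ^ p ≈ 0#
      0^p = go p refl
        where
        go : ∀ n → p ≡ n → 0# ^ n ≈ 0#
        go zero    refl = contradiction pp ¬prime[0]
        go (suc n) _    = zeroˡ _

      1^ : ∀ n → 1# ^ n ≈ 1#
      1^ zero    = ≈-refl
      1^ (suc n) = ≈-trans (*-identityˡ _) (1^ n)

      -- Additivity gives x ^ p + (- x) ^ p ≡ 0 ^ p, which treats `p = 2` together with the odd
      -- primes.
      frobenius-neg : ∀ {x} → Integral x → (- x) ^ p ≋ - (x ^ p)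
      frobenius-neg {x} Ix = ≋-trans (≈⇒≋ (solve 2 (λ a b → a := (b :+ a) :+ :- b) ≈-refl ((- x) ^ p) (x ^ p)))
        (≋-trans (≋-+ (≋-trans (≋-sym (frobenius-+ Ix (Integral-neg Ix))) (≈⇒≋ (≈-trans (^-congˡ p (-‿inverseʳ x)) 0^p))) (≈⇒≋ ≈-refl))
          (≈⇒≋ (+-identityˡ _)))

      frobenius-sub : ∀ {x y} → Integral x → Integral y → (x - y) ^ p ≋ x ^ p - y ^ p
      frobenius-sub Ix Iy = ≋-trans (frobenius-+ Ix (Integral-neg Iy)) (≋-+ (≈⇒≋ ≈-refl) (frobenius-neg Iy))

      fermatℕ : ∀ n → ιℕ n ^ p ≋ ιℕ n
      fermatℕ zero    = ≈⇒≋ 0^p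
      fermatℕ (suc n) = ≋-trans (frobenius-+ Integral-1 (Integral-ι (+ n))) (≋-+ (≈⇒≋ (1^ p)) (fermatℕ n))

      fermat : ∀ a → ι a ^ p ≋ ι a
      fermat (+ n)    = fermatℕ n
      fermat -[1+ n ] = ≋-trans (frobenius-neg (Integral-ι (+ suc n))) (≋-neg (fermatℕ (suc n)))

      -- The p-th power is additive modulo p and, by Fermat, fixes the integer coefficients, so it
      -- acts on the argument alone.
      frobenius-horner : ∀ (a : ℕ → ℤ) m → horner (λ n → ι (a n)) m α ^ p ≋ horner (λ n → ι (a n)) m (α ^ p)
      frobenius-horner a zero    = ≈⇒≋ 0^p
      frobenius-horner a (suc m) = ≋-trans (frobenius-+ (Integral-* Integral-α (Integral-horner m)) (Integral-ι (a m)))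
        (≋-+ (≋-trans (≈⇒≋ (^-distrib-* α _ p)) (≋-* (Integral-^ p (Integral-horner m)) (Integral-^ p Integral-α) (≈⇒≋ ≈-refl) (frobenius-horner a m))) (fermat (a m)))
        where
        Integral-horner : ∀ m → Integral (horner (λ n → ι (a n)) m α)
        Integral-horner zero    = Integral-0
        Integral-horner (suc m) = Integral-+ (Integral-* Integral-α (Integral-horner m)) (Integral-ι (a m))

-- Vandermonde determinants and divided differences

module Vandermonde where
  open Lattice using (MonicOrder; module Order)
  open import Data.Nat.DivMod using (_/_; _%_; m≡m%n+[m/n]*n)
  open import Data.List.Relation.Unary.All using (All; []; _∷_)

  module Alternants {c ℓ : Level} (R : CommutativeRing c ℓ) where
    open CommutativeRing R renaming (refl to ≈-refl; sym to ≈-sym; trans to ≈-trans; zero to *-zero; reflexive to ≈-reflexive)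
    open RingTools.IntegerAction R
    open ≈-Solver
    open import Relation.Binary.Reasoning.Setoid setoid

    Π : Carrier → List Carrier → Carrier
    Π x []       = 1#
    Π x (y ∷ ys) = (x - y) * Π x ys

    Δ : List Carrier → Carrier
    Δ []       = 1#
    Δ (x ∷ xs) = Π x xs * Δ xs

    -- the alternating sum of F xᵢ (xs without xᵢ)
    alt : (Carrier → List Carrier → Carrier) → List Carrier → Carrier
    alt F []       = 0#
    alt F (x ∷ xs) = F x xs - alt (λ y zs → F y (x ∷ zs)) xs

    -- `F` and `G` need to agree only where `zs` is `xs` without `y`. Of this relation only the
    -- factorisation of `Π w xs` is recorded, which is all that later computations use.
    alt-cong : ∀ {F G} xs → (∀ y zs → (∀ w → Π w xs ≈ (w - y) * Π w zs) → F y zs ≈ G y zs) → alt F xs ≈ alt G xs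
    alt-cong []       eq = ≈-refl
    alt-cong (x ∷ xs) eq = +-cong (eq x xs (λ w → ≈-refl)) (-‿cong (alt-cong xs (λ y zs Π≈ → eq y (x ∷ zs) (λ w →
      ≈-trans (*-congˡ (Π≈ w)) (solve 3 (λ a b c → a :* (b :* c) := b :* (a :* c)) ≈-refl (w - x) (w - y) (Π w zs))))))

    alt-linear : ∀ F G a b xs → alt (λ y zs → a * F y zs - b * G y zs) xs ≈ a * alt F xs - b * alt G xs
    alt-linear F G a b []       = solve 2 (λ a b → con (+ 0) := a :* con (+ 0) :- b :* con (+ 0)) ≈-refl a b
    alt-linear F G a b (x ∷ xs) = ≈-trans (+-congˡ (-‿cong (alt-linear (λ y zs → F y (x ∷ zs)) (λ y zs → G y (x ∷ zs)) a b xs)))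
      (solve 6 (λ a b f g u v → (a :* f :- b :* g) :- (a :* u :- b :* v) := a :* (f :- u) :- b :* (g :- v)) ≈-refl
        a b (F x xs) (G x xs) (alt (λ y zs → F y (x ∷ zs)) xs) (alt (λ y zs → G y (x ∷ zs)) xs))

    -- the determinant with rows (Q x, x ^ (n - 2), …, x, 1), expanded along its first column
    Λ : (Carrier → Carrier) → List Carrier → Carrier
    Λ Q = alt (λ y zs → Q y * Δ zs)

    -- `Λ Q` is the divided difference of `Q` at the given points times their Vandermonde product.
    -- The identity is the recurrence (x - x′) Q[x, x′, ys] = Q[x, ys] - Q[x′, ys] with denominators
    -- cleared, so it holds without division.
    Λ-∷∷ : ∀ Q x x′ ys → Λ Q (x ∷ x′ ∷ ys) ≈ Λ Q (x ∷ ys) * Π x′ ys - Λ Q (x′ ∷ ys) * Π x ys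
    Λ-∷∷ Q x x′ ys = begin
      Q x * (Π x′ ys * Δ ys) - (Q x′ * (Π x ys * Δ ys) - alt (λ y zs → Q y * Δ (x ∷ x′ ∷ zs)) ys)
        ≈⟨ +-congˡ (-‿cong (+-congˡ (-‿cong (≈-trans (alt-cong ys split) (alt-linear F′ F (Π x ys) (Π x′ ys) ys))))) ⟩
      Q x * (Π x′ ys * Δ ys) - (Q x′ * (Π x ys * Δ ys) - (Π x ys * alt F′ ys - Π x′ ys * alt F ys))
        ≈⟨ solve 7 (λ q q′ p p′ D A B → q :* (p′ :* D) :- (q′ :* (p :* D) :- (p :* B :- p′ :* A)) := (q :* D :- A) :* p′ :- (q′ :* D :- B) :* p) ≈-refl
             (Q x) (Q x′) (Π x ys) (Π x′ ys) (Δ ys) (alt F ys) (alt F′ ys) ⟩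
      (Q x * Δ ys - alt F ys) * Π x′ ys - (Q x′ * Δ ys - alt F′ ys) * Π x ys ∎
      where
      F F′ : Carrier → List Carrier → Carrier
      F  y zs = Q y * Δ (x ∷ zs)
      F′ y zs = Q y * Δ (x′ ∷ zs)
      -- This rests on x - x′ = (x - y) - (x′ - y); the two new factors complete the products over
      -- `zs` to products over `ys`.
      split : ∀ y zs → (∀ w → Π w ys ≈ (w - y) * Π w zs) → Q y * Δ (x ∷ x′ ∷ zs) ≈ Π x ys * F′ y zs - Π x′ ys * F y zs
      split y zs Π≈ = ≈-trans
        (solve 7 (λ q x x′ y p p′ D → q :* (((x :- x′) :* p) :* (p′ :* D)) := ((x :- y) :* p) :* (q :* (p′ :* D)) :- ((x′ :- y) :* p′) :* (q :* (p :* D))) ≈-refl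
          (Q y) x x′ y (Π x zs) (Π x′ zs) (Δ zs))
        (+-cong (*-congʳ (≈-sym (Π≈ x))) (-‿cong (*-congʳ (≈-sym (Π≈ x′)))))

    -- g is a polynomial function of degree at most n whose coefficient of degree n is a
    Leading : ℕ → Carrier → (Carrier → Carrier) → Set (c ⊔ ℓ)
    Leading zero    a g = Level.Lift (c ⊔ ℓ) (∀ y → g y ≈ a)
    Leading (suc n) a g = ∀ b → ∃ λ g′ → Leading n a g′ × (∀ y → g y - g b ≈ (y - b) * g′ y)

    Leading-cong : ∀ n {a a′ g g′} → a ≈ a′ → (∀ y → g y ≈ g′ y) → Leading n a g → Leading n a′ g′
    Leading-cong zero    a≈ g≈ (Level.lift eq) = Level.lift (λ y → ≈-trans (≈-sym (g≈ y)) (≈-trans (eq y) a≈))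
    Leading-cong (suc n) a≈ g≈ lead b with lead b
    ... | h , lead-h , eq = h , Leading-cong n a≈ (λ _ → ≈-refl) lead-h , λ y → ≈-trans (+-cong (≈-sym (g≈ y)) (-‿cong (≈-sym (g≈ b)))) (eq y)

    Leading-+* : ∀ n {a b g h} s → Leading n a g → Leading n b h → Leading n (a + s * b) (λ y → g y + s * h y)
    Leading-+* zero    s (Level.lift eq) (Level.lift eq′) = Level.lift (λ y → +-cong (eq y) (*-congˡ (eq′ y)))
    Leading-+* (suc n) {g = g} {h} s lead lead′ b with lead b | lead′ b
    ... | g′ , lg , eq | h′ , lh , eq′ = _ , Leading-+* n s lg lh , λ y → begin
        (g y + s * h y) - (g b + s * h b)            ≈⟨ solve 5 (λ u v s w z → (u :+ s :* v) :- (w :+ s :* z) := (u :- w) :+ s :* (v :- z)) ≈-refl (g y) (h y) s (g b) (h b) ⟩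
        (g y - g b) + s * (h y - h b)                ≈⟨ +-cong (eq y) (*-congˡ (eq′ y)) ⟩
        (y - b) * g′ y + s * ((y - b) * h′ y)        ≈⟨ solve 4 (λ d u s v → d :* u :+ s :* (d :* v) := d :* (u :+ s :* v)) ≈-refl (y - b) (g′ y) s (h′ y) ⟩
        (y - b) * (g′ y + s * h′ y)                  ∎

    Leading-pad : ∀ n {a g} → Leading n a g → Leading (suc n) 0# g
    Leading-pad zero    (Level.lift eq) b = (λ _ → 0#) , Level.lift (λ _ → ≈-refl) , λ y →
      ≈-trans (+-cong (eq y) (-‿cong (eq b))) (≈-trans (-‿inverseʳ _) (≈-sym (zeroʳ _)))
    Leading-pad (suc n) lead b with lead b
    ... | g′ , lead′ , eq = g′ , Leading-pad n lead′ , eq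

    Leading-pads : ∀ m n {a g} → Leading n a g → Leading (suc m ℕ.+ n) 0# g
    Leading-pads zero    n lead = Leading-pad n lead
    Leading-pads (suc m) n lead = Leading-pad (suc m ℕ.+ n) (Leading-pads m n lead)

    Leading-y* : ∀ n {a g} → Leading n a g → Leading (suc n) a (λ y → y * g y)
    Leading-y* zero    {a} {g} (Level.lift eq) b = (λ _ → a) , Level.lift (λ _ → ≈-refl) , λ y → ≈-trans (+-cong (*-congˡ (eq y)) (-‿cong (*-congˡ (eq b))))
      (solve 3 (λ y b a → y :* a :- b :* a := (y :- b) :* a) ≈-refl y b a)
    Leading-y* (suc n) {a} {g} lead b with lead b
    ... | g′ , lead′ , eq = _ , Leading-cong (suc n) (solve 2 (λ a b → a :+ b :* con (+ 0) := a) ≈-refl a b) (λ _ → ≈-refl) (Leading-+* (suc n) b lead (Leading-pad n lead′)) ,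
      λ y → begin
        y * g y - b * g b                          ≈⟨ solve 4 (λ y u b v → y :* u :- b :* v := (y :- b) :* u :+ b :* (u :- v)) ≈-refl y (g y) b (g b) ⟩
        (y - b) * g y + b * (g y - g b)            ≈⟨ +-congˡ (*-congˡ (eq y)) ⟩
        (y - b) * g y + b * ((y - b) * g′ y)       ≈⟨ solve 4 (λ d u b v → d :* u :+ b :* (d :* v) := d :* (u :+ b :* v)) ≈-refl (y - b) (g y) b (g′ y) ⟩
        (y - b) * (g y + b * g′ y)                 ∎

    Leading-y^* : ∀ m n {a g} → Leading n a g → Leading (m ℕ.+ n) a (λ y → y ^ m * g y)
    Leading-y^* zero    n lead = Leading-cong n ≈-refl (λ y → ≈-sym (*-identityˡ _)) lead
    Leading-y^* (suc m) n lead = Leading-cong (suc m ℕ.+ n) ≈-refl (λ y → ≈-sym (*-assoc _ _ _)) (Leading-y* (m ℕ.+ n) (Leading-y^* m n lead))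

    -- The exponent is written as `p + 2` to be at least 2: then y g(y) has smaller degree than the
    -- other product and leaves the leading coefficient alone.
    Leading-y^p-y* : ∀ p n {a g} → Leading n a g → Leading (suc (suc p) ℕ.+ n) a (λ y → (y ^ suc (suc p) - y) * g y)
    Leading-y^p-y* p n {a} {g} lead = Leading-cong (suc (suc p) ℕ.+ n)
      (solve 1 (λ a → a :+ con (ℤ.- + 1) :* con (+ 0) := a) ≈-refl a)
      (λ y → solve 3 (λ u v w → u :* w :+ con (ℤ.- + 1) :* (v :* w) := (u :- v) :* w) ≈-refl (y ^ suc (suc p)) y (g y))
      (Leading-+* (suc (suc p) ℕ.+ n) (ι (ℤ.- + 1)) (Leading-y^* (suc (suc p)) n lead)
        (subst (λ m → Leading m 0# (λ y → y * g y)) (ℕₚ.+-suc (suc p) n) (Leading-pads p (suc n) (Leading-y* n lead))))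

    -- The quotient is the divided difference of Q at the points x ∷ ys.
    Λ-Leading : ∀ ys n {a Q} → Leading (List.length ys ℕ.+ n) a Q → ∃ λ g → Leading n a g × (∀ x → Λ Q (x ∷ ys) ≈ g x * Δ (x ∷ ys))
    Λ-Leading []        n {a} {Q} lead = Q , lead , λ x → ≈-trans (solve 2 (λ q o → q :* o :- con (+ 0) := q :* o) ≈-refl (Q x) 1#) (*-congˡ (≈-sym (*-identityˡ 1#)))
    Λ-Leading (x′ ∷ ys) n {a} {Q} lead with Λ-Leading ys (suc n) (subst (λ m → Leading m a Q) (sym (ℕₚ.+-suc (List.length ys) n)) lead)
    ... | g , lead-g , eq with lead-g x′
    ...   | g′ , lead-g′ , eq′ = g′ , lead-g′ , λ x → begin
        Λ Q (x ∷ x′ ∷ ys)                                                 ≈⟨ Λ-∷∷ Q x x′ ys ⟩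
        Λ Q (x ∷ ys) * Π x′ ys - Λ Q (x′ ∷ ys) * Π x ys                   ≈⟨ +-cong (*-congʳ (eq x)) (-‿cong (*-congʳ (eq x′))) ⟩
        (g x * (Π x ys * Δ ys)) * Π x′ ys - (g x′ * (Π x′ ys * Δ ys)) * Π x ys
          ≈⟨ solve 5 (λ u v p p′ D → (u :* (p :* D)) :* p′ :- (v :* (p′ :* D)) :* p := (u :- v) :* (p :* (p′ :* D))) ≈-refl (g x) (g x′) (Π x ys) (Π x′ ys) (Δ ys) ⟩
        (g x - g x′) * (Π x ys * (Π x′ ys * Δ ys))                        ≈⟨ *-congʳ (eq′ x) ⟩
        ((x - x′) * g′ x) * (Π x ys * (Π x′ ys * Δ ys))
          ≈⟨ solve 4 (λ d g p r → (d :* g) :* (p :* r) := g :* ((d :* p) :* r)) ≈-refl (x - x′) (g′ x) (Π x ys) (Π x′ ys * Δ ys) ⟩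
        g′ x * (((x - x′) * Π x ys) * (Π x′ ys * Δ ys))                   ∎

    -- On n points the divided difference of a monic polynomial of degree n - 1 is 1. Thus any monic
    -- polynomial of that degree may replace the leading monomial column.
    Λ≈Δ : ∀ x ys {Q} → Leading (List.length ys) 1# Q → Λ Q (x ∷ ys) ≈ Δ (x ∷ ys)
    Λ≈Δ x ys {Q} lead with Λ-Leading ys 0 (subst (λ m → Leading m 1# Q) (sym (ℕₚ.+-identityʳ _)) lead)
    ... | g , Level.lift g≈1 , eq = ≈-trans (eq x) (≈-trans (*-congʳ (g≈1 x)) (*-identityˡ _))

    alt-closed : ∀ {p q} (P : Carrier → Set p) (G : Carrier → Set q) → P 0# → (∀ {x y} → P x → P y → P (x - y)) →
      ∀ F xs → All G xs → (∀ y zs → G y → All G zs → suc (List.length zs) ≡ List.length xs → P (F y zs)) → P (alt F xs)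
    alt-closed P G P0 P- F []       []       PF = P0
    alt-closed P G P0 P- F (x ∷ xs) (g ∷ gs) PF = P- (PF x xs g gs refl)
      (alt-closed P G P0 P- (λ y zs → F y (x ∷ zs)) xs gs (λ y zs Gy Gzs len → PF y (x ∷ zs) Gy (g ∷ Gzs) (cong suc len)))

  quotientSum : (p : ℕ) → .{{NonZero p}} → ℕ → ℕ
  quotientSum p zero    = 0
  quotientSum p (suc n) = n / p ℕ.+ quotientSum p n

  module _ {c ℓ : Level} (𝓞 : MonicOrder c ℓ) where
    open Order 𝓞
    open CommutativeRing R renaming (refl to ≈-refl; sym to ≈-sym; trans to ≈-trans; zero to *-zero; reflexive to ≈-reflexive)
    open RingTools.IntegerAction R
    open Alternants R

    FrobeniusFixed : ℕ → Carrier → Set (c ⊔ ℓ)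
    FrobeniusFixed p x = Integral x × Multiple (+ p) (x ^ p - x)

    private
      divisor : ℕ → ℕ → ℕ → Carrier → Carrier
      divisor p zero    s y = y ^ s * 1#
      divisor p (suc q) s y = (y ^ suc (suc p) - y) * divisor p q s y

      divisor-Leading : ∀ p q s → Leading (q ℕ.* suc (suc p) ℕ.+ s) 1# (divisor p q s)
      divisor-Leading p zero    s = subst (λ m → Leading m 1# (divisor p 0 s)) (ℕₚ.+-identityʳ s) (Leading-y^* s 0 (Level.lift (λ _ → ≈-refl)))
      divisor-Leading p (suc q) s = subst (λ m → Leading m 1# (divisor p (suc q) s)) (sym (ℕₚ.+-assoc (suc (suc p)) (q ℕ.* suc (suc p)) s))
        (Leading-y^p-y* p (q ℕ.* suc (suc p) ℕ.+ s) (divisor-Leading p q s))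

      divisor-Multiple : ∀ p q s y → FrobeniusFixed (suc (suc p)) y → Multiple ((+ suc (suc p)) ℤ.^ q) (divisor p q s y)
      divisor-Multiple p zero    s y (Iy , _) = Multiple-cong (≈-trans (*-congʳ ι-1) (*-identityˡ _)) (Multiple-ι* (+ 1) (Integral-* (Integral-^ s Iy) Integral-1))
      divisor-Multiple p (suc q) s y F@(_ , M) = Multiple-* M (divisor-Multiple p q s y F)

    -- Replace the monomial column x ^ n of the Vandermonde determinant by (x ^ p - x) ^ q x ^ s, where n = q p + s.
    Δ-Multiple : ∀ p → let P = suc (suc p) in ∀ xs → All (FrobeniusFixed P) xs → Multiple ((+ P) ℤ.^ quotientSum P (List.length xs)) (Δ xs)
    Δ-Multiple p xs all = go (List.length xs) xs refl all
      where
      P = suc (suc p)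
      go : ∀ n xs → List.length xs ≡ n → All (FrobeniusFixed P) xs → Multiple ((+ P) ℤ.^ quotientSum P n) (Δ xs)
      go zero    []       _   []  = Multiple-cong (≈-trans (*-congʳ ι-1) (*-identityˡ _)) (Multiple-ι* (+ 1) Integral-1)
      -- Only the first column is replaced. Its cofactors `Δ zs` are Vandermonde products of one
      -- point fewer, again at fixed points, so the induction hypothesis supplies the remaining
      -- power of `P`.
      go (suc n) (x ∷ ys) len all = subst (λ m → Multiple m (Δ (x ∷ ys))) (sym (ℤₚ.^-distribˡ-+-* (+ P) (n / P) (quotientSum P n)))
        (Multiple-cong (Λ≈Δ x ys lead) (alt-closed (Multiple _) (FrobeniusFixed P) (Multiple-0 _) Multiple-sub _ (x ∷ ys) all
          (λ y zs Fy Fzs len′ → Multiple-* (divisor-Multiple p (n / P) (n % P) y Fy) (go n zs (ℕₚ.suc-injective (trans len′ len)) Fzs))))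
        where
        lead : Leading (List.length ys) 1# (divisor p (n / P) (n % P))
        lead = subst (λ m → Leading m 1# (divisor p (n / P) (n % P)))
          (trans (ℕₚ.+-comm (n / P ℕ.* P) (n % P)) (trans (sym (m≡m%n+[m/n]*n n P)) (sym (ℕₚ.suc-injective len)))) (divisor-Leading p (n / P) (n % P))

-- Superfactorials: prime powers and size

module Factorials where
  open Binomials
  open Vandermonde using (quotientSum)
  open import Data.Nat using (_+_; _*_; _^_; _!)
  open import Data.Nat.Properties using (_!≢0)
  open import Data.Nat.Combinatorics using (_C_; nCk+nC[k+1]≡[n+1]C[k+1]; k>n⇒nCk≡0)
  open import Data.Nat.DivMod using (_/_; _%_; m≡m%n+[m/n]*n; m%n<n; m/n*n≤m; m/n<m)
  open import Data.Nat.Induction using (<-rec)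
  open import Data.Nat.Primality using (prime⇒irreducible; prime⇒nonZero; prime⇒nonTrivial; ¬prime[0]; ¬prime[1])
  open import Data.Nat.Coprimality using (Coprime; coprime-divisor)
  open DoldSums using (primeFactor)
  import Data.Nat.Solver as ℕ-Solver
  open ℕ-Solver.+-*-Solver using (solve; _:+_; _:*_; _:=_; con)

  Exact : ℕ → ℕ → ℕ → Set
  Exact p k n = ∃ λ c → n ≡ p ^ k * c × p ∤ c

  prime∣^ : ∀ {p q} → Prime p → ∀ j → p ∣ q ^ j → p ∣ q
  prime∣^ pp zero    p∣1 with ℕ∣.∣1⇒≡1 p∣1
  ... | refl = contradiction pp ¬prime[1]
  prime∣^ {p} {q} pp (suc j) p∣ with euclidsLemma q (q ^ j) pp p∣
  ... | inj₁ p∣q  = p∣q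
  ... | inj₂ p∣qʲ = prime∣^ pp j p∣qʲ

  module _ {p : ℕ} (pp : Prime p) where
    private instance _ = prime⇒nonZero pp

    Exact-* : ∀ {a b m n} → Exact p a m → Exact p b n → Exact p (a + b) (m * n)
    Exact-* {a} {b} (c , refl , p∤c) (c′ , refl , p∤c′) = c * c′
      , trans (solve 4 (λ x y z w → (x :* y) :* (z :* w) := (x :* z) :* (y :* w)) refl (p ^ a) c (p ^ b) c′) (cong (_* (c * c′)) (sym (ℕₚ.^-distribˡ-+-* p a b)))
      , λ p∣ → [ p∤c , p∤c′ ]′ (euclidsLemma c c′ pp p∣)

    Exact-≤ : ∀ {k n} j → Exact p k n → p ^ j ∣ n → j ≤ k
    Exact-≤ {k}     zero    _ _ = z≤n
    Exact-≤ {zero}  (suc j) (c , refl , p∤c) pʲ∣ = contradiction (subst (p ∣_) (ℕₚ.*-identityˡ c) (ℕ∣.∣-trans (ℕ∣.m∣m*n (p ^ j)) pʲ∣)) p∤c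
    Exact-≤ {suc k} (suc j) (c , refl , p∤c) pʲ∣ = s≤s (Exact-≤ j (c , refl , p∤c) (ℕ∣.*-cancelˡ-∣ p (subst (p ^ suc j ∣_) (ℕₚ.*-assoc p (p ^ k) c) pʲ∣)))

    exact : ∀ n → 1 ≤ n → ∃ λ k → Exact p k n
    exact = <-rec _ step
      where
      step : ∀ n → (∀ {m} → m < n → 1 ≤ m → ∃ λ k → Exact p k m) → 1 ≤ n → ∃ λ k → Exact p k n
      step n rec 1≤n with p ∣? n
      ... | no p∤n = 0 , n , sym (ℕₚ.*-identityˡ n) , p∤n
      ... | yes (divides (suc q) refl) with rec {suc q} (ℕₚ.m<m*n (suc q) p (ℕ.nonTrivial⇒n>1 p {{prime⇒nonTrivial pp}})) (s≤s z≤n)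
      ...   | k , c , eq , p∤c = suc k , c , trans (ℕₚ.*-comm (suc q) p) (trans (cong (p *_) eq) (sym (ℕₚ.*-assoc p (p ^ k) c))) , p∤c

  prime-power-coprime : ∀ {p q} → Prime p → Prime q → q ≢ p → ∀ j k m → q ^ j ∣ p ^ k * m → q ^ j ∣ m
  prime-power-coprime pp qq q≢p j zero    m ∣m = subst (_ ∣_) (ℕₚ.*-identityˡ m) ∣m
  prime-power-coprime {p} {q} pp qq q≢p j (suc k) m ∣pm = prime-power-coprime pp qq q≢p j k m
    (coprime-divisor cop (subst (q ^ j ∣_) (ℕₚ.*-assoc p (p ^ k) m) ∣pm))
    where
    cop : Coprime (q ^ j) p
    cop (i∣qʲ , i∣p) with prime⇒irreducible pp i∣p
    ... | inj₁ i≡1 = i≡1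
    ... | inj₂ refl with prime⇒irreducible qq (prime∣^ pp j i∣qʲ)
    ...   | inj₁ refl = contradiction pp ¬prime[1]
    ...   | inj₂ p≡q  = contradiction (sym p≡q) q≢p

  -- Strong induction on `a`: the full power of one prime is split off `a` and divided out of `b`.
  -- Powers of the other primes survive in the quotient, being prime to what was removed.
  prime-powers⇒∣ : ∀ a b → 1 ≤ a → (∀ p → Prime p → ∀ k → p ^ k ∣ a → p ^ k ∣ b) → a ∣ b
  prime-powers⇒∣ = <-rec _ step
    where
    step : ∀ a → (∀ {c} → c < a → ∀ b → 1 ≤ c → (∀ p → Prime p → ∀ k → p ^ k ∣ c → p ^ k ∣ b) → c ∣ b) →
           ∀ b → 1 ≤ a → (∀ p → Prime p → ∀ k → p ^ k ∣ a → p ^ k ∣ b) → a ∣ b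
    step 1 rec b _ hyp = ℕ∣.1∣ b
    step a@(suc (suc _)) rec b _ hyp with primeFactor a (s≤s (s≤s z≤n))
    ... | p , pp , p∣a with exact pp a (s≤s z≤n)
    ...   | zero , c , eq , p∤c = contradiction (subst (p ∣_) (trans eq (ℕₚ.*-identityˡ c)) p∣a) p∤c
    ...   | suc k , zero , eq , p∤c = contradiction (p ℕ∣.∣0) p∤c
    ...   | suc k , c@(suc _) , eq , p∤c with hyp p pp (suc k) (divides c (trans eq (ℕₚ.*-comm (p ^ suc k) c)))
    ...     | divides b′ refl = subst₂ _∣_ (trans (ℕₚ.*-comm c (p ^ suc k)) (sym eq)) refl (ℕ∣.*-monoˡ-∣ (p ^ suc k) (rec c<a b′ (s≤s z≤n) hyp′))
      where
      open import Relation.Binary.PropositionalEquality using (subst₂)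
      instance _ = prime⇒nonZero pp
      c<a : c < a
      c<a = subst (c <_) (sym eq) (subst (c <_) (ℕₚ.*-comm c (p ^ suc k)) (ℕₚ.m<m*n c (p ^ suc k)
        (ℕₚ.<-≤-trans (ℕ.nonTrivial⇒n>1 p {{prime⇒nonTrivial pp}}) (ℕₚ.m≤m*n p (p ^ k) {{ℕₚ.m^n≢0 p k}}))))
      hyp′ : ∀ q → Prime q → ∀ j → q ^ j ∣ c → q ^ j ∣ b′
      hyp′ q qq j qʲ∣c with q ℕ.≟ p
      ... | no q≢p = prime-power-coprime pp qq q≢p j (suc k) b′ (subst (q ^ j ∣_) (ℕₚ.*-comm b′ (p ^ suc k))
                       (hyp q qq j (subst (q ^ j ∣_) (sym eq) (ℕ∣.∣n⇒∣m*n (p ^ suc k) qʲ∣c))))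
      hyp′ q qq zero    qʲ∣c | yes refl = ℕ∣.1∣ b′
      hyp′ q qq (suc j) qʲ∣c | yes refl = contradiction (ℕ∣.∣-trans (ℕ∣.m∣m*n (q ^ j)) qʲ∣c) p∤c

  module _ {p-2 : ℕ} (pp : Prime (suc (suc p-2))) where
    private
      p = suc (suc p-2)

      -- Legendre's step: only the multiples of `p` up to `q * p + s` contribute factors `p`; these
      -- are `p` times the numbers 1, ..., `q`, and their product is `p ^ q * q !`.
      block! : ∀ q s → s < p → ∃ λ c → (q * p + s) ! ≡ p ^ q * q ! * c × p ∤ c
      block! zero    zero    s<p = 1 , refl , λ p∣1 → contradiction (ℕ∣.∣1⇒≡1 p∣1) λ ()
      block! (suc q) zero    s<p with block! q (suc p-2) ℕₚ.≤-refl
      ... | c , eq , p∤c = c , trans (cong _! index) (trans (cong (suc (q * p + suc p-2) *_) eq) (trans (cong (λ x → x * (p ^ q * q ! * c)) (trans (sym index) (ℕₚ.+-identityʳ (suc q * p))))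
          (solve 5 (λ s p x y c → (s :* p) :* (x :* y :* c) := (p :* x) :* (s :* y) :* c) refl (suc q) p (p ^ q) (q !) c))) , p∤c
        where
        index : suc q * p + 0 ≡ suc (q * p + suc p-2)
        index = trans (ℕₚ.+-identityʳ _) (trans (ℕₚ.+-comm p (q * p)) (ℕₚ.+-suc (q * p) (suc p-2)))
      block! q (suc s) s<p with block! q s (ℕₚ.<⇒≤ s<p)
      ... | c , eq , p∤c = suc (q * p + s) * c , trans (cong _! (ℕₚ.+-suc (q * p) s)) (trans (cong (suc (q * p + s) *_) eq)
              (solve 4 (λ n x y c → n :* (x :* y :* c) := x :* y :* (n :* c)) refl (suc (q * p + s)) (p ^ q) (q !) c))
          , λ p∣ → [ (λ p∣n → ℕₚ.<⇒≱ s<p (ℕ∣.∣⇒≤ (ℕ∣.∣m+n∣m⇒∣n (subst (p ∣_) (sym (ℕₚ.+-suc (q * p) s)) p∣n) (ℕ∣.n∣m*n q)))) , p∤c ]′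
              (euclidsLemma (suc (q * p + s)) c pp p∣)

      Exact-! : ∀ {n v} → Exact p v ((n / p) !) → Exact p (n / p + v) (n !)
      Exact-! {n} {v} (c′ , eq′ , p∤c′) with block! (n / p) (n % p) (m%n<n n p)
      ... | c , eq , p∤c = c′ * c
        , trans (cong _! (trans (m≡m%n+[m/n]*n n p) (ℕₚ.+-comm (n % p) _))) (trans eq (trans (cong (λ x → p ^ (n / p) * x * c) eq′)
            (trans (solve 4 (λ x y c′ c → x :* (y :* c′) :* c := (x :* y) :* (c′ :* c)) refl (p ^ (n / p)) (p ^ v) c′ c)
                   (cong (_* (c′ * c)) (sym (ℕₚ.^-distribˡ-+-* p (n / p) v))))))
        , λ p∣ → [ p∤c′ , p∤c ]′ (euclidsLemma c′ c pp p∣)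

      /p< : ∀ n → suc n / p < suc n
      /p< n = m/n<m (suc n) p (s≤s (s≤s z≤n))

    -- With q = ⌊n/p⌋ induction gives v_p(n!) = q + v_p(q!) ≤ 2 q ≤ p q ≤ n. This crude bound also
    -- covers `p = 2`; it serves the primes up to the bound `P`.
    Exact-!-≤ : ∀ n → ∃ λ v → Exact p v (n !) × v ≤ n
    Exact-!-≤ = <-rec _ step
      where
      step : ∀ n → (∀ {m} → m < n → ∃ λ v → Exact p v (m !) × v ≤ m) → ∃ λ v → Exact p v (n !) × v ≤ n
      step zero    rec = 0 , (1 , refl , λ p∣1 → contradiction (ℕ∣.∣1⇒≡1 p∣1) λ ()) , z≤n
      step (suc n) rec with rec (/p< n)
      ... | v , ex , v≤ = suc n / p + v , Exact-! {suc n} {v} ex , (begin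
          suc n / p + v               ≤⟨ ℕₚ.+-monoʳ-≤ (suc n / p) v≤ ⟩
          suc n / p + suc n / p       ≡⟨ solve 1 (λ q → q :+ q := q :* con 2) refl (suc n / p) ⟩
          suc n / p * 2               ≤⟨ ℕₚ.*-monoʳ-≤ (suc n / p) {2} {p} (s≤s (s≤s z≤n)) ⟩
          suc n / p * p               ≤⟨ m/n*n≤m (suc n) p ⟩
          suc n                       ∎)
        where open ℕₚ.≤-Reasoning

    -- v_p(n!) = q + v_p(q!) with q = ⌊n/p⌋, hence 2 v_p(n!) ≤ n by induction, and then 2 v_p(n!) ≤ 3 q.
    Exact-!-≤3q : 3 ≤ p → ∀ n → ∃ λ v → Exact p v (n !) × 2 * v ≤ 3 * (n / p)
    Exact-!-≤3q 3≤p n with half (n / p)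
      where
      open ℕₚ.≤-Reasoning
      half : ∀ n → ∃ λ v → Exact p v (n !) × 2 * v ≤ n
      half = <-rec _ step
        where
        step : ∀ n → (∀ {m} → m < n → ∃ λ v → Exact p v (m !) × 2 * v ≤ m) → ∃ λ v → Exact p v (n !) × 2 * v ≤ n
        step zero    rec = 0 , (1 , refl , λ p∣1 → contradiction (ℕ∣.∣1⇒≡1 p∣1) λ ()) , z≤n
        step (suc n) rec with rec (/p< n)
        ... | v , ex , v≤ = suc n / p + v , Exact-! {suc n} {v} ex , (begin
          2 * (suc n / p + v)           ≡⟨ solve 2 (λ q v → con 2 :* (q :+ v) := con 2 :* q :+ con 2 :* v) refl (suc n / p) v ⟩
          2 * (suc n / p) + 2 * v       ≤⟨ ℕₚ.+-monoʳ-≤ (2 * (suc n / p)) v≤ ⟩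
          2 * (suc n / p) + suc n / p   ≡⟨ solve 1 (λ q → con 2 :* q :+ q := q :* con 3) refl (suc n / p) ⟩
          suc n / p * 3                 ≤⟨ ℕₚ.*-monoʳ-≤ (suc n / p) 3≤p ⟩
          suc n / p * p                 ≤⟨ m/n*n≤m (suc n) p ⟩
          suc n                         ∎)
    ... | v , ex , v≤ = n / p + v , Exact-! {n} {v} ex , (begin
          2 * (n / p + v)           ≡⟨ solve 2 (λ q v → con 2 :* (q :+ v) := con 2 :* q :+ con 2 :* v) refl (n / p) v ⟩
          2 * (n / p) + 2 * v       ≤⟨ ℕₚ.+-monoʳ-≤ (2 * (n / p)) v≤ ⟩
          2 * (n / p) + n / p       ≡⟨ solve 1 (λ q → con 2 :* q :+ q := con 3 :* q) refl (n / p) ⟩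
          3 * (n / p)               ∎)
      where open ℕₚ.≤-Reasoning

  triangle : ℕ → ℕ
  triangle zero    = 0
  triangle (suc n) = n + triangle n

  superfactorial : ℕ → ℕ
  superfactorial zero    = 1
  superfactorial (suc n) = n ! * superfactorial n

  superfactorial≥1 : ∀ n → 1 ≤ superfactorial n
  superfactorial≥1 zero    = s≤s z≤n
  superfactorial≥1 (suc n) = ℕₚ.*-mono-≤ (ℕ.>-nonZero⁻¹ (n !) {{n !≢0}}) (superfactorial≥1 n)

  module _ {p-2 : ℕ} (pp : Prime (suc (suc p-2))) where
    private p = suc (suc p-2)

    Exact-superfactorial-≤ : ∀ n → ∃ λ v → Exact p v (superfactorial n) × v ≤ triangle n
    Exact-superfactorial-≤ zero    = 0 , (1 , refl , λ p∣1 → contradiction (ℕ∣.∣1⇒≡1 p∣1) λ ()) , z≤n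
    Exact-superfactorial-≤ (suc n) with Exact-!-≤ pp n | Exact-superfactorial-≤ n
    ... | v , ex , v≤ | w , ex′ , w≤ = v + w , Exact-* pp {v} {w} ex ex′ , ℕₚ.+-mono-≤ v≤ w≤

    Exact-superfactorial-≤3q : 3 ≤ p → ∀ n → ∃ λ v → Exact p v (superfactorial n) × 2 * v ≤ 3 * quotientSum p n
    Exact-superfactorial-≤3q 3≤p zero    = 0 , (1 , refl , λ p∣1 → contradiction (ℕ∣.∣1⇒≡1 p∣1) λ ()) , z≤n
    Exact-superfactorial-≤3q 3≤p (suc n) with Exact-!-≤3q pp 3≤p n | Exact-superfactorial-≤3q 3≤p n
    ... | v , ex , v≤ | w , ex′ , w≤ = v + w , Exact-* pp {v} {w} ex ex′ , (begin
        2 * (v + w)                                ≡⟨ ℕₚ.*-distribˡ-+ 2 v w ⟩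
        2 * v + 2 * w                              ≤⟨ ℕₚ.+-mono-≤ v≤ w≤ ⟩
        3 * (n / p) + 3 * quotientSum p n          ≡⟨ sym (ℕₚ.*-distribˡ-+ 3 (n / p) (quotientSum p n)) ⟩
        3 * (n / p + quotientSum p n)              ∎)
      where open ℕₚ.≤-Reasoning

  ∣-^ : ∀ {m n} k → m ∣ n → m ^ k ∣ n ^ k
  ∣-^ zero    _   = ℕ∣.∣-refl
  ∣-^ (suc k) m∣n = ℕ∣.*-pres-∣ m∣n (∣-^ k m∣n)

  ^-monoʳ-∣ : ∀ m {j k} → j ≤ k → m ^ j ∣ m ^ k
  ^-monoʳ-∣ m {j} {k} j≤k = divides (m ^ (k ∸ j)) (trans (cong (m ^_) (sym (ℕₚ.m∸n+n≡m j≤k))) (ℕₚ.^-distribˡ-+-* m (k ∸ j) j))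

  ≤⇒∣! : ∀ {m n} → 1 ≤ m → m ≤ n → m ∣ n !
  ≤⇒∣! {suc m} {n} _ m≤n = ℕ∣.∣-trans (ℕ∣.m∣m*n (m !)) (ℕ∣.m≤n⇒m!∣n! m≤n)

  -- The divisibility is checked prime by prime. A prime up to `P` divides `P !`, and its exponent
  -- in the superfactorial is at most `triangle N`. A prime above `P` is at least 3, and 2 v ≤ 3 q
  -- explains the square on the left and the cube of `z`.
  superfactorial²∣ : ∀ P N z → 2 ≤ P → (∀ p → Prime (suc (suc p)) → P < suc (suc p) → suc (suc p) ^ quotientSum (suc (suc p)) N ∣ z) →
    superfactorial N ^ 2 ∣ (P !) ^ (2 * triangle N) * z ^ 3
  superfactorial²∣ P N z 2≤P hyp = prime-powers⇒∣ _ _ (ℕₚ.*-mono-≤ (superfactorial≥1 N) (ℕₚ.*-mono-≤ (superfactorial≥1 N) (s≤s z≤n))) powers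
    where
    square : ∀ {p v} → Prime p → Exact p v (superfactorial N) → Exact p (2 * v) (superfactorial N ^ 2)
    square {p} {v} pp ex = subst₂ (Exact p) (cong (λ x → v + x) (sym (ℕₚ.+-identityʳ v))) (cong (superfactorial N *_) (sym (ℕₚ.*-identityʳ (superfactorial N)))) (Exact-* pp {v} {v} ex ex)
      where open import Relation.Binary.PropositionalEquality using (subst₂)
    powers : ∀ p → Prime p → ∀ k → p ^ k ∣ superfactorial N ^ 2 → p ^ k ∣ (P !) ^ (2 * triangle N) * z ^ 3
    powers 0 pp = contradiction pp ¬prime[0]
    powers 1 pp = contradiction pp ¬prime[1]
    powers p@(suc (suc p-2)) pp k pᵏ∣ with p ℕ.≤? P
    ... | yes p≤P with Exact-superfactorial-≤ pp N
    ...   | v , ex , v≤ = ℕ∣.∣m⇒∣m*n (z ^ 3) (ℕ∣.∣-trans (^-monoʳ-∣ p (ℕₚ.≤-trans (Exact-≤ pp k (square {p} {v} pp ex) pᵏ∣) (ℕₚ.*-monoʳ-≤ 2 v≤)))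
                            (∣-^ (2 * triangle N) (≤⇒∣! (s≤s z≤n) p≤P)))
    powers p@(suc (suc p-2)) pp k pᵏ∣ | no p≰P with Exact-superfactorial-≤3q pp (ℕₚ.≤-<-trans 2≤P (ℕₚ.≰⇒> p≰P)) N
    ...   | v , ex , v≤ = ℕ∣.∣n⇒∣m*n ((P !) ^ (2 * triangle N)) (ℕ∣.∣-trans (^-monoʳ-∣ p (ℕₚ.≤-trans (Exact-≤ pp k (square {p} {v} pp ex) pᵏ∣) (ℕₚ.≤-trans v≤ (ℕₚ.≤-reflexive (ℕₚ.*-comm 3 (quotientSum p N))))))
                            (subst (_∣ z ^ 3) (ℕₚ.^-*-assoc p (quotientSum p N) 3) (∣-^ 3 (hyp p-2 pp (ℕₚ.≰⇒> p≰P)))))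

  nCk≤2ⁿ : ∀ n k → n C k ≤ 2 ^ n
  nCk≤2ⁿ zero    zero    = ℕₚ.≤-refl
  nCk≤2ⁿ zero    (suc k) = subst (_≤ 1) (sym (k>n⇒nCk≡0 (s≤s (z≤n {k})))) z≤n
  nCk≤2ⁿ (suc n) zero    = ℕₚ.m^n>0 2 (suc n)
  nCk≤2ⁿ (suc n) (suc k) = subst (_≤ 2 ^ suc n) (nCk+nC[k+1]≡[n+1]C[k+1] n k)
    (ℕₚ.≤-trans (ℕₚ.+-mono-≤ (nCk≤2ⁿ n k) (nCk≤2ⁿ n (suc k))) (ℕₚ.≤-reflexive (cong (λ x → 2 ^ n + x) (sym (ℕₚ.+-identityʳ (2 ^ n))))))

  n^j*n!≤[n+j]! : ∀ n j → n ^ j * n ! ≤ (j + n) !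
  n^j*n!≤[n+j]! n zero    = ℕₚ.≤-reflexive (ℕₚ.+-identityʳ (n !))
  n^j*n!≤[n+j]! n (suc j) = ℕₚ.≤-trans (ℕₚ.≤-reflexive (ℕₚ.*-assoc n (n ^ j) (n !)))
    (ℕₚ.*-mono-≤ {n} {suc (j + n)} (ℕₚ.m≤n⇒m≤1+n (ℕₚ.m≤n+m n j)) (n^j*n!≤[n+j]! n j))

  -- A replacement for Stirling's formula: n ^ j / j! is at most the binomial coefficient (n + j)! /
  -- (j! n!), hence at most 2 ^ (j + n).
  n^j≤j!*2^[n+j] : ∀ n j → n ^ j ≤ j ! * 2 ^ (j + n)
  n^j≤j!*2^[n+j] n j = ℕₚ.*-cancelʳ-≤ (n ^ j) (j ! * 2 ^ (j + n)) (n !) {{n !≢0}} (begin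
    n ^ j * n !                            ≤⟨ n^j*n!≤[n+j]! n j ⟩
    (j + n) !                              ≡⟨ sym (nCk*k![n∸k]! (ℕₚ.m≤m+n j n)) ⟩
    ((j + n) C j) * (j ! * (j + n ∸ j) !)  ≡⟨ cong (λ x → ((j + n) C j) * (j ! * x !)) (ℕₚ.m+n∸m≡n j n) ⟩
    ((j + n) C j) * (j ! * n !)            ≤⟨ ℕₚ.*-monoˡ-≤ (j ! * n !) (nCk≤2ⁿ (j + n) j) ⟩
    2 ^ (j + n) * (j ! * n !)              ≡⟨ solve 3 (λ x y z → x :* (y :* z) := y :* x :* z) refl (2 ^ (j + n)) (j !) (n !) ⟩
    j ! * 2 ^ (j + n) * n !                ∎)
    where open ℕₚ.≤-Reasoning

  N^triangle≤ : ∀ N n → N ^ triangle n ≤ superfactorial n * 2 ^ (triangle n + n * N)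
  N^triangle≤ N zero    = ℕₚ.≤-refl
  N^triangle≤ N (suc n) = begin
    N ^ (n + triangle n)                                                        ≡⟨ ℕₚ.^-distribˡ-+-* N n (triangle n) ⟩
    N ^ n * N ^ triangle n                                                      ≤⟨ ℕₚ.*-mono-≤ (n^j≤j!*2^[n+j] N n) (N^triangle≤ N n) ⟩
    (n ! * 2 ^ (n + N)) * (superfactorial n * 2 ^ (triangle n + n * N))         ≡⟨ solve 4 (λ a b c d → (a :* b) :* (c :* d) := a :* c :* (b :* d)) refl (n !) (2 ^ (n + N)) (superfactorial n) _ ⟩
    n ! * superfactorial n * (2 ^ (n + N) * 2 ^ (triangle n + n * N))           ≡⟨ cong (n ! * superfactorial n *_) (sym (ℕₚ.^-distribˡ-+-* 2 (n + N) (triangle n + n * N))) ⟩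
    n ! * superfactorial n * 2 ^ (n + N + (triangle n + n * N))                 ≡⟨ cong (λ x → n ! * superfactorial n * 2 ^ x) (solve 4 (λ n N t s → n :+ N :+ (t :+ s) := n :+ t :+ (N :+ s)) refl n N (triangle n) (n * N)) ⟩
    n ! * superfactorial n * 2 ^ (n + triangle n + (N + n * N))                 ∎
    where open ℕₚ.≤-Reasoning

  n²≡2triangle+n : ∀ n → n * n ≡ 2 * triangle n + n
  n²≡2triangle+n zero    = refl
  n²≡2triangle+n (suc n) = trans (solve 1 (λ n → (con 1 :+ n) :* (con 1 :+ n) := n :* n :+ n :+ n :+ con 1) refl n)
    (trans (cong (λ x → x + n + n + 1) (n²≡2triangle+n n)) (solve 2 (λ n t → con 2 :* t :+ n :+ n :+ n :+ con 1 := con 2 :* (n :+ t) :+ (con 1 :+ n)) refl n (triangle n)))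

  n≤2triangle : ∀ n → 2 ≤ n → n ≤ 2 * triangle n
  n≤2triangle n 2≤n = ℕₚ.+-cancelʳ-≤ n n (2 * triangle n) (begin
    n + n               ≡⟨ solve 1 (λ n → n :+ n := con 2 :* n) refl n ⟩
    2 * n               ≤⟨ ℕₚ.*-monoˡ-≤ n 2≤n ⟩
    n * n               ≡⟨ n²≡2triangle+n n ⟩
    2 * triangle n + n  ∎)
    where open ℕₚ.≤-Reasoning

  -- The error exponent is T + N ^ 2 = 3 T + N ≤ 5 T for T = `triangle N`, and 32 = 2 ^ 5.
  N^triangle≤32 : ∀ N → 2 ≤ N → N ^ triangle N ≤ superfactorial N * 32 ^ triangle N
  N^triangle≤32 N 2≤N = ℕₚ.≤-trans (N^triangle≤ N N) (ℕₚ.*-monoʳ-≤ (superfactorial N) (begin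
    2 ^ (T + N * N)           ≡⟨ cong (λ x → 2 ^ (T + x)) (n²≡2triangle+n N) ⟩
    2 ^ (T + (2 * T + N))     ≤⟨ ℕₚ.^-monoʳ-≤ 2 (ℕₚ.+-monoʳ-≤ T (ℕₚ.+-monoʳ-≤ (2 * T) (n≤2triangle N 2≤N))) ⟩
    2 ^ (T + (2 * T + 2 * T)) ≡⟨ cong (2 ^_) (solve 1 (λ t → t :+ (con 2 :* t :+ con 2 :* t) := con 5 :* t) refl T) ⟩
    2 ^ (5 * T)               ≡⟨ sym (ℕₚ.^-*-assoc 2 5 T) ⟩
    32 ^ T                    ∎))
    where
    open ℕₚ.≤-Reasoning
    T = triangle N

  -- The squared superfactorial of N = X ^ 2 has size about X ^ (4 T), while z ^ 3 ≤ (A X) ^ (3 T).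
  no-small-multiple : ∀ P A X → 2 ≤ P → 2 ≤ X → (P !) ^ 2 * A ^ 3 * 32 ^ 2 < X → ∀ z → 1 ≤ z → z ≤ (A * X) ^ triangle (X * X) →
    ¬ (∀ p → Prime (suc (suc p)) → P < suc (suc p) → suc (suc p) ^ quotientSum (suc (suc p)) (X * X) ∣ z)
  no-small-multiple P A X 2≤P 2≤X B<X z 1≤z z≤ hyp = ℕₚ.<⇒≱ BX³<X⁴ (begin
    (X ^ 4) ^ T                                                ≡⟨ ℕₚ.^-*-assoc X 4 T ⟩
    X ^ (4 * T)                                                ≡⟨ cong (X ^_) (solve 1 (λ t → con 4 :* t := con 2 :* (t :* con 2)) refl T) ⟩
    X ^ (2 * (T * 2))                                          ≡⟨ sym (ℕₚ.^-*-assoc X 2 (T * 2)) ⟩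
    (X ^ 2) ^ (T * 2)                                          ≡⟨ cong (_^ (T * 2)) (cong (X *_) (ℕₚ.*-identityʳ X)) ⟩
    N ^ (T * 2)                                                ≡⟨ sym (ℕₚ.^-*-assoc N T 2) ⟩
    (N ^ T) ^ 2                                                ≤⟨ ℕₚ.^-monoˡ-≤ 2 (N^triangle≤32 N 2≤N) ⟩
    (superfactorial N * 32 ^ T) ^ 2                            ≡⟨ ^-distribʳ-* 2 (superfactorial N) (32 ^ T) ⟩
    superfactorial N ^ 2 * (32 ^ T) ^ 2                        ≤⟨ ℕₚ.*-monoˡ-≤ ((32 ^ T) ^ 2) (ℕ∣.∣⇒≤ {{nonzero}} (superfactorial²∣ P N z 2≤P hyp)) ⟩
    (P !) ^ (2 * T) * z ^ 3 * (32 ^ T) ^ 2                     ≤⟨ ℕₚ.*-monoˡ-≤ ((32 ^ T) ^ 2) (ℕₚ.*-monoʳ-≤ ((P !) ^ (2 * T)) (ℕₚ.^-monoˡ-≤ 3 z≤)) ⟩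
    (P !) ^ (2 * T) * ((A * X) ^ T) ^ 3 * (32 ^ T) ^ 2         ≡⟨ cong₂ _*_ (cong₂ _*_ (sym (ℕₚ.^-*-assoc (P !) 2 T)) (swap (A * X) 3)) (swap 32 2) ⟩
    ((P !) ^ 2) ^ T * ((A * X) ^ 3) ^ T * (32 ^ 2) ^ T         ≡⟨ cong (_* (32 ^ 2) ^ T) (sym (^-distribʳ-* T ((P !) ^ 2) ((A * X) ^ 3))) ⟩
    ((P !) ^ 2 * (A * X) ^ 3) ^ T * (32 ^ 2) ^ T               ≡⟨ sym (^-distribʳ-* T ((P !) ^ 2 * (A * X) ^ 3) (32 ^ 2)) ⟩
    ((P !) ^ 2 * (A * X) ^ 3 * 32 ^ 2) ^ T                     ≡⟨ cong (_^ T) (trans (cong (λ x → (P !) ^ 2 * x * 32 ^ 2) (^-distribʳ-* 3 A X))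
                                                                    (solve 4 (λ a b c d → a :* (b :* c) :* d := a :* b :* d :* c) refl ((P !) ^ 2) (A ^ 3) (X ^ 3) (32 ^ 2))) ⟩
    (B * X ^ 3) ^ T                                            ∎)
    where
    open ℕₚ.≤-Reasoning
    -- The three factors account for the primes up to `P`, for the constant in the size of `z` after
    -- cubing, and for the squared loss in the lower bound of the superfactorial.
    B = (P !) ^ 2 * A ^ 3 * 32 ^ 2
    instance
      X≢0 : NonZero X
      X≢0 = ℕ.>-nonZero (ℕₚ.<⇒≤ 2≤X)
    N = X * X
    T = triangle N
    2≤N : 2 ≤ N
    2≤N = ℕₚ.≤-trans 2≤X (ℕₚ.m≤m*n X X)
    ^-distribʳ-* : ∀ n a b → (a * b) ^ n ≡ a ^ n * b ^ n
    ^-distribʳ-* zero    a b = refl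
    ^-distribʳ-* (suc n) a b = trans (cong (a * b *_) (^-distribʳ-* n a b)) (solve 4 (λ a b x y → a :* b :* (x :* y) := a :* x :* (b :* y)) refl a b (a ^ n) (b ^ n))
    swap : ∀ a k → (a ^ T) ^ k ≡ (a ^ k) ^ T
    swap a k = trans (ℕₚ.^-*-assoc a T k) (trans (cong (a ^_) (ℕₚ.*-comm T k)) (sym (ℕₚ.^-*-assoc a k T)))
    nonzero : NonZero ((P !) ^ (2 * T) * z ^ 3)
    nonzero = ℕₚ.m*n≢0 ((P !) ^ (2 * T)) (z ^ 3) {{ℕₚ.m^n≢0 (P !) (2 * T) {{P !≢0}}}} {{ℕₚ.m^n≢0 z 3 {{ℕ.>-nonZero 1≤z}}}}
    1≤T : 1 ≤ T
    1≤T = ℕₚ.*-cancelˡ-≤ 2 (ℕₚ.≤-trans 2≤N (n≤2triangle N 2≤N))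
    BX³<X⁴ : (B * X ^ 3) ^ T < (X ^ 4) ^ T
    BX³<X⁴ = ℕₚ.^-monoˡ-< T {{ℕ.>-nonZero 1≤T}} (ℕₚ.*-monoˡ-< (X ^ 3) {{ℕₚ.m^n≢0 X 3}} B<X)

-- Irreducibility and inverses up to an integer

module Bezout where
  open import Data.Rational as ℚ using (ℚ; 0ℚ; 1ℚ)
  import Data.Rational.Properties as ℚₚ
  open import Data.Rational.Unnormalised as ℚᵘ using (mkℚᵘ; *≡*)
  import Data.Rational.Unnormalised.Properties as ℚᵘₚ
  open ℤ-Solver.+-*-Solver using (solve; _:+_; _:*_; :-_; _:-_; _:=_; con)

  coeffℤ : List ℤ → ℕ → ℤ
  coeffℤ []      _       = + 0
  coeffℤ (a ∷ p) zero    = a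
  coeffℤ (a ∷ p) (suc i) = coeffℤ p i

  mulℤ : List ℤ → (ℕ → ℤ) → ℕ → ℤ
  mulℤ []      v i       = + 0
  mulℤ (a ∷ p) v zero    = a ℤ.* v 0
  mulℤ (a ∷ p) v (suc i) = a ℤ.* v (suc i) ℤ.+ mulℤ p v i

  mulℤ-scale : ∀ c p v i → mulℤ (List.map (c ℤ.*_) p) v i ≡ c ℤ.* mulℤ p v i
  mulℤ-scale c []      v i       = sym (ℤₚ.*-zeroʳ c)
  mulℤ-scale c (a ∷ p) v zero    = ℤₚ.*-assoc c a (v 0)
  mulℤ-scale c (a ∷ p) v (suc i) = trans (cong (λ x → c ℤ.* a ℤ.* v (suc i) ℤ.+ x) (mulℤ-scale c p v i))
    (solve 4 (λ c a x y → c :* a :* x :+ c :* y := c :* (a :* x :+ y)) refl c a (v (suc i)) (mulℤ p v i))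

  VanishesFrom : ℕ → (ℕ → ℤ) → Set
  VanishesFrom n v = ∀ i → n ≤ i → v i ≡ + 0

  coeffℤ-vanishes : ∀ p → VanishesFrom (List.length p) (coeffℤ p)
  coeffℤ-vanishes []      i       _       = refl
  coeffℤ-vanishes (a ∷ p) (suc i) (s≤s l) = coeffℤ-vanishes p i l

  -- Scaling by the coefficient `v n` at each step replaces division by it, so everything stays
  -- integral; the accumulated power has one factor for each coefficient of `f`.
  pseudoDivision : ∀ v n → VanishesFrom (suc n) v → ∀ f →
    ∃ λ Q → ∃ λ r → VanishesFrom n r × (∀ i → v n ℤ.^ List.length f ℤ.* coeffℤ f i ≡ mulℤ Q v i ℤ.+ r i)
  pseudoDivision v n v≡0 []      = [] , (λ _ → + 0) , (λ _ _ → refl) , λ _ → refl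
  pseudoDivision v n v≡0 (a ∷ f) with pseudoDivision v n v≡0 f
  ... | Q , r , r≡0 , eq = t ∷ List.map (c ℤ.*_) Q , r′ , r′≡0 , eq′
    where
    c = v n
    -- The previous remainder is shifted by one degree and receives the scaled new coefficient `a`.
    -- Subtracting `t` times `v` from `c` times the result cancels degree `n`.
    s : ℕ → ℤ
    s zero    = c ℤ.^ List.length f ℤ.* a
    s (suc i) = r i
    t = s n
    r′ : ℕ → ℤ
    r′ i = c ℤ.* s i ℤ.- t ℤ.* v i
    r′≡0 : VanishesFrom n r′
    r′≡0 i n≤i with i ℕ.≟ n
    ... | yes refl = trans (cong (λ x → c ℤ.* t ℤ.- x) (ℤₚ.*-comm t c)) (ℤₚ.+-inverseʳ (c ℤ.* t))
    r′≡0 zero    n≤i | no i≢n = contradiction (sym (ℕₚ.n≤0⇒n≡0 n≤i)) i≢n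
    r′≡0 (suc i) n≤i | no i≢n = trans (cong₂ (λ x y → c ℤ.* x ℤ.- t ℤ.* y) (r≡0 i (ℕ.s≤s⁻¹ n<i)) (v≡0 (suc i) n<i))
        (solve 2 (λ c t → c :* con (+ 0) :- t :* con (+ 0) := con (+ 0)) refl c t)
      where n<i = ℕₚ.≤∧≢⇒< n≤i (i≢n ∘ sym)
    eq′ : ∀ i → c ℤ.^ suc (List.length f) ℤ.* coeffℤ (a ∷ f) i ≡ mulℤ (t ∷ List.map (c ℤ.*_) Q) v i ℤ.+ r′ i
    eq′ zero    = solve 5 (λ c x a t v → c :* x :* a := t :* v :+ (c :* (x :* a) :- t :* v)) refl c (c ℤ.^ List.length f) a t (v 0)
    eq′ (suc i) = begin
      c ℤ.* X ℤ.* coeffℤ f i                                                ≡⟨ ℤₚ.*-assoc c X (coeffℤ f i) ⟩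
      c ℤ.* (X ℤ.* coeffℤ f i)                                              ≡⟨ cong (c ℤ.*_) (eq i) ⟩
      c ℤ.* (mulℤ Q v i ℤ.+ r i)                                            ≡⟨ solve 5 (λ c m r t w → c :* (m :+ r) := (t :* w :+ c :* m) :+ (c :* r :- t :* w)) refl c (mulℤ Q v i) (r i) t (v (suc i)) ⟩
      (t ℤ.* v (suc i) ℤ.+ c ℤ.* mulℤ Q v i) ℤ.+ (c ℤ.* r i ℤ.- t ℤ.* v (suc i)) ≡⟨ cong (λ x → (t ℤ.* v (suc i) ℤ.+ x) ℤ.+ (c ℤ.* r i ℤ.- t ℤ.* v (suc i))) (sym (mulℤ-scale c Q v i)) ⟩
      (t ℤ.* v (suc i) ℤ.+ mulℤ (List.map (c ℤ.*_) Q) v i) ℤ.+ (c ℤ.* r i ℤ.- t ℤ.* v (suc i)) ∎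
      where
      open ≡-Reasoning
      X = c ℤ.^ List.length f

  search : ∀ p → (∃ λ i → coeffℤ p i ≢ + 0) ⊎ (∀ i → coeffℤ p i ≡ + 0)
  search []      = inj₂ (λ _ → refl)
  search (a ∷ p) with a ℤ.≟ + 0 | search p
  ... | no a≢0  | _              = inj₁ (0 , a≢0)
  ... | yes _   | inj₁ (i , ≢0)  = inj₁ (suc i , ≢0)
  ... | yes a≡0 | inj₂ ≡0        = inj₂ λ { zero → a≡0 ; (suc i) → ≡0 i }

  searchBelow : ∀ n (v : ℕ → ℤ) → (∃ λ i → i < n × v i ≢ + 0) ⊎ (∀ i → i < n → v i ≡ + 0)
  searchBelow zero    v = inj₂ (λ _ ())
  searchBelow (suc n) v with v n ℤ.≟ + 0 | searchBelow n v
  ... | no v≢0  | _                   = inj₁ (n , ℕₚ.≤-refl , v≢0)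
  ... | yes _   | inj₁ (i , i<n , ≢0) = inj₁ (i , ℕₚ.m<n⇒m<1+n i<n , ≢0)
  ... | yes v≡0 | inj₂ ≡0             = inj₂ λ i i<1+n → [ ≡0 i , (λ { refl → v≡0 }) ]′ (ℕₚ.m≤n⇒m<n∨m≡n (ℕ.s≤s⁻¹ i<1+n))

  private
    mulℤ-0 : ∀ p v → (∀ i → coeffℤ p i ≡ + 0) → ∀ i → mulℤ p v i ≡ + 0
    mulℤ-0 []      v ≡0 i       = refl
    mulℤ-0 (a ∷ p) v ≡0 zero    = trans (cong (ℤ._* v 0) (≡0 0)) (ℤₚ.*-zeroˡ (v 0))
    mulℤ-0 (a ∷ p) v ≡0 (suc i) = trans (cong₂ (λ x y → x ℤ.* v (suc i) ℤ.+ y) (≡0 0) (mulℤ-0 p v (≡0 ∘ suc) i)) (cong (ℤ._+ + 0) (ℤₚ.*-zeroˡ (v (suc i))))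

    toℚ : ℤ → ℚ
    toℚ z = z ℚ./ 1

    toℚ-unnormalised : ∀ z → ℚ.toℚᵘ (toℚ z) ℚᵘ.≃ mkℚᵘ z 0
    toℚ-unnormalised z = ℚₚ.toℚᵘ-fromℚᵘ (mkℚᵘ z 0)

    toℚ-+ : ∀ a b → toℚ (a ℤ.+ b) ≡ toℚ a ℚ.+ toℚ b
    toℚ-+ a b = ℚₚ.toℚᵘ-injective (ℚᵘₚ.≃-trans (toℚ-unnormalised (a ℤ.+ b)) (ℚᵘₚ.≃-trans
      (*≡* (solve 2 (λ a b → (a :+ b) :* (con (+ 1) :* con (+ 1)) := (a :* con (+ 1) :+ b :* con (+ 1)) :* con (+ 1)) refl a b))
      (ℚᵘₚ.≃-sym (ℚᵘₚ.≃-trans (ℚₚ.toℚᵘ-homo-+ (toℚ a) (toℚ b)) (ℚᵘₚ.+-cong (toℚ-unnormalised a) (toℚ-unnormalised b))))))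

    toℚ-* : ∀ a b → toℚ (a ℤ.* b) ≡ toℚ a ℚ.* toℚ b
    toℚ-* a b = ℚₚ.toℚᵘ-injective (ℚᵘₚ.≃-trans (toℚ-unnormalised (a ℤ.* b)) (ℚᵘₚ.≃-trans
      (*≡* (solve 2 (λ a b → (a :* b) :* (con (+ 1) :* con (+ 1)) := (a :* b) :* con (+ 1)) refl a b))
      (ℚᵘₚ.≃-sym (ℚᵘₚ.≃-trans (ℚₚ.toℚᵘ-homo-* (toℚ a) (toℚ b)) (ℚᵘₚ.*-cong (toℚ-unnormalised a) (toℚ-unnormalised b))))))

    toℚ≡0 : ∀ z → toℚ z ≡ 0ℚ → z ≡ + 0
    toℚ≡0 z eq with ℚᵘₚ.≃-trans (ℚᵘₚ.≃-sym (toℚ-unnormalised z)) (ℚᵘₚ.≃-reflexive (cong ℚ.toℚᵘ eq))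
    ... | *≡* e = trans (sym (ℤₚ.*-identityʳ z)) e

    Σℚ-front : ∀ n (f : ℕ → ℚ) → Σ<ℚ (suc n) f ≡ f 0 ℚ.+ Σ<ℚ n (f ∘ suc)
    Σℚ-front zero    f = trans (ℚₚ.+-identityˡ (f 0)) (sym (ℚₚ.+-identityʳ (f 0)))
    Σℚ-front (suc n) f = trans (cong (ℚ._+ f (suc n)) (Σℚ-front n f)) (ℚₚ.+-assoc (f 0) _ _)

    mulCoeff-suc : ∀ a p q m → mulCoeff (a ∷ p) q (suc m) ≡ a ℚ.* coeff q (suc m) ℚ.+ mulCoeff p q m
    mulCoeff-suc a p q m = Σℚ-front (suc m) _

    coeff-map : ∀ (φ : ℤ → ℚ) → φ (+ 0) ≡ 0ℚ → ∀ p i → coeff (List.map φ p) i ≡ φ (coeffℤ p i)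
    coeff-map φ φ0 []      i       = sym φ0
    coeff-map φ φ0 (a ∷ p) zero    = refl
    coeff-map φ φ0 (a ∷ p) (suc i) = coeff-map φ φ0 p i

    coeff-applyUpTo : ∀ n (v : ℕ → ℤ) → VanishesFrom n v → ∀ i → coeff (List.applyUpTo (toℚ ∘ v) n) i ≡ toℚ (v i)
    coeff-applyUpTo zero    v v≡0 i       = sym (cong toℚ (v≡0 i z≤n))
    coeff-applyUpTo (suc n) v v≡0 zero    = refl
    coeff-applyUpTo (suc n) v v≡0 (suc i) = coeff-applyUpTo n (v ∘ suc) (λ j n≤j → v≡0 (suc j) (s≤s n≤j)) i

    mulCoeff-mulℤ : ∀ y Q q (v : ℕ → ℤ) → (∀ i → coeff q i ≡ toℚ (v i)) → ∀ m →
      mulCoeff (List.map (λ z → y ℚ.* toℚ z) Q) q m ≡ y ℚ.* toℚ (mulℤ Q v m)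
    mulCoeff-mulℤ y [] q v q≡ m = trans (zeros (suc m)) (sym (ℚₚ.*-zeroʳ y))
      where
      zeros : ∀ n → Σ<ℚ n (λ i → 0ℚ ℚ.* coeff q (m ∸ i)) ≡ 0ℚ
      zeros zero    = refl
      zeros (suc n) = trans (cong₂ ℚ._+_ (zeros n) (ℚₚ.*-zeroˡ (coeff q (m ∸ n)))) (ℚₚ.+-identityʳ 0ℚ)
    mulCoeff-mulℤ y (a ∷ Q) q v q≡ zero = trans (ℚₚ.+-identityˡ _) (trans (cong (y ℚ.* toℚ a ℚ.*_) (q≡ 0))
      (trans (ℚₚ.*-assoc y (toℚ a) (toℚ (v 0))) (cong (y ℚ.*_) (sym (toℚ-* a (v 0))))))
    mulCoeff-mulℤ y (a ∷ Q) q v q≡ (suc m) = begin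
      mulCoeff (y ℚ.* toℚ a ∷ List.map (λ z → y ℚ.* toℚ z) Q) q (suc m)
        ≡⟨ mulCoeff-suc (y ℚ.* toℚ a) (List.map (λ z → y ℚ.* toℚ z) Q) q m ⟩
      y ℚ.* toℚ a ℚ.* coeff q (suc m) ℚ.+ mulCoeff (List.map (λ z → y ℚ.* toℚ z) Q) q m
        ≡⟨ cong₂ ℚ._+_ (trans (cong (y ℚ.* toℚ a ℚ.*_) (q≡ (suc m))) (trans (ℚₚ.*-assoc y (toℚ a) (toℚ (v (suc m)))) (cong (y ℚ.*_) (sym (toℚ-* a (v (suc m)))))))
                       (mulCoeff-mulℤ y Q q v q≡ m) ⟩
      y ℚ.* toℚ (a ℤ.* v (suc m)) ℚ.+ y ℚ.* toℚ (mulℤ Q v m)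
        ≡⟨ sym (ℚₚ.*-distribˡ-+ y (toℚ (a ℤ.* v (suc m))) (toℚ (mulℤ Q v m))) ⟩
      y ℚ.* (toℚ (a ℤ.* v (suc m)) ℚ.+ toℚ (mulℤ Q v m))
        ≡⟨ cong (y ℚ.*_) (sym (toℚ-+ (a ℤ.* v (suc m)) (mulℤ Q v m))) ⟩
      y ℚ.* toℚ (a ℤ.* v (suc m) ℤ.+ mulℤ Q v m) ∎
      where open ≡-Reasoning

  -- If `Q` were constant, the product would have degree at most `n < D`, against the nonzero
  -- coefficient of `f` at `D`. So both factors are nonconstant, and dividing by `c` over ℚ
  -- contradicts irreducibility.
  no-proper-factor : ∀ {f} → Irreducibleℚ (toℚPoly f) → ∀ {D} → coeffℤ f D ≢ + 0 →
    ∀ c → c ≢ + 0 → ∀ Q v n → VanishesFrom (suc n) v → n < D → ∀ j → 1 ≤ j → v j ≢ + 0 →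
    ¬ (∀ i → c ℤ.* coeffℤ f i ≡ mulℤ Q v i)
  no-proper-factor {f} (_ , irr) {D} f_D≢0 c c≢0 Q v n v≡0 n<D j 1≤j vj≢0 eq with tail Q eq
    where
    tail : ∀ Q → (∀ i → c ℤ.* coeffℤ f i ≡ mulℤ Q v i) → ∃ λ i → 1 ≤ i × coeffℤ Q i ≢ + 0
    nonzero : c ℤ.* coeffℤ f D ≢ + 0
    nonzero e = [ c≢0 , f_D≢0 ]′ (ℤₚ.i*j≡0⇒i≡0∨j≡0 c e)
    tail []      eq = contradiction (eq D) nonzero
    tail (a ∷ Q) eq with search Q
    ... | inj₁ (i , ≢0) = suc i , s≤s z≤n , ≢0
    ... | inj₂ ≡0 = contradiction (trans (eq D) (top D n<D)) nonzero
      where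
      top : ∀ D → n < D → mulℤ (a ∷ Q) v D ≡ + 0
      top (suc D) n<D = trans (cong₂ (λ x y → a ℤ.* x ℤ.+ y) (v≡0 (suc D) n<D) (mulℤ-0 Q v ≡0 D)) (cong (ℤ._+ + 0) (ℤₚ.*-zeroʳ a))
  ... | i , 1≤i , Qi≢0 = irr (p , q , (i , 1≤i , pi≢0) , (j , 1≤j , qj≢0) , product)
    where
    C = toℚ c
    instance
      C≢0 : ℚ.NonZero C
      C≢0 = ℚ.≢-nonZero (c≢0 ∘ toℚ≡0 c)
    y = ℚ.1/ C
    p = List.map (λ z → y ℚ.* toℚ z) Q
    q = List.applyUpTo (toℚ ∘ v) (suc n)
    q≡ = coeff-applyUpTo (suc n) v v≡0
    cancel : ∀ z → C ℚ.* (y ℚ.* z) ≡ z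
    cancel z = trans (sym (ℚₚ.*-assoc C y z)) (trans (cong (ℚ._* z) (ℚₚ.*-inverseʳ C)) (ℚₚ.*-identityˡ z))
    pi≢0 : coeff p i ≢ 0ℚ
    pi≢0 e = Qi≢0 (toℚ≡0 _ (trans (sym (cancel (toℚ (coeffℤ Q i))))
      (trans (cong (C ℚ.*_) (trans (sym (coeff-map (λ z → y ℚ.* toℚ z) (ℚₚ.*-zeroʳ y) Q i)) e)) (ℚₚ.*-zeroʳ C))))
    qj≢0 : coeff q j ≢ 0ℚ
    qj≢0 e = vj≢0 (toℚ≡0 _ (trans (sym (q≡ j)) e))
    product : ∀ m → mulCoeff p q m ≡ coeff (toℚPoly f) m
    product m = begin
      mulCoeff p q m                         ≡⟨ mulCoeff-mulℤ y Q q v q≡ m ⟩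
      y ℚ.* toℚ (mulℤ Q v m)                 ≡⟨ cong (λ x → y ℚ.* toℚ x) (sym (eq m)) ⟩
      y ℚ.* toℚ (c ℤ.* coeffℤ f m)           ≡⟨ cong (y ℚ.*_) (toℚ-* c (coeffℤ f m)) ⟩
      y ℚ.* (C ℚ.* toℚ (coeffℤ f m))         ≡⟨ sym (ℚₚ.*-assoc y C (toℚ (coeffℤ f m))) ⟩
      y ℚ.* C ℚ.* toℚ (coeffℤ f m)           ≡⟨ cong (ℚ._* toℚ (coeffℤ f m)) (ℚₚ.*-inverseˡ C) ⟩
      1ℚ ℚ.* toℚ (coeffℤ f m)                ≡⟨ ℚₚ.*-identityˡ _ ⟩
      toℚ (coeffℤ f m)                       ≡⟨ sym (coeff-map toℚ refl f m) ⟩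
      coeff (toℚPoly f) m                    ∎
      where open ≡-Reasoning

  module Evaluation {c ℓ : Level} (R : CommutativeRing c ℓ) (α : CommutativeRing.Carrier R) where
    open CommutativeRing R renaming (refl to ≈-refl; sym to ≈-sym; trans to ≈-trans; zero to *-zero; reflexive to ≈-reflexive)
    open RingTools.IntegerAction R
    private module S = ≈-Solver
    open import Relation.Binary.Reasoning.Setoid setoid

    evalList : List ℤ → Carrier
    evalList []      = 0#
    evalList (a ∷ p) = ι a + α * evalList p

    -- eval v n = Σ_{i < n} v i * α ^ i
    eval : (ℕ → ℤ) → ℕ → Carrier
    eval v zero    = 0#
    eval v (suc n) = ι (v 0) + α * eval (v ∘ suc) n

    eval-cong : ∀ n {v w} → (∀ i → v i ≡ w i) → eval v n ≈ eval w n
    eval-cong zero    eq = ≈-refl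
    eval-cong (suc n) eq = +-cong (ι-cong (eq 0)) (*-congˡ (eval-cong n (eq ∘ suc)))

    eval-linear : ∀ n a v w → eval (λ i → a ℤ.* v i ℤ.+ w i) n ≈ ι a * eval v n + eval w n
    eval-linear zero    a v w = S.solve 1 (λ a → S.con (+ 0) S.:= a S.:* S.con (+ 0) S.:+ S.con (+ 0)) ≈-refl (ι a)
    eval-linear (suc n) a v w = ≈-trans (+-cong (≈-trans (ι-+ (a ℤ.* v 0) (w 0)) (+-congʳ (ι-* a (v 0)))) (*-congˡ (eval-linear n a (v ∘ suc) (w ∘ suc))))
      (S.solve 6 (λ a x y t u z → (a S.:* x S.:+ y) S.:+ t S.:* (a S.:* u S.:+ z) S.:= a S.:* (x S.:+ t S.:* u) S.:+ (y S.:+ t S.:* z)) ≈-refl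
        (ι a) (ι (v 0)) (ι (w 0)) α (eval (v ∘ suc) n) (eval (w ∘ suc) n))

    eval-0 : ∀ n v → (∀ i → v i ≡ + 0) → eval v n ≈ 0#
    eval-0 zero    v v≡0 = ≈-refl
    eval-0 (suc n) v v≡0 = ≈-trans (+-cong (ι-cong (v≡0 0)) (≈-trans (*-congˡ (eval-0 n (v ∘ suc) (v≡0 ∘ suc))) (zeroʳ α))) (+-identityʳ 0#)

    eval-truncate : ∀ {n m} v → n ≤ m → VanishesFrom n v → eval v m ≈ eval v n
    eval-truncate {m = m} v z≤n       v≡0 = eval-0 m v (λ i → v≡0 i z≤n)
    eval-truncate         v (s≤s n≤m) v≡0 = +-congˡ (*-congˡ (eval-truncate (v ∘ suc) n≤m (λ i n≤i → v≡0 (suc i) (s≤s n≤i))))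

    eval-coeffℤ : ∀ p n → List.length p ≤ n → eval (coeffℤ p) n ≈ evalList p
    eval-coeffℤ []      n       _         = eval-0 n (λ _ → + 0) (λ _ → refl)
    eval-coeffℤ (a ∷ p) (suc n) (s≤s len) = +-congˡ (*-congˡ (eval-coeffℤ p n len))

    eval-mulℤ : ∀ Q {n} v → VanishesFrom n v → ∀ m → List.length Q ℕ.+ n ≤ m → eval (mulℤ Q v) m ≈ evalList Q * eval v n
    eval-mulℤ []      {n} v v≡0 m _ = ≈-trans (eval-0 m (λ _ → + 0) (λ _ → refl)) (≈-sym (zeroˡ _))
    eval-mulℤ (a ∷ Q) {n} v v≡0 (suc m) (s≤s len) = begin
      ι (a ℤ.* v 0) + α * eval (λ i → a ℤ.* v (suc i) ℤ.+ mulℤ Q v i) m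
        ≈⟨ +-cong (ι-* a (v 0)) (*-congˡ (eval-linear m a (v ∘ suc) (mulℤ Q v))) ⟩
      ι a * ι (v 0) + α * (ι a * eval (v ∘ suc) m + eval (mulℤ Q v) m)
        ≈⟨ S.solve 5 (λ a x t u z → a S.:* x S.:+ t S.:* (a S.:* u S.:+ z) S.:= a S.:* (x S.:+ t S.:* u) S.:+ t S.:* z) ≈-refl (ι a) (ι (v 0)) α _ _ ⟩
      ι a * eval v (suc m) + α * eval (mulℤ Q v) m
        ≈⟨ +-cong (*-congˡ (eval-truncate v (ℕₚ.≤-trans (ℕₚ.m≤n+m n (List.length Q)) (ℕₚ.m≤n⇒m≤1+n len)) v≡0)) (*-congˡ (eval-mulℤ Q v v≡0 m len)) ⟩
      ι a * eval v n + α * (evalList Q * eval v n)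
        ≈⟨ S.solve 4 (λ a x t u → a S.:* x S.:+ t S.:* (u S.:* x) S.:= (a S.:+ t S.:* u) S.:* x) ≈-refl (ι a) (eval v n) α (evalList Q) ⟩
      (ι a + α * evalList Q) * eval v n ∎

    UnitUpToℤ : ℕ → (ℕ → ℤ) → Set ℓ
    UnitUpToℤ n v = ∃ λ w → ∃ λ m → m ≢ + 0 × evalList w * eval v n ≈ ι m

    module _ {f : List ℤ} (irr : Irreducibleℚ (toℚPoly f)) {D : ℕ} (fD : coeffℤ f D ≢ + 0) (f≈0 : evalList f ≈ 0#) where
      private
        -- If c f = Q v + r and f(α) = 0, then Q(α) v(α) = - r(α). So if w r takes a nonzero integer
        -- value at α, then - w Q does the same for v. Each stage divides `f` itself, now by the new
        -- remainder.
        reduce : ∀ n → n < D → ∀ v → VanishesFrom (suc n) v → v n ≢ + 0 →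
          (∀ r → VanishesFrom n r → (∃ λ i → r i ≢ + 0) → UnitUpToℤ n r) → UnitUpToℤ (suc n) v
        reduce zero n<D v v≡0 v₀≢0 rec = + 1 ∷ [] , v 0 , v₀≢0 ,
          S.solve 2 (λ x a → (S.con (+ 1) S.:+ a S.:* S.con (+ 0)) S.:* (x S.:+ a S.:* S.con (+ 0)) S.:= x) ≈-refl (ι (v 0)) α
        reduce n@(suc _) n<D v v≡0 vn≢0 rec with pseudoDivision v n v≡0 f
        ... | Q , r , r≡0 , division with searchBelow n r
        ...   | inj₂ r≡0′ = contradiction (λ j → trans (division j) (trans (cong (λ x → mulℤ Q v j ℤ.+ x) (all-zero j)) (ℤₚ.+-identityʳ _)))
                              (no-proper-factor {f} irr {D} fD (v n ℤ.^ List.length f) (λ e → vn≢0 (ℤₚ.i^n≡0⇒i≡0 (v n) (List.length f) e)) Q v n v≡0 n<D n (s≤s z≤n) vn≢0)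
          where
          all-zero : ∀ j → r j ≡ + 0
          all-zero j = [ r≡0′ j , r≡0 j ]′ (ℕₚ.<-≤-connex j n)
        ...   | inj₁ (j , _ , rj≢0) with rec r r≡0 (j , rj≢0)
        ...     | w , m , m≢0 , eq = List.map ℤ.-_ w′ , m , m≢0 , (begin
            evalList (List.map ℤ.-_ w′) * eval v (suc n)
              ≈⟨ *-congʳ (neg-eval w′) ⟩
            (- evalList w′) * eval v (suc n)
              ≈⟨ *-congʳ (-‿cong w′≈) ⟩
            (- (evalList w * evalList Q)) * eval v (suc n)
              ≈⟨ S.solve 4 (λ w q v r → (S.:- (w S.:* q)) S.:* v S.:= w S.:* r S.:- w S.:* (q S.:* v S.:+ r)) ≈-refl (evalList w) (evalList Q) (eval v (suc n)) (eval r n) ⟩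
            evalList w * eval r n - evalList w * (evalList Q * eval v (suc n) + eval r n)
              ≈⟨ +-cong eq (-‿cong (*-congˡ (≈-sym relation))) ⟩
            ι m - evalList w * 0#
              ≈⟨ S.solve 2 (λ m w → m S.:- w S.:* S.con (+ 0) S.:= m) ≈-refl (ι m) (evalList w) ⟩
            ι m ∎)
          where
          M = List.length f ℕ.+ (List.length Q ℕ.+ suc n)
          C = v n ℤ.^ List.length f
          relation : 0# ≈ evalList Q * eval v (suc n) + eval r n
          relation = begin
            0#                                                  ≈⟨ S.solve 1 (λ c → S.con (+ 0) S.:= c S.:* S.con (+ 0) S.:+ S.con (+ 0)) ≈-refl (ι C) ⟩
            ι C * 0# + 0#                                       ≈⟨ +-cong (*-congˡ (≈-sym f≈0)) (≈-sym (eval-0 M (λ _ → + 0) (λ _ → refl))) ⟩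
            ι C * evalList f + eval (λ _ → + 0) M               ≈⟨ +-congʳ (*-congˡ (≈-sym (eval-coeffℤ f M (ℕₚ.m≤m+n _ _)))) ⟩
            ι C * eval (coeffℤ f) M + eval (λ _ → + 0) M        ≈⟨ ≈-sym (eval-linear M C (coeffℤ f) (λ _ → + 0)) ⟩
            eval (λ j → C ℤ.* coeffℤ f j ℤ.+ + 0) M             ≈⟨ eval-cong M (λ j → trans (ℤₚ.+-identityʳ _) (trans (division j) (cong (ℤ._+ r j) (sym (ℤₚ.*-identityˡ (mulℤ Q v j)))))) ⟩
            eval (λ j → + 1 ℤ.* mulℤ Q v j ℤ.+ r j) M           ≈⟨ eval-linear M (+ 1) (mulℤ Q v) r ⟩
            ι (+ 1) * eval (mulℤ Q v) M + eval r M              ≈⟨ +-cong (≈-trans (*-congʳ ι-1) (*-identityˡ _)) (eval-truncate r (ℕₚ.≤-trans (ℕₚ.n≤1+n n) (ℕₚ.≤-trans (ℕₚ.m≤n+m (suc n) (List.length Q)) (ℕₚ.m≤n+m _ (List.length f)))) r≡0) ⟩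
            eval (mulℤ Q v) M + eval r n                        ≈⟨ +-congʳ (eval-mulℤ Q v v≡0 M (ℕₚ.m≤n+m _ (List.length f))) ⟩
            evalList Q * eval v (suc n) + eval r n              ∎
          w′ = List.applyUpTo (mulℤ w (coeffℤ Q)) (List.length w ℕ.+ List.length Q)
          evalList-applyUpTo : ∀ g k → evalList (List.applyUpTo g k) ≈ eval g k
          evalList-applyUpTo g zero    = ≈-refl
          evalList-applyUpTo g (suc k) = +-congˡ (*-congˡ (evalList-applyUpTo (g ∘ suc) k))
          w′≈ : evalList w′ ≈ evalList w * evalList Q
          w′≈ = ≈-trans (evalList-applyUpTo _ (List.length w ℕ.+ List.length Q)) (≈-trans (eval-mulℤ w (coeffℤ Q) (coeffℤ-vanishes Q) _ ℕₚ.≤-refl) (*-congˡ (eval-coeffℤ Q (List.length Q) ℕₚ.≤-refl)))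
          neg-eval : ∀ p → evalList (List.map ℤ.-_ p) ≈ - evalList p
          neg-eval []      = S.solve 0 (S.con (+ 0) S.:= S.:- S.con (+ 0)) ≈-refl
          neg-eval (a ∷ p) = ≈-trans (+-cong (ι-neg a) (*-congˡ (neg-eval p))) (S.solve 3 (λ a t x → S.:- a S.:+ t S.:* (S.:- x) S.:= S.:- (a S.:+ t S.:* x)) ≈-refl (ι a) α (evalList p))

      -- Euclid's algorithm on f and v with pseudo-division; a vanishing remainder would exhibit a proper factor of f.
      bezout : ∀ n → n ≤ D → ∀ v → VanishesFrom n v → (∃ λ i → v i ≢ + 0) → UnitUpToℤ n v
      bezout zero    n≤D v v≡0 (i , vi≢0) = contradiction (v≡0 i z≤n) vi≢0
      bezout (suc n) n<D v v≡0 (i , vi≢0) with v n ℤ.≟ + 0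
      ... | no vn≢0  = reduce n n<D v v≡0 vn≢0 (bezout n (ℕₚ.<⇒≤ n<D))
      ... | yes vn≡0 = let w , m , m≢0 , eq = bezout n (ℕₚ.<⇒≤ n<D) v v≡0′ (i , vi≢0) in
          w , m , m≢0 , ≈-trans (*-congˡ (eval-truncate v (ℕₚ.n≤1+n n) v≡0′)) eq
        where
        v≡0′ : VanishesFrom n v
        v≡0′ j n≤j = [ v≡0 j , (λ { refl → vn≡0 }) ]′ (ℕₚ.m≤n⇒m<n∨m≡n n≤j)

-- Newton's identities and Euler's formula

module Newton where
  open DoldSums using (Dold-*ˡ; doldSum-cong)
  import Data.Integer.Divisibility as ℤD
  open LogDerivative
  open import Data.Nat.Induction using (<-rec)
  import Data.Fin as Fin
  import Data.Fin.Properties as Finₚ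

  module FieldLemmas {c ℓ : Level} (K : Field c ℓ) where
    open Field K renaming (refl to ≈-refl; sym to ≈-sym; trans to ≈-trans; zero to *-zero; reflexive to ≈-reflexive)
    open FieldOps K using (ΣFin; CharacteristicZero)
    open RingTools.IntegerAction commutativeRing public
    open ≈-Solver
    open import Relation.Binary.Reasoning.Setoid setoid

    ιℤ≈ι : ∀ a → FieldOps.ιℤ K a ≈ ι a
    ιℤ≈ι (+ n)    = ιℕ≈ n
      where
      ιℕ≈ : ∀ n → FieldOps.ιℕ K n ≈ ιℕ n
      ιℕ≈ zero    = ≈-refl
      ιℕ≈ (suc n) = +-congˡ (ιℕ≈ n)
    ιℤ≈ι -[1+ n ] = -‿cong (ιℤ≈ι (+ suc n))

    ι-nonzero : CharacteristicZero → ∀ {a} → a ≢ + 0 → ¬ ι a ≈ 0#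
    ι-nonzero char0 {+ zero}    a≢0 _  = a≢0 refl
    ι-nonzero char0 {+ suc n}   a≢0 eq = char0 n (≈-trans (ιℤ≈ι (+ suc n)) eq)
    ι-nonzero char0 { -[1+ n ]} a≢0 eq = char0 n (≈-trans (ιℤ≈ι (+ suc n))
      (≈-trans (solve 1 (λ x → x := :- (:- x)) ≈-refl (ιℕ (suc n))) (≈-trans (-‿cong eq) (solve 0 (:- con (+ 0) := con (+ 0)) ≈-refl))))

    ι-injective : CharacteristicZero → ∀ {a b} → ι a ≈ ι b → a ≡ b
    ι-injective char0 {a} {b} eq with a ℤ.- b ℤ.≟ + 0
    ... | yes a-b≡0 = ℤₚ.i-j≡0⇒i≡j a b a-b≡0
    ... | no a-b≢0  = contradiction (≈-trans (ι-+ a (ℤ.- b)) (≈-trans (+-cong eq (ι-neg b)) (-‿inverseʳ (ι b)))) (ι-nonzero char0 a-b≢0)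

    *-cancel-0 : ∀ {x y} → ¬ x ≈ 0# → x * y ≈ 0# → y ≈ 0#
    *-cancel-0 {x} {y} x≉0 xy≈0 with inverse x x≉0
    ... | x⁻¹ , xx⁻¹≈1 = begin
      y                ≈⟨ ≈-sym (*-identityˡ y) ⟩
      1# * y           ≈⟨ *-congʳ (≈-sym xx⁻¹≈1) ⟩
      (x * x⁻¹) * y    ≈⟨ solve 3 (λ x i y → (x :* i) :* y := i :* (x :* y)) ≈-refl x x⁻¹ y ⟩
      x⁻¹ * (x * y)    ≈⟨ *-congˡ xy≈0 ⟩
      x⁻¹ * 0#         ≈⟨ zeroʳ x⁻¹ ⟩
      0#               ∎

    Σ-cong : ∀ {n} {f g : Fin n → Carrier} → (∀ i → f i ≈ g i) → ΣFin f ≈ ΣFin g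
    Σ-cong {zero}  eq = ≈-refl
    Σ-cong {suc n} eq = +-cong (eq Fin.zero) (Σ-cong (eq ∘ Fin.suc))

    Σ-linear : ∀ {n} (f g : Fin n → Carrier) a → ΣFin (λ i → f i + a * g i) ≈ ΣFin f + a * ΣFin g
    Σ-linear {zero}  f g a = solve 1 (λ a → con (+ 0) := con (+ 0) :+ a :* con (+ 0)) ≈-refl a
    Σ-linear {suc n} f g a = ≈-trans (+-congˡ (Σ-linear (f ∘ Fin.suc) (g ∘ Fin.suc) a))
      (solve 5 (λ x y a u v → (x :+ a :* y) :+ (u :+ a :* v) := (x :+ u) :+ a :* (y :+ v)) ≈-refl (f Fin.zero) (g Fin.zero) a (ΣFin (f ∘ Fin.suc)) (ΣFin (g ∘ Fin.suc)))

    Σ-0 : ∀ {n} {f : Fin n → Carrier} → (∀ i → f i ≈ 0#) → ΣFin f ≈ 0#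
    Σ-0 {zero}  eq = ≈-refl
    Σ-0 {suc n} eq = ≈-trans (+-cong (eq Fin.zero) (Σ-0 (eq ∘ Fin.suc))) (+-identityʳ 0#)

    Σ-+ : ∀ {n} (f g : Fin n → Carrier) → ΣFin (λ i → f i + g i) ≈ ΣFin f + ΣFin g
    Σ-+ f g = ≈-trans (Σ-cong (λ i → +-congˡ (≈-sym (*-identityˡ (g i))))) (≈-trans (Σ-linear f g 1#) (+-congˡ (*-identityˡ _)))

    Σ-*ˡ : ∀ {n} a (f : Fin n → Carrier) → ΣFin (λ i → a * f i) ≈ a * ΣFin f
    Σ-*ˡ {n} a f = ≈-trans (Σ-cong {n} (λ i → ≈-sym (+-identityˡ _))) (≈-trans (Σ-linear (λ _ → 0#) f a) (≈-trans (+-congʳ (Σ-0 {n} (λ _ → ≈-refl))) (+-identityˡ _)))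

    Σ-1 : ∀ n → ΣFin {n} (λ _ → 1#) ≈ ι (+ n)
    Σ-1 zero    = ≈-refl
    Σ-1 (suc n) = +-congˡ (Σ-1 n)

    Σ-single : ∀ {n} (f : Fin n → Carrier) j → (∀ i → i ≢ j → f i ≈ 0#) → ΣFin f ≈ f j
    Σ-single f Fin.zero    eq = ≈-trans (+-congˡ (Σ-0 (λ i → eq (Fin.suc i) (λ ())))) (+-identityʳ _)
    Σ-single f (Fin.suc j) eq = ≈-trans (+-cong (eq Fin.zero (λ ())) (Σ-single (f ∘ Fin.suc) j (λ i i≢j → eq (Fin.suc i) (i≢j ∘ Finₚ.suc-injective)))) (+-identityˡ _)

    Σ-horner : ∀ {n} (f : Fin n → ℕ → Carrier) m y → horner (λ j → ΣFin (λ i → f i j)) m y ≈ ΣFin (λ i → horner (f i) m y)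
    Σ-horner {n} f zero    y = ≈-sym (Σ-0 {n} (λ i → ≈-refl))
    Σ-horner {n} f (suc m) y = ≈-trans (+-comm _ _) (≈-trans (+-congˡ (*-congˡ (Σ-horner f m y)))
      (≈-trans (≈-sym (Σ-linear (λ i → f i m) (λ i → horner (f i) m y) y)) (Σ-cong {n} (λ i → +-comm _ _))))

    Distinct : ∀ {n} → (Fin n → Carrier) → Set ℓ
    Distinct β = ∀ i j → β i ≈ β j → i ≡ j

    difference≉0 : ∀ {n} {β : Fin n → Carrier} → Distinct β → ∀ {i j} → i ≢ j → ¬ β i - β j ≈ 0#
    difference≉0 {β = β} distinct {i} {j} i≢j eq = i≢j (distinct i j (≈-trans (solve 2 (λ x y → x := (x :- y) :+ y) ≈-refl (β i) (β j)) (≈-trans (+-congʳ eq) (+-identityˡ _))))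

    -- One root `a` is split off by synthetic division; the quotient vanishes at the remaining
    -- points because differences of distinct points can be cancelled. Each coefficient is then
    -- recovered from two consecutive Horner values at `a`.
    horner-vanishing : ∀ m c (β : Fin m → Carrier) → Distinct β → (∀ i → horner c m (β i) ≈ 0#) → ∀ n → n < m → c n ≈ 0#
    horner-vanishing (suc m) c β distinct roots n (s≤s n≤m) = begin
      c n                                    ≈⟨ solve 2 (λ x y → x := (y :+ x) :- y) ≈-refl (c n) (a * horner c n a) ⟩
      c′ n - a * horner c n a                ≈⟨ +-cong (c′≈0 n n≤m) (-‿cong (≈-trans (*-congˡ (prefix n n≤m)) (zeroʳ a))) ⟩
      0# - 0#                                ≈⟨ -‿inverseʳ 0# ⟩
      0#                                     ∎
      where
      a = β Fin.zero
      c′ = λ n → horner c (suc n) a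
      c′<m : ∀ n → n < m → c′ n ≈ 0#
      c′<m = horner-vanishing m c′ (β ∘ Fin.suc) (λ i j eq → Finₚ.suc-injective (distinct (Fin.suc i) (Fin.suc j) eq)) (λ i →
        *-cancel-0 (difference≉0 {β = β} distinct {Fin.suc i} {Fin.zero} (λ ()))
          (≈-trans (≈-sym (horner-divided c m (β (Fin.suc i)) a)) (≈-trans (+-cong (roots (Fin.suc i)) (-‿cong (roots Fin.zero))) (-‿inverseʳ 0#))))
      c′≈0 : ∀ n → n ≤ m → c′ n ≈ 0#
      c′≈0 n n≤m = [ c′<m n , (λ { refl → roots Fin.zero }) ]′ (ℕₚ.m≤n⇒m<n∨m≡n n≤m)
      prefix : ∀ n → n ≤ m → horner c n a ≈ 0#
      prefix zero    _   = ≈-refl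
      prefix (suc n) n<m = c′<m n n<m

  -- The simple roots α i of the monic polynomial x ^ d + e 1 x ^ (d - 1) + ⋯ + e d.
  module SimpleRoots {c ℓ : Level} (K : Field c ℓ) (char0 : FieldOps.CharacteristicZero K) (d : ℕ)
    (e : ℕ → ℤ) (e₀ : e 0 ≡ + 1) (e-vanishes : ∀ n → d < n → e n ≡ + 0) (α : Fin d → Field.Carrier K)
    (roots : ∀ i → Field._≈_ K (FieldLemmas.horner K (λ n → FieldLemmas.ι K (e n)) (suc d) (α i)) (Field.0# K))
    (distinct : FieldLemmas.Distinct K α) where

    open Field K renaming (refl to ≈-refl; sym to ≈-sym; trans to ≈-trans; zero to *-zero; reflexive to ≈-reflexive)
    open FieldOps K using (ΣFin)
    open FieldLemmas K
    open ≈-Solver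
    open import Relation.Binary.Reasoning.Setoid setoid

    hornerℤ : (ℕ → ℤ) → ℕ → Carrier → Carrier
    hornerℤ a = horner (λ n → ι (a n))

    -- At a root a of the polynomial f these are the coefficients of f(x) / (x - a).
    E : ℕ → Carrier → Carrier
    E n = hornerℤ e (suc n)

    E-vanishes : ∀ n → d ≤ n → ∀ i → E n (α i) ≈ 0#
    E-vanishes n d≤n i = subst (λ n → E n (α i) ≈ 0#) (ℕₚ.m+[n∸m]≡n d≤n) (go (n ∸ d))
      where
      go : ∀ j → E (d ℕ.+ j) (α i) ≈ 0#
      go zero    = ≈-trans (≈-reflexive (cong (λ x → E x (α i)) (ℕₚ.+-identityʳ d))) (roots i)
      go (suc j) = ≈-trans (≈-reflexive (cong (λ x → E x (α i)) (ℕₚ.+-suc d j))) (≈-trans (+-cong (≈-trans (*-congˡ (go j)) (zeroʳ _))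
        (ι-cong (e-vanishes (suc (d ℕ.+ j)) (s≤s (ℕₚ.m≤m+n d j))))) (+-identityʳ 0#))

    -- the derivative of the polynomial
    different : Carrier → Carrier
    different a = horner (λ n → E n a) d a

    -- Euler's dual basis: f(x) / (x - α i) vanishes at the other roots and equals f′(α j) at x = α
    -- j when i = j.
    euler : ∀ (z : Fin d → Carrier) j → horner (λ n → ΣFin (λ i → z i * E n (α i))) d (α j) ≈ z j * different (α j)
    euler z j = begin
      horner (λ n → ΣFin (λ i → z i * E n (α i))) d (α j)    ≈⟨ Σ-horner (λ i n → z i * E n (α i)) d (α j) ⟩
      ΣFin (λ i → horner (λ n → z i * E n (α i)) d (α j))    ≈⟨ Σ-cong (λ i → horner-* (λ n → E n (α i)) (z i) d (α j)) ⟩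
      ΣFin (λ i → z i * horner (λ n → E n (α i)) d (α j))    ≈⟨ Σ-single _ j (λ i i≢j → ≈-trans (*-congˡ (off-diagonal i i≢j)) (zeroʳ _)) ⟩
      z j * different (α j)                                  ∎
      where
      off-diagonal : ∀ i → i ≢ j → horner (λ n → E n (α i)) d (α j) ≈ 0#
      off-diagonal i i≢j = *-cancel-0 (difference≉0 {β = α} distinct {j} {i} (i≢j ∘ sym))
        (≈-trans (≈-sym (horner-divided (λ n → ι (e n)) d (α j) (α i))) (≈-trans (+-cong (roots j) (-‿cong (roots i))) (-‿inverseʳ 0#)))

    derivative : ℕ → ℕ → ℤ
    derivative m n = + (m ∸ n) ℤ.* e n

    different≈ : ∀ a → different a ≈ hornerℤ (derivative d) d a
    different≈ a = go d
      where
      go : ∀ m → horner (λ n → E n a) m a ≈ hornerℤ (derivative m) m a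
      go zero    = ≈-refl
      go (suc m) = begin
        a * horner (λ n → E n a) m a + E m a                               ≈⟨ +-congʳ (*-congˡ (go m)) ⟩
        a * hornerℤ (derivative m) m a + E m a                             ≈⟨ +-congʳ (≈-sym (≈-trans (+-congˡ last) (+-identityʳ _))) ⟩
        hornerℤ (derivative m) (suc m) a + E m a                           ≈⟨ +-congˡ (≈-sym (*-identityˡ _)) ⟩
        hornerℤ (derivative m) (suc m) a + 1# * E m a                      ≈⟨ ≈-sym (horner-linear (λ n → ι (derivative m n)) (λ n → ι (e n)) 1# (suc m) a) ⟩
        horner (λ n → ι (derivative m n) + 1# * ι (e n)) (suc m) a         ≈⟨ horner-congˡ (suc m) (λ n n≤m → ≈-trans (+-congˡ (*-identityˡ _)) (≈-trans (≈-sym (ι-+ (derivative m n) (e n))) (ι-cong (step n (ℕ.s≤s⁻¹ n≤m))))) ⟩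
        hornerℤ (derivative (suc m)) (suc m) a                             ∎
        where
        last : ι (derivative m m) ≈ 0#
        last = ι-cong (trans (cong (λ x → + x ℤ.* e m) (ℕₚ.n∸n≡0 m)) (ℤₚ.*-zeroˡ (e m)))
        step : ∀ n → n ≤ m → derivative m n ℤ.+ e n ≡ derivative (suc m) n
        step n n≤m = trans (ℤₚ.+-comm (derivative m n) (e n)) (trans (sym (ℤₚ.suc-* (+ (m ∸ n)) (e n))) (cong (λ x → + x ℤ.* e n) (sym (ℕₚ.+-∸-assoc 1 n≤m))))

    -- The coefficientwise form of Σ f(x) / (x - α i) = f′(x). Both sides have degree below `d` and
    -- agree at the `d` distinct roots, by `euler` with all `z i` equal to 1.
    ΣE : ∀ n → ΣFin (λ i → E n (α i)) ≈ ι (derivative d n)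
    ΣE n with n ℕ.<? d
    ... | no n≮d = ≈-trans (Σ-0 (E-vanishes n (ℕₚ.≮⇒≥ n≮d))) (≈-sym (ι-cong (trans (cong (λ x → + x ℤ.* e n) (ℕₚ.m≤n⇒m∸n≡0 (ℕₚ.≮⇒≥ n≮d))) (ℤₚ.*-zeroˡ (e n)))))
    ... | yes n<d = begin
      ΣFin (λ i → E n (α i))                            ≈⟨ Σ-cong {d} (λ i → ≈-sym (*-identityˡ _)) ⟩
      t n                                               ≈⟨ solve 2 (λ x y → x := (x :+ con (ℤ.- + 1) :* y) :+ y) ≈-refl (t n) (ι (derivative d n)) ⟩
      (t n + ι (ℤ.- + 1) * ι (derivative d n)) + ι (derivative d n)
        ≈⟨ +-congʳ (horner-vanishing d (λ n → t n + ι (ℤ.- + 1) * ι (derivative d n)) α distinct same n n<d) ⟩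
      0# + ι (derivative d n)                           ≈⟨ +-identityˡ _ ⟩
      ι (derivative d n)                                ∎
      where
      t = λ n → ΣFin (λ i → 1# * E n (α i))
      same : ∀ j → horner (λ n → t n + ι (ℤ.- + 1) * ι (derivative d n)) d (α j) ≈ 0#
      same j = begin
        horner (λ n → t n + ι (ℤ.- + 1) * ι (derivative d n)) d (α j)                  ≈⟨ horner-linear t (λ n → ι (derivative d n)) (ι (ℤ.- + 1)) d (α j) ⟩
        horner t d (α j) + ι (ℤ.- + 1) * hornerℤ (derivative d) d (α j)                ≈⟨ +-cong (euler (λ _ → 1#) j) (*-congˡ (≈-sym (different≈ (α j)))) ⟩
        1# * different (α j) + ι (ℤ.- + 1) * different (α j)                           ≈⟨ +-congʳ (*-identityˡ _) ⟩
        different (α j) + ι (ℤ.- + 1) * different (α j)                                ≈⟨ solve 1 (λ x → x :+ con (ℤ.- + 1) :* x := con (+ 0)) ≈-refl (different (α j)) ⟩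
        0#                                                                             ∎

    Σ-hornerℤ : ∀ (z : Fin d → Carrier) (A : ℕ → ℤ) → (∀ n → ΣFin (λ i → z i * α i ^ n) ≈ ι (A n)) →
      ∀ (a : ℕ → ℤ) m → ΣFin (λ i → z i * hornerℤ a m (α i)) ≈ ι (conv A a m)
    Σ-hornerℤ z A eq a zero    = Σ-0 (λ i → zeroʳ (z i))
    Σ-hornerℤ z A eq a (suc m) = begin
      ΣFin (λ i → z i * hornerℤ a (suc m) (α i))
        ≈⟨ Σ-cong (λ i → ≈-trans (*-congˡ (horner-front (λ n → ι (a n)) m (α i))) (solve 4 (λ z c x h → z :* (c :* x :+ h) := z :* h :+ c :* (z :* x)) ≈-refl (z i) (ι (a 0)) (α i ^ m) (hornerℤ (a ∘ suc) m (α i)))) ⟩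
      ΣFin (λ i → z i * hornerℤ (a ∘ suc) m (α i) + ι (a 0) * (z i * α i ^ m))
        ≈⟨ Σ-linear (λ i → z i * hornerℤ (a ∘ suc) m (α i)) (λ i → z i * α i ^ m) (ι (a 0)) ⟩
      ΣFin (λ i → z i * hornerℤ (a ∘ suc) m (α i)) + ι (a 0) * ΣFin (λ i → z i * α i ^ m)
        ≈⟨ +-cong (Σ-hornerℤ z A eq (a ∘ suc) m) (*-congˡ (eq m)) ⟩
      ι (conv A (a ∘ suc) m) + ι (a 0) * ι (A m)
        ≈⟨ ≈-trans (+-comm _ _) (+-congʳ (≈-sym (ι-* (a 0) (A m)))) ⟩
      ι (a 0 ℤ.* A m) + ι (conv A (a ∘ suc) m)
        ≈⟨ ≈-sym (ι-+ (a 0 ℤ.* A m) _) ⟩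
      ι (conv A a (suc m)) ∎

    private
      S : ℕ → Carrier
      S n = ΣFin (λ i → α i ^ n)

      Σ-hornerℤ-integral : ∀ (a : ℕ → ℤ) m → (∀ {n} → n < m → ∃ λ s → S n ≈ ι s) → ∃ λ t → ΣFin (λ i → hornerℤ a m (α i)) ≈ ι t
      Σ-hornerℤ-integral a zero    int = + 0 , Σ-0 {d} (λ _ → ≈-refl)
      Σ-hornerℤ-integral a (suc m) int = let t , t≈ = Σ-hornerℤ-integral (a ∘ suc) m (λ n<m → int (ℕₚ.m<n⇒m<1+n n<m)); s , s≈ = int {m} ℕₚ.≤-refl in
        t ℤ.+ a 0 ℤ.* s , (begin
          ΣFin (λ i → hornerℤ a (suc m) (α i))                                       ≈⟨ Σ-cong (λ i → ≈-trans (horner-front (λ n → ι (a n)) m (α i)) (+-comm _ _)) ⟩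
          ΣFin (λ i → hornerℤ (a ∘ suc) m (α i) + ι (a 0) * α i ^ m)                 ≈⟨ Σ-linear _ (λ i → α i ^ m) (ι (a 0)) ⟩
          ΣFin (λ i → hornerℤ (a ∘ suc) m (α i)) + ι (a 0) * S m                     ≈⟨ +-cong t≈ (*-congˡ s≈) ⟩
          ι t + ι (a 0) * ι s                                                        ≈⟨ +-congˡ (≈-sym (ι-* (a 0) s)) ⟩
          ι t + ι (a 0 ℤ.* s)                                                        ≈⟨ ≈-sym (ι-+ t _) ⟩
          ι (t ℤ.+ a 0 ℤ.* s)                                                        ∎)

      abstract
        -- Since `e 0` is 1, Newton's identity can be solved for the newest power sum over the
        -- integers.
        S-integral : ∀ n → ∃ λ s → S n ≈ ι s
        S-integral = <-rec _ step
         where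
         step : ∀ n → (∀ {m} → m < n → ∃ λ s → S m ≈ ι s) → ∃ λ s → S n ≈ ι s
         step n rec = let t , t≈ = Σ-hornerℤ-integral (e ∘ suc) n rec in
           derivative d n ℤ.- t , (begin
             S n                                                        ≈⟨ solve 2 (λ x y → x := (y :+ x) :- y) ≈-refl (S n) _ ⟩
             (ΣFin (λ i → hornerℤ (e ∘ suc) n (α i)) + S n) - ΣFin (λ i → hornerℤ (e ∘ suc) n (α i))
               ≈⟨ +-congʳ (≈-sym (Σ-+ (λ i → hornerℤ (e ∘ suc) n (α i)) (λ i → α i ^ n))) ⟩
             ΣFin (λ i → hornerℤ (e ∘ suc) n (α i) + α i ^ n) - ΣFin (λ i → hornerℤ (e ∘ suc) n (α i))
               ≈⟨ +-cong (Σ-cong (λ i → ≈-trans (+-comm _ _) (≈-trans (+-congʳ (≈-sym (≈-trans (*-congʳ (≈-trans (ι-cong e₀) ι-1)) (*-identityˡ _)))) (≈-sym (horner-front (λ n → ι (e n)) n (α i)))))) (-‿cong t≈) ⟩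
             ΣFin (λ i → E n (α i)) - ι t                               ≈⟨ +-cong (ΣE n) (≈-sym (ι-neg t)) ⟩
             ι (derivative d n) + ι (ℤ.- t)                             ≈⟨ ≈-sym (ι-+ (derivative d n) (ℤ.- t)) ⟩
             ι (derivative d n ℤ.- t)                                   ∎)

    powerSum : ℕ → ℤ
    powerSum n = proj₁ (S-integral n)

    Σα^n : ∀ n → ΣFin (λ i → α i ^ n) ≈ ι (powerSum n)
    Σα^n n = proj₂ (S-integral n)

    newton : ∀ n → conv powerSum e (suc n) ≡ derivative d n
    newton n = ι-injective char0 (≈-trans (≈-sym (Σ-hornerℤ (λ _ → 1#) powerSum (λ m → ≈-trans (Σ-cong {d} (λ i → *-identityˡ _)) (Σα^n m)) e (suc n)))
      (≈-trans (Σ-cong {d} (λ i → *-identityˡ _)) (ΣE n)))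

    powerSum-0 : powerSum 0 ≡ + d
    powerSum-0 = ι-injective char0 (≈-trans (≈-sym (Σα^n 0)) (Σ-1 d))

    -- By Newton's identities - Σ_{n ≥ 1} powerSum n t ^ n is the logarithmic derivative of the reciprocal polynomial Σ e n t ^ n.
    powerSum-Dold : Dold powerSum
    powerSum-Dold n 1≤n = subst (+ n ℤD.∣_) Σ-≡ (Dold-*ˡ (ℤ.- + 1) (λ n → ℤ.- powerSum n) (LogDerivative⇒Dold {λ n → ℤ.- powerSum n} {e} e₀ logDerivative) n 1≤n)
      where
      Σ-≡ : doldSum (λ n → (ℤ.- + 1) ℤ.* (ℤ.- powerSum n)) n ≡ doldSum powerSum n
      Σ-≡ = doldSum-cong n (λ k _ _ → trans (ℤₚ.-1*i≡-i _) (ℤₚ.neg-involutive (powerSum k)))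
      open ℤ-Solver.+-*-Solver using () renaming (solve to solveℤ; _:+_ to _⊕_; _:*_ to _⊛_; :-_ to ⊝_; _:=_ to _≣_; _:-_ to _⊖_)
      logDerivative : LogDerivative (λ n → ℤ.- powerSum n) e
      logDerivative n = sym (trans (conv-negˡ (powerSum ∘ suc) e n) (trans (cong ℤ.-_ rest) (by-cases n)))
        where
        rest : conv (powerSum ∘ suc) e n ≡ derivative d n ℤ.- e n ℤ.* + d
        rest = trans (solveℤ 2 (λ x y → y ≣ (x ⊕ y) ⊖ x) refl (e n ℤ.* powerSum 0) (conv (powerSum ∘ suc) e n))
          (cong₂ ℤ._-_ (trans (sym (conv-suc powerSum e n)) (newton n)) (cong (e n ℤ.*_) powerSum-0))
        -- For `n ≤ d` this is d - (d - n) = n times `e n`. Beyond `d` truncated subtraction breaks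
        -- that identity, but `e n` is zero.
        by-cases : ∀ n → ℤ.- (derivative d n ℤ.- e n ℤ.* + d) ≡ + n ℤ.* e n
        by-cases n with n ℕ.≤? d
        ... | yes n≤d = trans (cong (λ x → ℤ.- (derivative d n ℤ.- e n ℤ.* x)) (trans (cong +_ (sym (ℕₚ.m∸n+n≡m n≤d))) (ℤₚ.pos-+ (d ∸ n) n)))
              (solveℤ 3 (λ x y z → ⊝ (x ⊛ y ⊖ y ⊛ (x ⊕ z)) ≣ z ⊛ y) refl (+ (d ∸ n)) (e n) (+ n))
        ... | no n≰d rewrite e-vanishes n (ℕₚ.≰⇒> n≰d) = trans (cong (λ x → ℤ.- (x ℤ.- + 0 ℤ.* + d)) (ℤₚ.*-zeroʳ (+ (d ∸ n)))) (sym (ℤₚ.*-zeroʳ (+ n)))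

-- Traces and Frobenius modulo a prime

module Traces where
  open LogDerivative using (conv; conv--ˡ; conv-∣)
  open Lattice using (MonicOrder; module Order)
  open Frobenius using (module Congruence)
  open import Data.Nat.Primality using (prime⇒nonZero)
  open import Data.Integer.DivMod using (_%ℕ_; _/ℕ_; a≡a%ℕn+[a/ℕn]*n; n%ℕd<d)
  import Data.Fin as Fin
  import Data.Fin.Properties as Finₚ

  module TraceForm {a ℓ a′ ℓ′ : Level} (𝓞 : MonicOrder a ℓ) (K : CommutativeRing a′ ℓ′)
    (T : CommutativeRing.Carrier (MonicOrder.R 𝓞) → CommutativeRing.Carrier K) where

    open Order 𝓞
    open CommutativeRing R renaming (refl to ≈-refl; sym to ≈-sym; trans to ≈-trans; zero to *-zero; reflexive to ≈-reflexive)
    open RingTools.IntegerAction R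
    open ≈-Solver
    private
      module K = CommutativeRing K
      module Kι = RingTools.IntegerAction K

    record IsTrace : Set (a ⊔ ℓ ⊔ a′ ⊔ ℓ′) where
      field
        T-cong : ∀ {x y} → x ≈ y → T x K.≈ T y
        T-+    : ∀ x y → T (x + y) K.≈ T x K.+ T y
        T-ι*   : ∀ s x → T (ι s * x) K.≈ Kι.ι s K.* T x
        power  : ℕ → ℤ
        T-α^   : ∀ n → T (α ^ n) K.≈ Kι.ι (power n)
        power-prime : ∀ {p} → Prime p → ∀ n → + p ℤ∣.∣ power (n ℕ.* p) ℤ.- power n

    -- Traces are elements of `K`, where divisibility by `p` has no content; it is asserted of an
    -- integer that represents the trace.
    record TraceDivisible (p : ℕ) (x : Carrier) : Set ℓ′ where
      constructor traceDivisible
      field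
        {value}  : ℤ
        T≈       : T x K.≈ Kι.ι value
        divisible : + p ℤ∣.∣ value

    module _ (isTrace : IsTrace) where
      open IsTrace isTrace

      T-horner : ∀ β (A : ℕ → ℤ) → (∀ n → T (β ^ n) K.≈ Kι.ι (A n)) → ∀ (c : ℕ → ℤ) m → T (horner (λ n → ι (c n)) m β) K.≈ Kι.ι (conv A c m)
      T-horner β A eq c zero    = K.trans (T-cong (≈-sym (zeroˡ 0#))) (K.trans (T-ι* (+ 0) 0#) (K.zeroˡ _))
      T-horner β A eq c (suc m) = K.trans (T-cong (horner-front (λ n → ι (c n)) m β)) (K.trans (T-+ _ _) (K.trans
        (K.+-cong (K.trans (T-ι* (c 0) (β ^ m)) (K.trans (K.*-congˡ (eq m)) (K.sym (Kι.ι-* (c 0) (A m))))) (T-horner β A eq (c ∘ suc) m))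
        (K.sym (Kι.ι-+ (c 0 ℤ.* A m) (conv A (c ∘ suc) m)))))

      T-integral : ∀ {x} → Integral x → ∃ λ t → T x K.≈ Kι.ι t
      T-integral (_ , c , _ , x≈) = conv power c d , K.trans (T-cong x≈) (T-horner α power T-α^ c d)

      module _ {p : ℕ} (pp : Prime p) where
        open Congruence 𝓞 p
        private instance _ = prime⇒nonZero pp

        TraceDivisible-cong : ∀ {x y} → x ≈ y → TraceDivisible p x → TraceDivisible p y
        TraceDivisible-cong x≈y (traceDivisible T≈ div) = traceDivisible (K.trans (T-cong (≈-sym x≈y)) T≈) div

        TraceDivisible-+ : ∀ {x y} → TraceDivisible p x → TraceDivisible p y → TraceDivisible p (x + y)
        TraceDivisible-+ (traceDivisible {t} T≈ div) (traceDivisible {t′} T≈′ div′) =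
          traceDivisible (K.trans (T-+ _ _) (K.trans (K.+-cong T≈ T≈′) (K.sym (Kι.ι-+ t t′)))) (ℤ∣.∣m∣n⇒∣m+n div div′)

        TraceDivisible-neg : ∀ {x} → TraceDivisible p x → TraceDivisible p (- x)
        TraceDivisible-neg {x} (traceDivisible {t} T≈ div) = traceDivisible
          (K.trans (T-cong (solve 1 (λ x → :- x := con (ℤ.- + 1) :* x) ≈-refl x)) (K.trans (T-ι* (ℤ.- + 1) x) (K.trans (K.*-congˡ T≈) (K.sym (Kι.ι-* (ℤ.- + 1) t)))))
          (ℤ∣.∣n⇒∣m*n (ℤ.- + 1) div)

        Multiple⇒TraceDivisible : ∀ {x} → Multiple (+ p) x → TraceDivisible p x
        Multiple⇒TraceDivisible {x} (multiple {w} Iw x≈) = let t , Tw≈ = T-integral Iw in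
          traceDivisible (K.trans (T-cong x≈) (K.trans (T-ι* (+ p) w) (K.trans (K.*-congˡ Tw≈) (K.sym (Kι.ι-* (+ p) t))))) (ℤ∣.∣m⇒∣m*n t ℤ∣.∣-refl)

        TraceDivisible-sub : ∀ {x y s t} → T x K.≈ Kι.ι s → T y K.≈ Kι.ι t → + p ℤ∣.∣ s ℤ.- t → TraceDivisible p (x - y)
        TraceDivisible-sub {x} {y} {s} {t} Tx Ty div = traceDivisible
          (K.trans (T-cong (+-congˡ (solve 1 (λ x → :- x := con (ℤ.- + 1) :* x) ≈-refl y))) (K.trans (T-+ _ _) (K.trans (K.+-cong Tx (K.trans (T-ι* (ℤ.- + 1) y) (K.*-congˡ Ty)))
            (K.trans (K.+-congˡ (K.sym (Kι.ι-* (ℤ.- + 1) t))) (K.sym (Kι.ι-+ s ((ℤ.- + 1) ℤ.* t)))))))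
          (subst (λ z → + p ℤ∣.∣ s ℤ.+ z) (sym (ℤₚ.-1*i≡-i t)) div)

        α^-frobenius : ∀ n → (α ^ p) ^ n ≈ α ^ (n ℕ.* p)
        α^-frobenius n = ≈-trans (^-assocʳ α p n) (^-congʳ α (ℕₚ.*-comm p n))

        -- For x = c(α) one has x ^ p ≡ c(α ^ p) modulo p. The trace of c(α ^ p) combines the
        -- `power (n * p)` with the same coefficients with which that of x combines the `power n`,
        -- and these are congruent termwise.
        trace-frobenius : ∀ {x} → Integral x → TraceDivisible p (x ^ p - x)
        trace-frobenius {x} (_ , c , _ , x≈) = TraceDivisible-cong
          (≈-trans (solve 3 (λ u v w → (u :- v) :+ (v :- w) := u :- w) ≈-refl (⟦ c ⟧ ^ p) (horner (λ n → ι (c n)) d (α ^ p)) ⟦ c ⟧)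
            (+-cong (^-congˡ p (≈-sym x≈)) (-‿cong (≈-sym x≈))))
          (TraceDivisible-+ (Multiple⇒TraceDivisible (frobenius-horner pp c d))
            (TraceDivisible-sub {s = conv (λ n → power (n ℕ.* p)) c d} {t = conv power c d} (T-horner (α ^ p) (λ n → power (n ℕ.* p)) (λ n → K.trans (T-cong (α^-frobenius n)) (T-α^ (n ℕ.* p))) c d) (T-horner α power T-α^ c d) difference))
          where
          difference : + p ℤ∣.∣ conv (λ n → power (n ℕ.* p)) c d ℤ.- conv power c d
          difference = subst (+ p ℤ∣.∣_) (trans (conv--ˡ (λ n → power (n ℕ.* p)) power (+ 1) c d) (cong (λ z → conv (λ n → power (n ℕ.* p)) c d ℤ.- z) (ℤₚ.*-identityˡ (conv power c d))))
            (conv-∣ (λ n → power (n ℕ.* p) ℤ.- + 1 ℤ.* power n) c d (λ n _ → subst (λ z → + p ℤ∣.∣ power (n ℕ.* p) ℤ.- z) (sym (ℤₚ.*-identityˡ (power n))) (power-prime pp n)))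

        open import Algebra.Properties.CommutativeSemiring.Exp commutativeSemiring using (^-distrib-*)

        module _ (nondegenerate : ∀ {z} → Integral z → (∀ n → TraceDivisible p (z * α ^ n)) → Multiple (+ p) z) where

          -- The difference z satisfies z ^ p ≡ 0, so the p-th powers of all z α ^ n vanish modulo
          -- p. Their traces are those of the z α ^ n themselves, and nondegeneracy gives z ≡ 0: the
          -- order modulo p is reduced.
          frobenius-injective : ∀ {x y} → Integral x → Integral y → x ^ p ≋ y ^ p → x ≋ y
          frobenius-injective {x} {y} Ix Iy xᵖ≋yᵖ = nondegenerate Iz (λ n → TraceDivisible-cong (solve 2 (λ u v → u :+ :- (u :- v) := v) ≈-refl (w n ^ p) (w n))
              (TraceDivisible-+ (Multiple⇒TraceDivisible (Multiple-cong (≈-sym (^-distrib-* z (α ^ n) p)) (Multiple-*ʳ zᵖ≋0 (Integral-^ p (Integral-^ n Integral-α)))))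
                (TraceDivisible-neg (trace-frobenius (Integral-* Iz (Integral-^ n Integral-α))))))
            where
            z = x - y
            w : ℕ → Carrier
            w n = z * α ^ n
            Iz = Integral-sub Ix Iy
            zᵖ≋0 : Multiple (+ p) (z ^ p)
            zᵖ≋0 = Multiple-cong (solve 2 (λ u v → (u :- v) :+ v := u) ≈-refl (z ^ p) (x ^ p - y ^ p)) (Multiple-+ (frobenius-sub pp Ix Iy) xᵖ≋yᵖ)

          private
            residues : (ℕ → ℤ) → Fin d → Fin p
            residues c n = Fin.fromℕ< (n%ℕd<d (c (toℕ n)) p)

            residues-injective : ∀ c c′ → Fin.funToFin (residues c) ≡ Fin.funToFin (residues c′) → ∀ n → n < d → c n %ℕ p ≡ c′ n %ℕ p
            residues-injective c c′ eq n n<d = subst (λ n → c n %ℕ p ≡ c′ n %ℕ p) (Finₚ.toℕ-fromℕ< n<d)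
              (trans (sym (Finₚ.toℕ-fromℕ< (n%ℕd<d (c (toℕ m)) p)))
                (trans (cong toℕ (trans (sym (Finₚ.finToFun-funToFin (residues c) m)) (trans (cong (λ f → Fin.finToFun f m) eq) (Finₚ.finToFun-funToFin (residues c′) m))))
                  (Finₚ.toℕ-fromℕ< (n%ℕd<d (c′ (toℕ m)) p))))
              where m = Fin.fromℕ< n<d

            same-residues : ∀ c c′ → (∀ n → n < d → c n %ℕ p ≡ c′ n %ℕ p) → ⟦ c ⟧ ≋ ⟦ c′ ⟧
            same-residues c c′ same = Multiple-cong (≈-sym (≈-trans
                (solve 2 (λ u v → u :- v := u :+ con (ℤ.- + 1) :* v) ≈-refl ⟦ c ⟧ ⟦ c′ ⟧)
                (≈-trans (≈-sym (⟦⟧-linear c c′ (ℤ.- + 1))) (≈-trans (horner-congˡ d (λ n n<d → ≈-trans (ι-cong (quotient n n<d)) (ι-* (+ p) (q n)))) (horner-* (λ n → ι (q n)) (ι (+ p)) d α)))))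
                (Multiple-ι* (+ p) (_ , ⟦⟧-Height q))
              where
              open ℤ-Solver.+-*-Solver using () renaming (solve to solveℤ; _:+_ to _⊕_; _:*_ to _⊛_; :-_ to ⊝_; _:=_ to _≣_; _:-_ to _⊖_; con to κ)
              q : ℕ → ℤ
              q n = c n /ℕ p ℤ.- c′ n /ℕ p
              quotient : ∀ n → n < d → c n ℤ.+ (ℤ.- + 1) ℤ.* c′ n ≡ + p ℤ.* q n
              quotient n n<d = trans (cong₂ (λ x y → x ℤ.+ (ℤ.- + 1) ℤ.* y) (trans (a≡a%ℕn+[a/ℕn]*n (c n) p) (cong (λ r → + r ℤ.+ c n /ℕ p ℤ.* + p) (same n n<d))) (a≡a%ℕn+[a/ℕn]*n (c′ n) p))
                (solveℤ 4 (λ r a b P → (r ⊕ a ⊛ P) ⊕ κ (ℤ.- + 1) ⊛ (r ⊕ b ⊛ P) ≣ P ⊛ (a ⊖ b)) refl (+ (c′ n %ℕ p)) (c n /ℕ p) (c′ n /ℕ p) (+ p))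

            -- There are at most `p ^ d` classes modulo `p`, one for each tuple of residues of the
            -- coordinates.
            collision : (x : ℕ → Carrier) → (∀ i → ∃ λ c → x i ≈ ⟦ c ⟧) → ∃ λ i → ∃ λ j → i < j × x i ≋ x j
            collision x coord = let i , j , i<j , eq = Finₚ.pigeonhole (ℕₚ.n<1+n (p ℕ.^ d)) (λ i → Fin.funToFin (residues (c (toℕ i)))) in
              toℕ i , toℕ j , i<j , ≋-trans (≈⇒≋ (proj₂ (coord (toℕ i)))) (≋-trans
                (same-residues (c (toℕ i)) (c (toℕ j)) (residues-injective (c (toℕ i)) (c (toℕ j)) eq)) (≈⇒≋ (≈-sym (proj₂ (coord (toℕ j))))))
              where
              c : ℕ → ℕ → ℤ
              c i = proj₁ (coord i)

            descend : ∀ i j → α ^ (p ℕ.^ i) ≋ α ^ (p ℕ.^ (i ℕ.+ j)) → α ≋ α ^ (p ℕ.^ j)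
            descend zero    j eq = ≋-trans (≈⇒≋ (≈-sym (*-identityʳ α))) eq
            descend (suc i) j eq = descend i j (frobenius-injective (Integral-^ (p ℕ.^ i) Integral-α) (Integral-^ (p ℕ.^ (i ℕ.+ j)) Integral-α)
              (≋-trans (≈⇒≋ (raise i)) (≋-trans eq (≈⇒≋ (≈-sym (raise (i ℕ.+ j)))))))
              where
              raise : ∀ i → (α ^ (p ℕ.^ i)) ^ p ≈ α ^ (p ℕ.^ suc i)
              raise i = ≈-trans (^-assocʳ α (p ℕ.^ i) p) (^-congʳ α (ℕₚ.*-comm (p ℕ.^ i) p))

          -- Among the iterated Frobenius images of α two are congruent, say the i-th and the j-th
          -- with i < j. Cancelling Frobenius i times leaves α ≡ α ^ (p ^ (j - i)), and `M` is p ^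
          -- (j - i - 1).
          α-is-p-th-power : ∃ λ M → 1 ≤ M × α ≋ α ^ (M ℕ.* p)
          α-is-p-th-power = let i , j , i<j , eq = collision (λ i → α ^ (p ℕ.^ i)) coordinates in
            p ℕ.^ (j ∸ suc i) , ℕₚ.m^n>0 p (j ∸ suc i) ,
            ≋-trans (descend i (suc (j ∸ suc i)) (subst (λ x → α ^ (p ℕ.^ i) ≋ α ^ (p ℕ.^ x)) (sym (trans (ℕₚ.+-suc i (j ∸ suc i)) (ℕₚ.m+[n∸m]≡n i<j))) eq))
              (≈⇒≋ (^-congʳ α (ℕₚ.*-comm p (p ℕ.^ (j ∸ suc i)))))
            where
            coordinates : ∀ i → ∃ λ c → α ^ (p ℕ.^ i) ≈ ⟦ c ⟧
            coordinates i = let _ , c , _ , eq = Integral-^ (p ℕ.^ i) Integral-α in c , eq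

          -- T(uᵖ α^{np}) ≡ T(u αⁿ) ≡ T(u α^{np}) modulo p, and the α^{np} with n ≥ 0 generate the order modulo p.
          frobenius-fixed : ∀ {u} → Integral u → (B : ℕ → ℤ) → (∀ n → T (u * α ^ n) K.≈ Kι.ι (B n)) →
            (∀ n → 1 ≤ n → + p ℤ∣.∣ B (n ℕ.* p) ℤ.- B n) → Multiple (+ p) (u ^ p - u)
          frobenius-fixed {u} Iu B TB B-prime = nondegenerate Iy all
            where
            y = u ^ p - u
            Iy = Integral-sub (Integral-^ p Iu) Iu
            on-powers : ∀ n → 1 ≤ n → TraceDivisible p (y * α ^ (n ℕ.* p))
            on-powers n 1≤n = TraceDivisible-cong
              (≈-trans (solve 3 (λ a b c → (a :- b) :+ :- (c :- b) := a :- c) ≈-refl ((u * α ^ n) ^ p) (u * α ^ n) (u * α ^ (n ℕ.* p)))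
                (≈-trans (+-congʳ (≈-trans (^-distrib-* u (α ^ n) p) (*-congˡ (^-assocʳ α n p)))) (solve 3 (λ a b c → a :* c :- b :* c := (a :- b) :* c) ≈-refl (u ^ p) u (α ^ (n ℕ.* p)))))
              (TraceDivisible-+ (trace-frobenius (Integral-* Iu (Integral-^ n Integral-α)))
                (TraceDivisible-neg (TraceDivisible-sub {s = B (n ℕ.* p)} {t = B n} (TB (n ℕ.* p)) (TB n) (B-prime n 1≤n))))
            all : ∀ n → TraceDivisible p (y * α ^ n)
            -- The congruences for `B` start at index 1, so n = 0 is treated directly by Tr(uᵖ) ≡
            -- Tr(u).
            all zero      = TraceDivisible-cong (≈-sym (*-identityʳ y)) (trace-frobenius Iu)
            -- Modulo p, `α ^ n` may be replaced by `α ^ (n * M * p)`, whose exponent is a positive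
            -- multiple of p.
            all n@(suc _) = let M , 1≤M , α≋ = α-is-p-th-power in
              TraceDivisible-cong (solve 2 (λ u v → (u :- v) :+ v := u) ≈-refl (y * α ^ n) (y * α ^ (n ℕ.* M ℕ.* p)))
                (TraceDivisible-+ (Multiple⇒TraceDivisible (≋-* (Integral-^ n Integral-α) Iy (≈⇒≋ ≈-refl)
                    (≋-trans (≋-^ n Integral-α (Integral-^ (M ℕ.* p) Integral-α) α≋) (≈⇒≋ (≈-trans (^-assocʳ α (M ℕ.* p) n) (^-congʳ α (trans (ℕₚ.*-comm (M ℕ.* p) n) (sym (ℕₚ.*-assoc n M p)))))))))
                  (on-powers (n ℕ.* M) (ℕₚ.*-mono-≤ {1} {n} (s≤s z≤n) 1≤M)))

-- Elements fixed by Frobenius modulo almost all primes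

module Kronecker where
  open Lattice using (MonicOrder; module Order; bound)
  open Frobenius using (module Congruence)
  open Vandermonde using (module Alternants; quotientSum; FrobeniusFixed; Δ-Multiple)
  open Factorials using (triangle; no-small-multiple)
  open Bezout using (searchBelow)
  open import Data.Nat using (_!)
  open import Data.Nat.DivMod using (_/_; _%_; m≡m%n+[m/n]*n; m%n<n; m<n*o⇒m/o<n)
  open import Data.List.Relation.Unary.All using (All; []; _∷_)

  module FrobeniusInvariants {a ℓ : Level} (𝓞 : MonicOrder a ℓ) where
    open Order 𝓞
    open CommutativeRing R renaming (refl to ≈-refl; sym to ≈-sym; trans to ≈-trans; zero to *-zero; reflexive to ≈-reflexive)
    open RingTools.IntegerAction R
    open ≈-Solver
    open Alternants R
    open import Relation.Binary.Reasoning.Setoid setoid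

    -- A form of nonvanishing that is stable under products even in the presence of zero divisors.
    record UnitUpToℤ (x : Carrier) : Set (a ⊔ ℓ) where
      constructor unit
      field
        {cofactor} : Carrier
        {norm}     : ℤ
        nonzero    : norm ≢ + 0
        equation   : x * cofactor ≈ ι norm

    UnitUpToℤ-* : ∀ {x y} → UnitUpToℤ x → UnitUpToℤ y → UnitUpToℤ (x * y)
    UnitUpToℤ-* {x} {y} (unit {w} {m} m≢0 eq) (unit {v} {n} n≢0 eq′) = unit (λ mn≡0 → [ m≢0 , n≢0 ]′ (ℤₚ.i*j≡0⇒i≡0∨j≡0 m mn≡0))
      (≈-trans (solve 4 (λ x y w v → (x :* y) :* (w :* v) := (x :* w) :* (y :* v)) ≈-refl x y w v) (≈-trans (*-cong eq eq′) (≈-sym (ι-* m n))))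

    UnitUpToℤ-ι : ∀ {s} → s ≢ + 0 → UnitUpToℤ (ι s)
    UnitUpToℤ-ι s≢0 = unit s≢0 (*-identityʳ _)

    UnitUpToℤ-cong : ∀ {x y} → x ≈ y → UnitUpToℤ x → UnitUpToℤ y
    UnitUpToℤ-cong x≈y (unit m≢0 eq) = unit m≢0 (≈-trans (*-congʳ (≈-sym x≈y)) eq)

    module _
      (independent : ∀ c → ⟦ c ⟧ ≈ 0# → ∀ n → n < d → c n ≡ + 0)
      (nonzero⇒unit : ∀ c → (∃ λ n → n < d × c n ≢ + 0) → UnitUpToℤ ⟦ c ⟧)
      (ι≉0 : ∀ {m} → m ≢ + 0 → ¬ ι m ≈ 0#)
      (P : ℕ) (2≤P : 2 ≤ P) (g : ℕ → ℤ)
      (fixed : ∀ p → Prime p → P < p → Multiple (+ p) (⟦ g ⟧ ^ p - ⟦ g ⟧)) where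

      private
        u : Carrier
        u = ⟦ g ⟧

        combination : ℤ → ℤ → Carrier
        combination s t = ι s + ι t * u

        combination≈ : ∀ s t → combination s t ≈ ⟦ (λ n → s ℤ.* one n ℤ.+ t ℤ.* g n) ⟧
        combination≈ s t = ≈-sym (begin
          ⟦ (λ n → s ℤ.* one n ℤ.+ t ℤ.* g n) ⟧          ≈⟨ ⟦⟧-linear (λ n → s ℤ.* one n) g t ⟩
          ⟦ (λ n → s ℤ.* one n) ⟧ + ι t * u              ≈⟨ +-congʳ (horner-congˡ d (λ n _ → ι-* s (one n))) ⟩
          horner (λ n → ι s * ι (one n)) d α + ι t * u   ≈⟨ +-congʳ (horner-* (λ n → ι (one n)) (ι s) d α) ⟩
          ι s * ⟦ one ⟧ + ι t * u                        ≈⟨ +-congʳ (≈-trans (*-congˡ (≈-sym ⟦one⟧)) (*-identityʳ (ι s))) ⟩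
          ι s + ι t * u                                  ∎)

        H : ℕ
        H = 1 ℕ.+ bound g d

        combination-Height : ∀ {X} s t → ∣ s ∣ ≤ X → ∣ t ∣ ≤ X → Height (H ℕ.* X) (combination s t)
        combination-Height {X} s t s≤X t≤X = Height-mono (ℕₚ.≤-trans (ℕₚ.+-mono-≤ (ℕₚ.≤-trans (ℕₚ.≤-reflexive (ℕₚ.*-identityʳ ∣ s ∣)) s≤X) (ℕₚ.*-monoˡ-≤ (bound g d) t≤X))
            (ℕₚ.≤-reflexive (cong (X ℕ.+_) (ℕₚ.*-comm X (bound g d)))))
          (Height-cong (+-congʳ (*-identityʳ (ι s))) (Height-+ (Height-ι* s Height-1) (Height-ι* t (⟦⟧-Height g))))

        combination-Integral : ∀ s t → Integral (combination s t)
        combination-Integral s t = Integral-+ (Integral-ι s) (Integral-ι* t (_ , ⟦⟧-Height g))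

        combination-fixed : ∀ p → Prime p → P < p → ∀ s t → FrobeniusFixed 𝓞 p (combination s t)
        combination-fixed p pp P<p s t = combination-Integral s t ,
          ≋-trans (frobenius-+ pp (Integral-ι s) (Integral-* (Integral-ι t) Iu))
            (≋-+ (fermat pp s) (≋-trans (≈⇒≋ (^-distrib-* (ι t) u p)) (≋-* (Integral-^ p Iu) (Integral-ι t) (fermat pp t) (fixed p pp P<p))))
          where
          open Congruence 𝓞 p
          open import Algebra.Properties.CommutativeSemiring.Exp commutativeSemiring using (^-distrib-*)
          Iu : Integral u
          Iu = _ , ⟦⟧-Height g

        pos-^ : ∀ p n → ∣ (+ p) ℤ.^ n ∣ ≡ p ℕ.^ n
        pos-^ p zero    = refl
        pos-^ p (suc n) = trans (ℤₚ.abs-* (+ p) ((+ p) ℤ.^ n)) (cong (p ℕ.*_) (pos-^ p n))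

        module Points (n₀ : ℕ) (n₀<k : n₀ < k) (g≢0 : g n₀ ≢ + 0) (X : ℕ) (2≤X : 2 ≤ X) where
          instance
            X≢0 : NonZero X
            X≢0 = ℕ.>-nonZero (ℕₚ.<⇒≤ 2≤X)

          point : ℕ → Carrier
          point i = combination (+ (i % X)) (+ (i / X))

          points : ℕ → List Carrier
          points zero    = []
          points (suc n) = point n ∷ points n

          length-points : ∀ n → List.length (points n) ≡ n
          length-points zero    = refl
          length-points (suc n) = cong suc (length-points n)

          point-difference : ∀ i j → point i - point j ≈ combination (+ (i % X) ℤ.- + (j % X)) (+ (i / X) ℤ.- + (j / X))
          point-difference i j = ≈-trans (solve 5 (λ a b a′ b′ u → (a :+ b :* u) :- (a′ :+ b′ :* u) := (a :- a′) :+ (b :- b′) :* u) ≈-refl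
              (ι (+ (i % X))) (ι (+ (i / X))) (ι (+ (j % X))) (ι (+ (j / X))) u)
            (+-cong (≈-sym (ι-sub (+ (i % X)) (+ (j % X)))) (*-congʳ (≈-sym (ι-sub (+ (i / X)) (+ (j / X))))))
            where
            ι-sub : ∀ a b → ι (a ℤ.- b) ≈ ι a - ι b
            ι-sub a b = ≈-trans (ι-+ a (ℤ.- b)) (+-congˡ (ι-neg b))

          -- For `t = 0` the element is a nonzero integer. Otherwise its coordinate `n₀` is
          -- `t * g n₀`, because 1 has a coordinate only at the index `k > n₀`.
          combination-unit : ∀ s t → ¬ (s ≡ + 0 × t ≡ + 0) → UnitUpToℤ (combination s t)
          combination-unit s t ≢0 with t ℤ.≟ + 0
          ... | yes refl = UnitUpToℤ-cong (solve 2 (λ s u → s := s :+ con (+ 0) :* u) ≈-refl (ι s) u) (UnitUpToℤ-ι (λ s≡0 → ≢0 (s≡0 , refl)))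
          ... | no t≢0   = UnitUpToℤ-cong (≈-sym (combination≈ s t)) (nonzero⇒unit (λ n → s ℤ.* one n ℤ.+ t ℤ.* g n) (n₀ , ℕₚ.m<n⇒m<1+n n₀<k , λ eq →
              [ t≢0 , g≢0 ]′ (ℤₚ.i*j≡0⇒i≡0∨j≡0 t (trans (sym (trans (cong (λ x → s ℤ.* x ℤ.+ t ℤ.* g n₀) (one-< n₀ n₀<k)) (trans (cong (ℤ._+ t ℤ.* g n₀) (ℤₚ.*-zeroʳ s)) (ℤₚ.+-identityˡ _)))) eq))))

          -- An index is determined by its remainder and quotient on division by `X`.
          difference-unit : ∀ i j → i ≢ j → UnitUpToℤ (point i - point j)
          difference-unit i j i≢j = UnitUpToℤ-cong (≈-sym (point-difference i j)) (combination-unit (+ (i % X) ℤ.- + (j % X)) (+ (i / X) ℤ.- + (j / X)) (λ (s≡0 , t≡0) →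
            i≢j (trans (m≡m%n+[m/n]*n i X) (trans (cong₂ (λ x y → x ℕ.+ y ℕ.* X) (ℤₚ.+-injective (ℤₚ.i-j≡0⇒i≡j (+ (i % X)) (+ (j % X)) s≡0)) (ℤₚ.+-injective (ℤₚ.i-j≡0⇒i≡j (+ (i / X)) (+ (j / X)) t≡0))) (sym (m≡m%n+[m/n]*n j X))))))

          Π-unit : ∀ n m → m ≤ n → UnitUpToℤ (Π (point n) (points m))
          Π-unit n zero    _   = UnitUpToℤ-cong ι-1 (UnitUpToℤ-ι {+ 1} (λ ()))
          Π-unit n (suc m) m<n = UnitUpToℤ-* (difference-unit n m (ℕₚ.<⇒≢ m<n ∘ sym)) (Π-unit n m (ℕₚ.<⇒≤ m<n))

          Δ-unit : ∀ n → UnitUpToℤ (Δ (points n))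
          Δ-unit zero    = UnitUpToℤ-cong ι-1 (UnitUpToℤ-ι {+ 1} (λ ()))
          Δ-unit (suc n) = UnitUpToℤ-* (Π-unit n n ℕₚ.≤-refl) (Δ-unit n)

          F : ℕ
          F = distortion ℕ.* H ℕ.* X

          difference-Height : ∀ i j → i < X ℕ.* X → j < X ℕ.* X → Height (H ℕ.* X) (point i - point j)
          difference-Height i j i< j< = Height-cong (≈-sym (point-difference i j)) (combination-Height (+ (i % X) ℤ.- + (j % X)) (+ (i / X) ℤ.- + (j / X))
              (close (ℕₚ.<⇒≤ (m%n<n i X)) (ℕₚ.<⇒≤ (m%n<n j X))) (close (ℕₚ.<⇒≤ (m<n*o⇒m/o<n i<)) (ℕₚ.<⇒≤ (m<n*o⇒m/o<n j<))))
            where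
            close : ∀ {m n} → m ≤ X → n ≤ X → ∣ + m ℤ.- + n ∣ ≤ X
            close {m} {n} m≤X n≤X = ℕₚ.≤-trans (ℕₚ.≤-reflexive (trans (cong ∣_∣ (ℤₚ.m-n≡m⊖n m n)) (ℤₚ.∣m⊖n∣≡∣n⊖m∣ m n)))
              (ℕₚ.≤-trans (ℤₚ.∣m⊝n∣≤m⊔n n m) (ℕₚ.⊔-lub n≤X m≤X))

          -- The trailing factor `y` is carried along so that every point difference costs exactly
          -- one factor `F`, with the distortion of its multiplication included.
          Π*-Height : ∀ {h y} → Height h y → ∀ n m → n < X ℕ.* X → m ≤ n → Height (F ℕ.^ m ℕ.* h) (Π (point n) (points m) * y)
          Π*-Height {h} {y} Hy n zero    n< _   = Height-cong (≈-sym (*-identityˡ y)) (Height-mono (ℕₚ.≤-reflexive (sym (ℕₚ.+-identityʳ h))) Hy)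
          Π*-Height {h} {y} Hy n (suc m) n< m<n = Height-cong (≈-sym (*-assoc _ _ _)) (Height-mono (ℕₚ.≤-reflexive eq)
              (Height-* (difference-Height n m n< (ℕₚ.<-trans m<n n<)) (Π*-Height Hy n m n< (ℕₚ.<⇒≤ m<n))))
            where
            eq : distortion ℕ.* (H ℕ.* X ℕ.* (F ℕ.^ m ℕ.* h)) ≡ F ℕ.^ suc m ℕ.* h
            eq = trans (sym (ℕₚ.*-assoc distortion (H ℕ.* X) (F ℕ.^ m ℕ.* h))) (trans (cong (ℕ._* (F ℕ.^ m ℕ.* h)) (sym (ℕₚ.*-assoc distortion H X))) (sym (ℕₚ.*-assoc F (F ℕ.^ m) h)))

          Δ-Height : ∀ n → n ≤ X ℕ.* X → Height (F ℕ.^ triangle n) (Δ (points n))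
          Δ-Height zero    _  = Height-1
          Δ-Height (suc n) n< = Height-mono (ℕₚ.≤-reflexive (sym (ℕₚ.^-distribˡ-+-* F n (triangle n)))) (Π*-Height (Δ-Height n (ℕₚ.<⇒≤ n<)) n n n< ℕₚ.≤-refl)

          points-fixed : ∀ p → Prime p → P < p → ∀ n → All (FrobeniusFixed 𝓞 p) (points n)
          points-fixed p pp P<p zero    = []
          points-fixed p pp P<p (suc n) = combination-fixed p pp P<p (+ (n % X)) (+ (n / X)) ∷ points-fixed p pp P<p n

          -- Coordinates are unique by `independent`, so divisibility in the order can be read off
          -- from any representation.
          multiple-coordinate : ∀ {m x} c → x ≈ ⟦ c ⟧ → Multiple m x → ∀ n → n < d → m ℤ∣.∣ c n
          multiple-coordinate {m} c x≈ (multiple (_ , c′ , _ , w≈) x≈′) n n<d = ℤ∣.divides (c′ n) (trans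
            (ℤₚ.i-j≡0⇒i≡j (c n) (m ℤ.* c′ n) (trans (cong (λ z → c n ℤ.+ z) (ℤₚ.neg-distribˡ-* m (c′ n))) (independent (λ n → c n ℤ.+ (ℤ.- m) ℤ.* c′ n) zero-difference n n<d))) (ℤₚ.*-comm m (c′ n)))
            where
            zero-difference : ⟦ (λ n → c n ℤ.+ (ℤ.- m) ℤ.* c′ n) ⟧ ≈ 0#
            zero-difference = begin
              ⟦ (λ n → c n ℤ.+ (ℤ.- m) ℤ.* c′ n) ⟧    ≈⟨ ⟦⟧-linear c c′ (ℤ.- m) ⟩
              ⟦ c ⟧ + ι (ℤ.- m) * ⟦ c′ ⟧              ≈⟨ +-cong (≈-trans (≈-sym x≈) (≈-trans x≈′ (*-congˡ w≈))) (*-congʳ (ι-neg m)) ⟩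
              ι m * ⟦ c′ ⟧ + (- ι m) * ⟦ c′ ⟧         ≈⟨ solve 2 (λ m c → m :* c :+ (:- m) :* c := con (+ 0)) ≈-refl (ι m) ⟦ c′ ⟧ ⟩
              0#                                      ∎

          -- A nonzero coordinate of the determinant takes the place of its norm: it inherits both
          -- the divisibility and the bound on the height. One exists because the determinant
          -- divides a nonzero integer.
          bounded : ¬ (P !) ℕ.^ 2 ℕ.* (distortion ℕ.* H) ℕ.^ 3 ℕ.* 32 ℕ.^ 2 < X
          bounded B<X with Δ-Height (X ℕ.* X) ℕₚ.≤-refl
          ... | c , c≤ , Δ≈ with searchBelow d c
          ...   | inj₂ c≡0 with Δ-unit (X ℕ.* X)
          ...     | unit m≢0 eq = ι≉0 m≢0 (≈-trans (≈-sym eq) (≈-trans (*-congʳ (≈-trans Δ≈ (horner-zero d α (λ n n<d → ι-cong (c≡0 n n<d))))) (zeroˡ _)))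
          bounded B<X | c , c≤ , Δ≈ | inj₁ (n₁ , n₁<d , c≢0) = no-small-multiple P (distortion ℕ.* H) X 2≤P 2≤X B<X ∣ c n₁ ∣
              (ℕₚ.n≢0⇒n>0 (c≢0 ∘ ℤₚ.∣i∣≡0⇒i≡0)) (c≤ n₁ n₁<d)
              (λ p pp P<p → subst (_∣ ∣ c n₁ ∣) (trans (pos-^ (suc (suc p)) (quotientSum (suc (suc p)) (List.length (points (X ℕ.* X))))) (cong (λ m → suc (suc p) ℕ.^ quotientSum (suc (suc p)) m) (length-points (X ℕ.* X))))
                (ℤ∣.∣⇒∣ᵤ (multiple-coordinate c Δ≈ (Δ-Multiple 𝓞 p (points (X ℕ.* X)) (points-fixed (suc (suc p)) pp P<p (X ℕ.* X))) n₁ n₁<d)))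

      -- If u ∉ ℤ, the X ^ 2 points a + b u with 0 ≤ a, b < X are distinct, and their Vandermonde determinant is
      -- divisible by too large an integer.
      frobenius-invariant⇒constant : ∀ n → n < k → g n ≡ + 0
      frobenius-invariant⇒constant with searchBelow k g
      ... | inj₂ g≡0 = g≡0
      -- The choice `X = 2 + B` satisfies both `2 ≤ X` and `B < X`.
      ... | inj₁ (n₀ , n₀<k , g≢0) = ⊥-elim (Points.bounded n₀ n₀<k g≢0 (2 ℕ.+ B) (s≤s (s≤s z≤n)) (ℕₚ.m≤n+m (suc B) 1))
        where
        B = (P !) ℕ.^ 2 ℕ.* (distortion ℕ.* H) ℕ.^ 3 ℕ.* 32 ℕ.^ 2

-- The two implications

module Main where
  open DoldSums using (∣0; Dold-*ˡ; Dold⇒prime-∣; doldSum-cong)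
  open LogDerivative using (conv; conv-∣)
  open Lattice using (MonicOrder; module Order)
  open Bezout using (coeffℤ; coeffℤ-vanishes; VanishesFrom; module Evaluation)
  open Newton using (module FieldLemmas; module SimpleRoots)
  open Traces using (module TraceForm)
  open Kronecker using (module FrobeniusInvariants)
  import Algebra.Construct.Pointwise as Pointwise
  import Data.Fin as Fin
  import Data.Integer.Divisibility as ℤD
  open import Data.Vec using (toList)
  open import Data.Vec.Properties using (length-toList)
  open import Data.List.Properties using (unfold-reverse; length-map; length-reverse)
  open import Data.Nat.Coprimality using (Coprime; coprime-Bézout)
  open import Data.Nat.GCD using (module Bézout)
  open import Data.Nat.Primality using (prime⇒irreducible)
  open import Function.Bundles using (mk⇔)

  private
    -- Coordinates in the order descend in degree, whereas the polynomials of Euclid's algorithm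
    -- ascend.
    reversal : (ℕ → ℤ) → ℕ → ℕ → ℤ
    reversal c zero    i       = + 0
    reversal c (suc m) zero    = c m
    reversal c (suc m) (suc i) = reversal c m i

    reversal-vanishes : ∀ c m → VanishesFrom m (reversal c m)
    reversal-vanishes c zero    i       _         = refl
    reversal-vanishes c (suc m) (suc i) (s≤s m≤i) = reversal-vanishes c m i m≤i

    reversal-nonzero : ∀ c m n → n < m → c n ≢ + 0 → ∃ λ i → reversal c m i ≢ + 0
    reversal-nonzero c (suc m) n (s≤s n≤m) cn≢0 with ℕₚ.m≤n⇒m<n∨m≡n n≤m
    ... | inj₁ n<m  = let i , ≢0 = reversal-nonzero c m n n<m cn≢0 in suc i , ≢0
    ... | inj₂ refl = 0 , cn≢0

    coeffℤ-last : ∀ p a → coeffℤ (p ++ a ∷ []) (List.length p) ≡ a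
    coeffℤ-last []      a = refl
    coeffℤ-last (b ∷ p) a = coeffℤ-last p a

  module Reversal {c ℓ : Level} (R : CommutativeRing c ℓ) (α : CommutativeRing.Carrier R) where
    open CommutativeRing R renaming (refl to ≈-refl; sym to ≈-sym; trans to ≈-trans; zero to *-zero; reflexive to ≈-reflexive)
    open RingTools.IntegerAction R
    open ≈-Solver
    open Evaluation R α

    eval-reversal : ∀ c m → eval (reversal c m) m ≈ horner (λ n → ι (c n)) m α
    eval-reversal c zero    = ≈-refl
    eval-reversal c (suc m) = ≈-trans (+-congˡ (*-congˡ (eval-reversal c m))) (+-comm _ _)

    evalList-∷ʳ : ∀ p a → evalList (p ++ a ∷ []) ≈ ι a * α ^ List.length p + evalList p
    evalList-∷ʳ []      a = ≈-trans (solve 2 (λ a x → a :+ x :* con (+ 0) := a :+ con (+ 0)) ≈-refl (ι a) α) (+-congʳ (≈-sym (*-identityʳ _)))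
    evalList-∷ʳ (b ∷ p) a = ≈-trans (+-congˡ (*-congˡ (evalList-∷ʳ p a)))
      (solve 5 (λ b x a y z → b :+ x :* (a :* y :+ z) := a :* (x :* y) :+ (b :+ x :* z)) ≈-refl (ι b) α (ι a) (α ^ List.length p) (evalList p))

    evalList-reverse : ∀ p → evalList (List.reverse p) ≈ horner (λ n → ι (coeffℤ p n)) (List.length p) α
    evalList-reverse []      = ≈-refl
    evalList-reverse (a ∷ p) = ≈-trans (≈-reflexive (cong evalList (unfold-reverse a p))) (≈-trans (evalList-∷ʳ (List.reverse p) a)
      (≈-trans (+-cong (*-congˡ (^-congʳ α (length-reverse p))) (evalList-reverse p)) (≈-sym (horner-front (λ n → ι (coeffℤ (a ∷ p) n)) (List.length p) α))))

  module _ {c ℓ : Level} (K : Field c ℓ) (char0 : FieldOps.CharacteristicZero K) (k : ℕ) (r : Vec ℤ (suc k)) (U : ℕ → ℤ)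
    (irreducible : Irreducibleℚ (toℚPoly (charPoly r))) (α : Fin (suc k) → Field.Carrier K)
    (charPoly-roots : ∀ i → Field._≈_ K (FieldOps.evalℤ K (charPoly r) (α i)) (Field.0# K))
    (distinct : ∀ i j → Field._≈_ K (α i) (α j) → i ≡ j) (l : Fin (suc k) → Field.Carrier K)
    (U≈ : ∀ n → Field._≈_ K (FieldOps.ιℤ K (U n)) (FieldOps.ΣFin K (λ i → Field._*_ K (l i) (FieldOps.pow K (α i) n)))) where

    private
      open Field K renaming (refl to ≈-refl; sym to ≈-sym; trans to ≈-trans; zero to *-zero; reflexive to ≈-reflexive)
      open FieldOps K using (ΣFin)
      open FieldLemmas K
      open ≈-Solver
      open import Relation.Binary.Reasoning.Setoid setoid

      d : ℕ
      d = suc k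

      coefficients : List ℤ
      coefficients = + 1 ∷ List.map ℤ.-_ (toList r)

      e : ℕ → ℤ
      e = coeffℤ coefficients

      length-coefficients : List.length coefficients ≡ suc d
      length-coefficients = cong suc (trans (length-map ℤ.-_ (toList r)) (length-toList r))

      e-vanishes : ∀ n → d < n → e n ≡ + 0
      e-vanishes n d<n = coeffℤ-vanishes coefficients n (subst (_≤ n) (sym length-coefficients) d<n)

      charPoly≡ : charPoly r ≡ List.reverse coefficients
      charPoly≡ = sym (unfold-reverse (+ 1) (List.map ℤ.-_ (toList r)))

      charPoly-monic : coeffℤ (charPoly r) d ≢ + 0
      charPoly-monic eq = contradiction (trans (sym eq) (trans (cong (coeffℤ (charPoly r)) (sym (trans (length-reverse (List.map ℤ.-_ (toList r))) (ℕₚ.suc-injective length-coefficients))))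
        (coeffℤ-last (List.reverse (List.map ℤ.-_ (toList r))) (+ 1)))) λ ()

      evalℤ≈ : ∀ p x → FieldOps.evalℤ K p x ≈ Evaluation.evalList commutativeRing x p
      evalℤ≈ []      x = ≈-refl
      evalℤ≈ (a ∷ p) x = +-cong (ιℤ≈ι a) (*-congˡ (evalℤ≈ p x))

      pow≈ : ∀ x n → FieldOps.pow K x n ≈ x ^ n
      pow≈ x zero    = ≈-refl
      pow≈ x (suc n) = *-congˡ (pow≈ x n)

      roots : ∀ i → horner (λ n → ι (e n)) (suc d) (α i) ≈ 0#
      roots i = ≈-trans (≈-sym (≈-reflexive (cong (λ m → horner (λ n → ι (e n)) m (α i)) length-coefficients)))
        (≈-trans (≈-sym (Reversal.evalList-reverse commutativeRing (α i) coefficients))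
          (≈-trans (≈-reflexive (cong (Evaluation.evalList commutativeRing (α i)) (sym charPoly≡))) (≈-trans (≈-sym (evalℤ≈ (charPoly r) (α i))) (charPoly-roots i))))

      open SimpleRoots K char0 d e refl e-vanishes α roots distinct

      Σlα^n : ∀ n → ΣFin (λ i → l i * α i ^ n) ≈ ι (U n)
      Σlα^n n = ≈-trans (Σ-cong (λ i → *-congˡ {l i} (≈-sym (pow≈ (α i) n)))) (≈-trans (≈-sym (U≈ n)) (ιℤ≈ι (U n)))

    -- The common value λ₀ lies in `K` and need not be an integer, but `λ₀ * d` is `U 0`. Hence `d`
    -- serves as the multiplier: d U n = U 0 · powerSum n.
    equal⇒AlmostDold : (∀ i j → l i ≈ l j) → AlmostDold U
    equal⇒AlmostDold l≈l = d , s≤s z≤n , λ n 1≤n → subst (+ n ℤD.∣_) (doldSum-cong n (λ m _ _ → sym (proportional m))) (Dold-*ˡ (U 0) powerSum powerSum-Dold n 1≤n)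
      where
      λ₀ = l Fin.zero
      U≈λs : ∀ n → ι (U n) ≈ λ₀ * ι (powerSum n)
      U≈λs n = ≈-trans (≈-sym (Σlα^n n)) (≈-trans (Σ-cong (λ i → *-congʳ {α i ^ n} (l≈l i Fin.zero))) (≈-trans (Σ-*ˡ λ₀ (λ i → α i ^ n)) (*-congˡ (Σα^n n))))
      proportional : ∀ n → + d ℤ.* U n ≡ U 0 ℤ.* powerSum n
      proportional n = ι-injective char0 (begin
        ι (+ d ℤ.* U n)                          ≈⟨ ι-* (+ d) (U n) ⟩
        ι (+ d) * ι (U n)                        ≈⟨ *-congˡ (U≈λs n) ⟩
        ι (+ d) * (λ₀ * ι (powerSum n))          ≈⟨ solve 3 (λ x y z → x :* (y :* z) := (y :* x) :* z) ≈-refl (ι (+ d)) λ₀ (ι (powerSum n)) ⟩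
        (λ₀ * ι (+ d)) * ι (powerSum n)          ≈⟨ *-congʳ (*-congˡ (ι-cong (sym powerSum-0))) ⟩
        (λ₀ * ι (powerSum 0)) * ι (powerSum n)   ≈⟨ *-congʳ (≈-sym (U≈λs 0)) ⟩
        ι (U 0) * ι (powerSum n)                 ≈⟨ ≈-sym (ι-* (U 0) (powerSum n)) ⟩
        ι (U 0 ℤ.* powerSum n)                   ∎)

    private
      -- The order is realised in `K ^ d` by all its embeddings at once. The family `α` is then a
      -- single element, as is `l`, and rational integers are constant vectors.
      R : CommutativeRing c ℓ
      R = Pointwise.commutativeRing (Fin d) commutativeRing

      module R where
        open CommutativeRing R public
        open RingTools.IntegerAction R public

      ι-pointwise : ∀ a i → R.ι a i ≈ ι a
      ι-pointwise (+ n)    i = ιℕ-pointwise n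
        where
        ιℕ-pointwise : ∀ n → R.ιℕ n i ≈ ιℕ n
        ιℕ-pointwise zero    = ≈-refl
        ιℕ-pointwise (suc n) = +-congˡ (ιℕ-pointwise n)
      ι-pointwise -[1+ n ] i = -‿cong (ι-pointwise (+ suc n) i)

      horner-pointwise : ∀ (a : ℕ → ℤ) m y i → R.horner (λ n → R.ι (a n)) m y i ≈ hornerℤ a m (y i)
      horner-pointwise a zero    y i = ≈-refl
      horner-pointwise a (suc m) y i = +-cong (*-congˡ (horner-pointwise a m y i)) (ι-pointwise (a m) i)

      ^-pointwise : ∀ x n i → (x R.^ n) i ≈ x i ^ n
      ^-pointwise x zero    i = ≈-refl
      ^-pointwise x (suc n) i = *-congˡ (^-pointwise x n i)

      𝓞 : MonicOrder c ℓ
      𝓞 = record { R = R ; k = k ; α = α ; e = e ; e₀ = refl ; root = λ i → ≈-trans (horner-pointwise e (suc d) α i) (roots i) }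

      open Order 𝓞 using (⟦_⟧; Integral; Integral-cong; Integral-*; Integral-+; Integral-ι; Integral-ι*; Integral-α; Integral-0; ⟦⟧-Height;
                          Multiple; Multiple-cong; Multiple-ι*; Multiple-*ʳ)
      open TraceForm 𝓞 commutativeRing ΣFin
      open FrobeniusInvariants 𝓞 using (UnitUpToℤ; unit; frobenius-invariant⇒constant)

      ⟦⟧-pointwise : ∀ a i → ⟦ a ⟧ i ≈ hornerℤ a d (α i)
      ⟦⟧-pointwise a = horner-pointwise a d α

      isTrace : IsTrace
      isTrace = record
        { T-cong = Σ-cong
        ; T-+ = Σ-+
        ; T-ι* = λ s x → ≈-trans (Σ-cong (λ i → *-congʳ {x i} (ι-pointwise s i))) (Σ-*ˡ (ι s) x)
        ; power = powerSum
        ; T-α^ = λ n → ≈-trans (Σ-cong (^-pointwise α n)) (Σα^n n)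
        ; power-prime = power-prime
        }
        where
        power-prime : ∀ {p} → Prime p → ∀ n → + p ℤ∣.∣ powerSum (n ℕ.* p) ℤ.- powerSum n
        power-prime pp zero      = subst (_ ℤ∣.∣_) (sym (ℤₚ.+-inverseʳ (powerSum 0))) ∣0
        power-prime pp n@(suc _) = Dold⇒prime-∣ {powerSum} powerSum-Dold pp n (s≤s z≤n)

      independent : ∀ a → ⟦ a ⟧ R.≈ R.0# → ∀ n → n < d → a n ≡ + 0
      independent a a≈0 n n<d = ι-injective char0 (horner-vanishing d (λ n → ι (a n)) α distinct (λ i → ≈-trans (≈-sym (⟦⟧-pointwise a i)) (a≈0 i)) n n<d)

      ι≉0 : ∀ {m} → m ≢ + 0 → ¬ R.ι m R.≈ R.0#
      ι≉0 {m} m≢0 eq = ι-nonzero char0 m≢0 (≈-trans (≈-sym (ι-pointwise m Fin.zero)) (eq Fin.zero))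

      module Eval = Evaluation R α

      charPoly-root : Eval.evalList (charPoly r) R.≈ R.0#
      charPoly-root = R.trans (R.reflexive (cong Eval.evalList charPoly≡)) (R.trans (Reversal.evalList-reverse R α coefficients)
        (R.trans (R.reflexive (cong (λ m → R.horner (λ n → R.ι (e n)) m α) length-coefficients)) (MonicOrder.root 𝓞)))

      integral-inverse : ∀ a → (∃ λ n → n < d × a n ≢ + 0) → ∃ λ w → Integral w × ∃ λ m → m ≢ + 0 × (⟦ a ⟧ R.* w) R.≈ R.ι m
      integral-inverse a (n , n<d , an≢0) = let w , m , m≢0 , eq = inverse-of-reversal in
          Eval.evalList w , evalList-Integral w , m , m≢0 , R.trans (R.*-comm ⟦ a ⟧ (Eval.evalList w)) (R.trans (R.*-congˡ (R.sym (Reversal.eval-reversal R α a d))) eq)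
        where
        inverse-of-reversal : Eval.UnitUpToℤ d (reversal a d)
        inverse-of-reversal = Eval.bezout {charPoly r} irreducible {d} charPoly-monic charPoly-root d ℕₚ.≤-refl (reversal a d) (reversal-vanishes a d) (reversal-nonzero a d n n<d an≢0)
        evalList-Integral : ∀ p → Integral (Eval.evalList p)
        evalList-Integral []      = Integral-0
        evalList-Integral (b ∷ p) = Integral-+ (Integral-ι b) (Integral-* Integral-α (evalList-Integral p))

      nonzero⇒unit : ∀ a → (∃ λ n → n < d × a n ≢ + 0) → UnitUpToℤ ⟦ a ⟧
      nonzero⇒unit a nz = let _ , _ , _ , m≢0 , eq = integral-inverse a nz in unit m≢0 eq

      δ : R.Carrier
      δ i = different (α i)

      -- The coordinates of δ are those of the derivative, whose leading coefficient `d` is nonzero;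
      -- thus δ divides a nonzero integer.
      δ-inverse : ∃ λ w → Integral w × ∃ λ m → m ≢ + 0 × (δ R.* w) R.≈ R.ι m
      δ-inverse = let w , Iw , m , m≢0 , eq = integral-inverse (derivative d) (0 , s≤s z≤n , derivative≢0) in
          w , Iw , m , m≢0 , R.trans (R.*-congʳ δ≈) eq
        where
        derivative≢0 : derivative d 0 ≢ + 0
        derivative≢0 eq with trans (sym (ℤₚ.*-identityʳ (+ d))) eq
        ... | ()
        δ≈ : δ R.≈ ⟦ derivative d ⟧
        δ≈ i = ≈-trans (different≈ (α i)) (≈-sym (⟦⟧-pointwise (derivative d) i))

      -- By Euler's formula the coordinates of z δ are the sums Σ z i · E n (α i), which are
      -- integral combinations of the traces of the z α ^ j. This brings an element with integral
      -- traces into the order.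
      dual : ∀ z (A : ℕ → ℤ) → (∀ n → ΣFin (λ i → z i * α i ^ n) ≈ ι (A n)) → (z R.* δ) R.≈ ⟦ (λ n → conv A e (suc n)) ⟧
      dual z A TA i = ≈-sym (≈-trans (⟦⟧-pointwise (λ n → conv A e (suc n)) i)
        (≈-trans (horner-congˡ d (λ n _ → ≈-sym (Σ-hornerℤ z A TA e (suc n)))) (euler z i)))

      -- A Bézout relation between `p` and the absolute value of `m` writes `z` as a difference of
      -- two multiples of `p`.
      cancel-coprime : ∀ {p} m → Coprime p ∣ m ∣ → ∀ {z} → Integral z → Multiple (+ p) (R.ι m R.* z) → Multiple (+ p) z
      cancel-coprime {p} m cop {z} Iz Mz = go (coprime-Bézout cop)
        where
        module RS = R.≈-Solver
        M∣m∣ : Multiple (+ p) (R.ι (+ ∣ m ∣) R.* z)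
        M∣m∣ with ℤₚ.+∣i∣≡i⊎+∣i∣≡-i m
        ... | inj₁ eq = Multiple-cong (R.*-congʳ {z} (R.ι-cong (sym eq))) Mz
        ... | inj₂ eq = Multiple-cong (R.trans (RS.solve 2 (λ m z → RS.:- (m RS.:* z) RS.:= (RS.:- m) RS.:* z) R.refl (R.ι m) z) (R.*-congʳ {z} (R.sym (R.trans (R.ι-cong eq) (R.ι-neg m))))) (Order.Multiple-neg 𝓞 Mz)
        scaled : ∀ a → Multiple (+ p) (R.ι (+ (a ℕ.* ∣ m ∣)) R.* z)
        scaled a = Multiple-cong (R.trans (RS.solve 3 (λ a m z → (m RS.:* z) RS.:* a RS.:= (a RS.:* m) RS.:* z) R.refl (R.ι (+ a)) (R.ι (+ ∣ m ∣)) z)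
            (R.*-congʳ {z} (R.sym (R.trans (R.ι-cong (ℤₚ.pos-* a ∣ m ∣)) (R.ι-* (+ a) (+ ∣ m ∣)))))) (Multiple-*ʳ M∣m∣ (Integral-ι (+ a)))
        scaledₚ : ∀ a → Multiple (+ p) (R.ι (+ (a ℕ.* p)) R.* z)
        scaledₚ a = Multiple-cong (R.trans (R.sym (R.*-assoc (R.ι (+ p)) (R.ι (+ a)) z)) (R.*-congʳ {z} (R.trans (R.*-comm (R.ι (+ p)) (R.ι (+ a))) (R.sym (R.trans (R.ι-cong (ℤₚ.pos-* a p)) (R.ι-* (+ a) (+ p)))))))
          (Multiple-ι* (+ p) (Integral-ι* (+ a) Iz))
        unit-difference : ∀ {a b} → 1 ℕ.+ b ≡ a → Multiple (+ p) (R.ι (+ a) R.* z) → Multiple (+ p) (R.ι (+ b) R.* z) → Multiple (+ p) z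
        unit-difference {b = b} refl Ma Mb = Multiple-cong (R.trans (RS.solve 3 (λ o b z → (o RS.:+ b) RS.:* z RS.:- b RS.:* z RS.:= o RS.:* z) R.refl R.1# (R.ι (+ b)) z) (R.*-identityˡ z))
          (Order.Multiple-sub 𝓞 Ma Mb)
        go : Bézout.Identity 1 p ∣ m ∣ → Multiple (+ p) z
        go (Bézout.+- x y eq) = unit-difference eq (scaledₚ x) (scaled y)
        go (Bézout.-+ x y eq) = unit-difference eq (scaled y) (scaledₚ x)

      module _ (w : R.Carrier) (Iw : Integral w) (m : ℤ) (m≢0 : m ≢ + 0) (δw≈m : (δ R.* w) R.≈ R.ι m) where

        -- If p divides all the traces, it divides every coordinate of z δ, hence also z δ w = m z,
        -- and `m` is prime to p.
        nondegenerate : ∀ {p} → Prime p → Coprime p ∣ m ∣ → ∀ {z} → Integral z → (∀ n → TraceDivisible p (z R.* (α R.^ n))) → Multiple (+ p) z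
        nondegenerate {p} pp cop {z} Iz div = cancel-coprime m cop Iz (Multiple-cong zδw≈ (Multiple-*ʳ Mzδ Iw))
          where
          A : ℕ → ℤ
          A n = TraceDivisible.value (div n)
          A-∣ : ∀ n → + p ℤ∣.∣ conv A e (suc n)
          A-∣ n = conv-∣ A e (suc n) (λ j _ → TraceDivisible.divisible (div j))
          q : ℕ → ℤ
          q n = ℤ∣._∣_.quotient (A-∣ n)
          zδ≈ : (z R.* δ) R.≈ ⟦ (λ n → conv A e (suc n)) ⟧
          zδ≈ = dual z A (λ n → ≈-trans (Σ-cong (λ i → *-congˡ {z i} (≈-sym (^-pointwise α n i)))) (TraceDivisible.T≈ (div n)))
          Mzδ : Multiple (+ p) (z R.* δ)
          Mzδ = Multiple-cong (R.sym (R.trans zδ≈ (R.trans (R.horner-congˡ d (λ n _ → R.trans (R.ι-cong (trans (ℤ∣._∣_.equality (A-∣ n)) (ℤₚ.*-comm (q n) (+ p)))) (R.ι-* (+ p) (q n))))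
              (R.horner-* (λ n → R.ι (q n)) (R.ι (+ p)) d α))))
            (Multiple-ι* (+ p) (_ , ⟦⟧-Height q))
          zδw≈ : ((z R.* δ) R.* w) R.≈ (R.ι m R.* z)
          zδw≈ = R.trans (R.*-assoc z δ w) (R.trans (R.*-congˡ {z} δw≈m) (R.*-comm z (R.ι m)))

        AlmostDold⇒equal : AlmostDold U → ∀ i j → l i ≈ l j
        AlmostDold⇒equal (b , 1≤b , dold) i j = ≈-trans (solve 2 (λ x y → x := (x :- y) :+ y) ≈-refl (l i) (l j))
            (≈-trans (+-congʳ (*-cancel-0 (ι-nonzero char0 bm≢0) difference≈0)) (+-identityˡ _))
          where
          -- The factor `b` gives the Dold condition, and `m = δ w` makes the product integral:
          -- `m l = (l δ) w`.
          bm : ℤ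
          bm = + b ℤ.* m
          bm≢0 : bm ≢ + 0
          bm≢0 eq = [ (λ { refl → contradiction 1≤b λ () }) ∘ ℤₚ.+-injective , m≢0 ]′ (ℤₚ.i*j≡0⇒i≡0∨j≡0 (+ b) eq)
          u : R.Carrier
          u = R.ι bm R.* l
          u-Integral : Integral u
          u-Integral = Integral-cong u≈ (Integral-ι* (+ b) (Integral-* (_ , ⟦⟧-Height (λ n → conv U e (suc n))) Iw))
            where
            module RS = R.≈-Solver
            u≈ : (R.ι (+ b) R.* (⟦ (λ n → conv U e (suc n)) ⟧ R.* w)) R.≈ u
            u≈ = R.trans (R.*-congˡ {R.ι (+ b)} (R.trans (R.*-congʳ {w} (R.sym (dual l U Σlα^n))) (R.trans (R.*-assoc l δ w) (R.*-congˡ {l} δw≈m))))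
              (R.trans (RS.solve 3 (λ b l m → b RS.:* (l RS.:* m) RS.:= (b RS.:* m) RS.:* l) R.refl (R.ι (+ b)) l (R.ι m)) (R.*-congʳ {l} (R.sym (R.ι-* (+ b) m))))
          B : ℕ → ℤ
          B n = m ℤ.* (+ b ℤ.* U n)
          B-Dold : Dold B
          B-Dold = Dold-*ˡ m (λ n → + b ℤ.* U n) dold
          T-u : ∀ n → ΣFin (u R.* (α R.^ n)) ≈ ι (B n)
          T-u n = begin
            ΣFin (λ i → (R.ι bm i * l i) * (α R.^ n) i)      ≈⟨ Σ-cong (λ i → ≈-trans (*-cong (*-congʳ (ι-pointwise bm i)) (^-pointwise α n i)) (*-assoc (ι bm) (l i) (α i ^ n))) ⟩
            ΣFin (λ i → ι bm * (l i * α i ^ n))              ≈⟨ Σ-*ˡ (ι bm) (λ i → l i * α i ^ n) ⟩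
            ι bm * ΣFin (λ i → l i * α i ^ n)                ≈⟨ *-congˡ (Σlα^n n) ⟩
            ι bm * ι (U n)                                   ≈⟨ ≈-sym (ι-* bm (U n)) ⟩
            ι (bm ℤ.* U n)                                   ≈⟨ ι-cong (trans (cong (ℤ._* U n) (ℤₚ.*-comm (+ b) m)) (ℤₚ.*-assoc m (+ b) (U n))) ⟩
            ι (B n)                                          ∎
          P : ℕ
          -- Primes above `P` cannot divide `m`, and the summand 2 provides the bound `2 ≤ P` needed
          -- in the size estimate.
          P = 2 ℕ.+ ∣ m ∣
          large-coprime : ∀ p → Prime p → P < p → Coprime p ∣ m ∣
          large-coprime p pp P<p (i∣p , i∣m) with prime⇒irreducible pp i∣p
          ... | inj₁ i≡1  = i≡1
          ... | inj₂ refl = contradiction (ℕ∣.∣⇒≤ {{ℕ.≢-nonZero (m≢0 ∘ ℤₚ.∣i∣≡0⇒i≡0)}} i∣m) (ℕₚ.<⇒≱ (ℕₚ.<-trans (ℕₚ.m<n+m ∣ m ∣ {2} (s≤s z≤n)) P<p))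
          g : ℕ → ℤ
          g = proj₁ (proj₂ u-Integral)
          u≈⟦g⟧ : u R.≈ ⟦ g ⟧
          u≈⟦g⟧ = proj₂ (proj₂ (proj₂ u-Integral))
          fixed : ∀ p → Prime p → P < p → Multiple (+ p) ((⟦ g ⟧ R.^ p) R.- ⟦ g ⟧)
          fixed p pp P<p = Multiple-cong (R.+-cong (R.^-congˡ p u≈⟦g⟧) (R.-‿cong u≈⟦g⟧))
            (frobenius-fixed isTrace pp (nondegenerate pp (large-coprime p pp P<p)) u-Integral B T-u (λ n 1≤n → Dold⇒prime-∣ {B} B-Dold pp n 1≤n))
          constant : ∀ n → n < k → g n ≡ + 0
          constant = frobenius-invariant⇒constant independent nonzero⇒unit ι≉0 P (s≤s (s≤s z≤n)) g fixed
          -- Only the coordinate of `α ^ 0` is left, and its value does not depend on the root.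
          bml≈ : ∀ i → ι bm * l i ≈ ι (g k)
          bml≈ i = begin
            ι bm * l i                          ≈⟨ *-congʳ (≈-sym (ι-pointwise bm i)) ⟩
            u i                                 ≈⟨ u≈⟦g⟧ i ⟩
            ⟦ g ⟧ i                             ≈⟨ ⟦⟧-pointwise g i ⟩
            α i * hornerℤ g k (α i) + ι (g k)   ≈⟨ +-congʳ (≈-trans (*-congˡ (horner-zero k (α i) (λ n n<k → ι-cong (constant n n<k)))) (zeroʳ (α i))) ⟩
            0# + ι (g k)                        ≈⟨ +-identityˡ _ ⟩
            ι (g k)                             ∎
          difference≈0 : ι bm * (l i - l j) ≈ 0#
          difference≈0 = ≈-trans (solve 3 (λ x y z → x :* (y :- z) := x :* y :- x :* z) ≈-refl (ι bm) (l i) (l j)) (≈-trans (+-cong (bml≈ i) (-‿cong (bml≈ j))) (-‿inverseʳ (ι (g k))))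

    almostDold⇔equal : AlmostDold U ⇔ (∀ i j → l i ≈ l j)
    almostDold⇔equal = mk⇔ (let w , Iw , m , m≢0 , eq = δ-inverse in AlmostDold⇒equal w Iw m m≢0 eq) equal⇒AlmostDold

theorem6 : ∀ {c ℓ} (K : Field c ℓ) → FieldOps.CharacteristicZero K →
    (d : ℕ) → 1 ≤ d → (r : Vec ℤ d) → (U : ℕ → ℤ) →
    SatisfiesRec r U →
    Irreducibleℚ (toℚPoly (charPoly r)) →
    (α : Fin d → Field.Carrier K) →
    (∀ i → Field._≈_ K (FieldOps.evalℤ K (charPoly r) (α i)) (Field.0# K)) →
    (∀ i j → Field._≈_ K (α i) (α j) → i ≡ j) →
    (l : Fin d → Field.Carrier K) →
    (∀ n → Field._≈_ K (FieldOps.ιℤ K (U n)) (FieldOps.ΣFin K (λ i → Field._*_ K (l i) (FieldOps.pow K (α i) n)))) →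
    (AlmostDold U ⇔ (∀ i j → Field._≈_ K (l i) (l j)))
theorem6 K char0 (suc k) _ r U _ irreducible α roots distinct l U≈ =
  Main.almostDold⇔equal K char0 k r U irreducible α roots distinct l U≈
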